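{- Let $k$ and $t$ be integers with $k\geq 2$ and $1\leq t\leq k-1$, and let $G$ be a $t$-connected graph of order $n$ with $$n\geq\frac{(2k^{2}+5k+1)t+k^{2}+5k+2}{2k}.$$ If $$|E(G)|>\binom{n-\left\lfloor\left(k+\frac{1}{2}\right)t\right\rfloor-1}{2}+t\left(\left\lfloor\left(k+\frac{1}{2}\right)t\right\rfloor+1\right),$$ then $G$ has a $\{K_{1,1},K_{1,2},\ldots,K_{1,k},\mathcal{T}(2k+1)\}$-factor.
   Context: All graphs are finite, undirected, without loops or multiple edges. $K_{1,j}$ denotes the star with $j$ leaves. For a set $\mathcal{H}$ of connected graphs, an $\mathcal{H}$-factor of $G$ is a spanning subgraph of $G$ each of whose connected components is isomorphic to an element of $\mathcal{H}$. The family $\mathcal{T}(2k+1)$ ($k\geq2$) is defined as follows. For a tree $T$, $Leaf(T)$ is its set of leaves. Let $R$ be a tree such that for every $x\in V(R)\setminus Leaf(R)$: (a) $d_{R-Leaf(R)}(x)\in\{1,3,\ldots,2k+1\}$, and (b) $2\cdot(\text{number of leaves of } R \text{ adjacent to } x)+d_{R-Leaf(R)}(x)\leq 2k+1$. From such $R$ build a tree $T_R$ by (c) inserting a new vertex of degree 2 into each edge of $R-Leaf(R)$, and (d) for every vertex $x$ of $R-Leaf(R)$ with $d_{R-Leaf(R)}(x)=2r+1<2k+1$, attaching $k-r-(\text{number of leaves of } R \text{ adjacent to } x)$ new pendant edges to $x$. Then $\mathcal{T}(2k+1)$ is the set of all trees $T_R$ over all trees $R$ satisfying (a) and (b). A $\{K_{1,1},\ldots,K_{1,k},\mathcal{T}(2k+1)\}$-factor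 is an $\mathcal{H}$-factor with $\mathcal{H}=\{K_{1,1},\ldots,K_{1,k}\}\cup\mathcal{T}(2k+1)$. -}

module Defs where

open import Data.Nat using (ℕ; zero; suc; _+_; _*_; _∸_; _≤_; _<_; _/_; _≡ᵇ_; _<ᵇ_)
open import Data.Fin using (Fin; toℕ) renaming (zero to fzero)
open import Data.List using (List; []; _∷_; length; map; allFin)
open import Data.Nat.ListAction using (sum)
open import Data.List.Relation.Unary.Unique.Propositional using (Unique)
open import Data.Bool using (Bool; true; false; T; _∧_; _∨_; not; if_then_else_)
open import Data.Unit using (⊤)
open import Data.Product using (Σ; ∃; ∃-syntax; _×_; _,_)
open import Data.Sum using (_⊎_; inj₁; inj₂)
open import Data.Empty using (⊥)
open import Relation.Binary.PropositionalEquality using (_≡_; _≢_)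
open import Function.Bundles using (_⇔_)
open import Data.Vec using () renaming (lookup to vlookup)
open import Data.Fin.Subset using (Subset; _∉_; ∣_∣)

record SimpleGraph (n : ℕ) : Set where
  field
    Adj    : Fin n → Fin n → Bool
    sym    : ∀ i j → Adj i j ≡ Adj j i
    irrefl : ∀ i → Adj i i ≡ false
open SimpleGraph public

count : {n : ℕ} → (Fin n → Bool) → ℕ
count {n} p = sum (map (λ y → if p y then 1 else 0) (allFin n))

edgeCount : {n : ℕ} → SimpleGraph n → ℕ
edgeCount {n} G =
  sum (map (λ i → count (λ j → (toℕ i <ᵇ toℕ j) ∧ Adj G i j)) (allFin n))

degree : {n : ℕ} → SimpleGraph n → Fin n → ℕ
degree G x = count (λ y → Adj G x y)

data Walk {n : ℕ} (A : Fin n → Fin n → Bool) : Fin n → Fin n → Set where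
  here : ∀ {u} → Walk A u u
  step : ∀ {u v w} → T (A u v) → Walk A v w → Walk A u w

Connected : {n : ℕ} → SimpleGraph n → Set
Connected {n} G = (0 < n) × (∀ u w → Walk (Adj G) u w)

deleteAdj : {n : ℕ} → SimpleGraph n → Subset n → Fin n → Fin n → Bool
deleteAdj G S u v = Adj G u v ∧ not (vlookup S u) ∧ not (vlookup S v)

TConnected : ℕ → {n : ℕ} → SimpleGraph n → Set
TConnected t {n} G =
  (t < n) ×
  (∀ (S : Subset n) → ∣ S ∣ < t →
     ∀ u w → u ∉ S → w ∉ S → Walk (deleteAdj G S) u w)

PathFrom : {n : ℕ} → SimpleGraph n → Fin n → Fin n → List (Fin n) → Set
PathFrom G first x []       = T (Adj G x first)
PathFrom G first x (y ∷ ys) = T (Adj G x y) × PathFrom G first y ys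

IsCycle : {n : ℕ} → SimpleGraph n → List (Fin n) → Set
IsCycle G []       = ⊥
IsCycle G (x ∷ xs) = (2 ≤ length xs) × Unique (x ∷ xs) × PathFrom G x x xs

Acyclic : {n : ℕ} → SimpleGraph n → Set
Acyclic {n} G = ∀ (c : List (Fin n)) → IsCycle G c → ⊥

IsTree : {n : ℕ} → SimpleGraph n → Set
IsTree G = Connected G × Acyclic G

record Graph : Set₁ where
  field
    V   : Set
    Adj : V → V → Set

Star : ℕ → Graph
Star j = record
  { V   = Fin (suc j)
  ; Adj = λ a b → (a ≡ fzero × b ≢ fzero) ⊎ (b ≡ fzero × a ≢ fzero) }

module TreeFamily {r : ℕ} (R : SimpleGraph r) where

  isLeaf : Fin r → Bool
  isLeaf x = degree R x ≡ᵇ 1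

  dCore : Fin r → ℕ
  dCore x = count (λ y → Adj R x y ∧ not (isLeaf y))

  nLeaves : Fin r → ℕ
  nLeaves x = count (λ y → Adj R x y ∧ isLeaf y)

  CondA : ℕ → Set
  CondA k = ∀ x → isLeaf x ≡ false →
              Σ ℕ λ s → (s ≤ k) × (dCore x ≡ 2 * s + 1)

  CondB : ℕ → Set
  CondB k = ∀ x → isLeaf x ≡ false → 2 * nLeaves x + dCore x ≤ 2 * k + 1

  -- subdivision vertices: one per edge {a,b} (a < b) of R - Leaf(R)
  SubV : Set
  SubV = Σ (Fin r) λ a → Σ (Fin r) λ b →
           T ((toℕ a <ᵇ toℕ b) ∧ Adj R a b ∧ not (isLeaf a) ∧ not (isLeaf b))

  -- new pendant vertices: for a non-leaf x with d_{R-Leaf(R)}(x) = 2s+1,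
  -- k - s - (number of leaves adjacent to x) of them (this is 0 when s = k,
  -- by (b)), where s = d_{R-Leaf(R)}(x) / 2
  NewV : ℕ → Set
  NewV k = Σ (Fin r) λ x → T (not (isLeaf x)) × Fin (k ∸ dCore x / 2 ∸ nLeaves x)

  TV : ℕ → Set
  TV k = Fin r ⊎ (SubV ⊎ NewV k)

  TAdj : (k : ℕ) → TV k → TV k → Set
  TAdj k (inj₁ x) (inj₁ y) = T (Adj R x y ∧ (isLeaf x ∨ isLeaf y))
  TAdj k (inj₁ x) (inj₂ (inj₁ (a , b , _))) = (x ≡ a) ⊎ (x ≡ b)
  TAdj k (inj₂ (inj₁ (a , b , _))) (inj₁ x) = (x ≡ a) ⊎ (x ≡ b)
  TAdj k (inj₁ x) (inj₂ (inj₂ (y , _ , _))) = x ≡ y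
  TAdj k (inj₂ (inj₂ (y , _ , _))) (inj₁ x) = x ≡ y
  TAdj k _ _ = ⊥

  TR : ℕ → Graph
  TR k = record { V = TV k ; Adj = TAdj k }

ComponentIso : {n : ℕ} → SimpleGraph n → Fin n → Graph → Set
ComponentIso {n} F v H =
  Σ (Graph.V H → Fin n) λ φ →
    (∀ a b → φ a ≡ φ b → a ≡ b) ×
    (∀ a → Walk (Adj F) v (φ a)) ×
    (∀ w → Walk (Adj F) v w → ∃ λ a → φ a ≡ w) ×
    (∀ a b → T (Adj F (φ a) (φ b)) ⇔ Graph.Adj H a b)

ComponentOK : ℕ → {n : ℕ} → SimpleGraph n → Fin n → Set
ComponentOK k F v =
  (Σ ℕ λ j → (1 ≤ j) × (j ≤ k) × ComponentIso F v (Star j))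
  ⊎
  (Σ ℕ λ r → Σ (SimpleGraph r) λ R →
     IsTree R × TreeFamily.CondA R k × TreeFamily.CondB R k ×
     ComponentIso F v (TreeFamily.TR R k))

Spanning⊆ : {n : ℕ} → SimpleGraph n → SimpleGraph n → Set
Spanning⊆ F G = ∀ i j → T (Adj F i j) → T (Adj G i j)

HasStarTreeFactor : ℕ → {n : ℕ} → SimpleGraph n → Set
HasStarTreeFactor k {n} G =
  Σ (SimpleGraph n) λ F → Spanning⊆ F G × (∀ v → ComponentOK k F v)

{-# OPTIONS --safe #-}
module Submission where

-- Write i(G - S) for the number of isolated vertices of G - S. First, i(G - S) ≤ (k + 1/2)|S|
-- for all S: if |S| < t, then G - S is connected and has no isolated vertex, and if |S| ≥ t,
-- a violation leaves G with too few edges, the worst case being |S| = t.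
--
-- Choose S with i(G - S) - |S| maximal and let I be the isolated vertices of G - S. By Hall's
-- theorem S is matched into I, the matching extends to a flow in which every vertex of I sends
-- two units to S and every vertex of S receives between 2 and 2k + 1 units, and the remaining
-- vertices carry a permutation along edges, hence a {K_{1,1}, K_{1,2}}-factor. This gives a
-- set of centres such that every other vertex sends two units to adjacent centres and every
-- centre receives between 2 and 2k + 1. Minimise the number of vertices that send their two
-- units to different centres. These vertices are then the edges of a forest on the centres,
-- and every centre they touch receives exactly 2k + 1 units: otherwise units can be moved along
-- a cycle, or along a path to a centre with room. So the components of the support of the flow
-- are stars and the trees T_R, the vertices that split their units being the subdivision vertices.

open import Defs
open import Data.Nat using (ℕ; zero; suc; _+_; _*_; _∸_; _≤_; _<_; _/_; z≤n; s≤s; _≤?_; _<?_; _<ᵇ_)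
open import Data.Nat.Properties hiding (_≟_)
open import Data.Nat.DivMod using (m/n*n≤m; _%_; m*n%n≡0; m*n/n≡m; +-distrib-/)
open import Data.Nat.Combinatorics using (_C_; nCk+nC[k+1]≡[n+1]C[k+1]; nC1≡n)
open import Data.Nat.Tactic.RingSolver using (solve-∀)
open import Data.Bool using (Bool; true; false; T; if_then_else_; T?; _∧_; _∨_; not)
open import Data.Bool.Properties using (T-∧; T-∨; T-not-≡; T-irrelevant)
open import Data.Fin using (Fin; zero; suc; toℕ; _≟_; _↑ˡ_; _↑ʳ_; splitAt)
open import Data.Fin.Properties using (any?; all?; toℕ-injective; splitAt-↑ˡ; splitAt-↑ʳ) renaming (suc-injective to fsuc-injective)
open import Data.Fin.Subset using (Subset; ∣_∣) renaming (_∉_ to _∉ˢ_)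
open import Data.Maybe using (Maybe; just; nothing)
open import Data.Maybe.Properties using (just-injective; ≡-dec)
open import Data.Vec using (Vec; []; _∷_; lookup; tabulate; _[_]≔_)
open import Data.Vec.Properties using (lookup∘tabulate; lookup∘update; lookup∘update′; []=⇒lookup)
open import Data.Product using (Σ; ∃; _×_; _,_; proj₁; proj₂)
open import Data.Product.Properties using () renaming (≡-dec to ×-≡-dec)
open import Data.Sum using (_⊎_; inj₁; inj₂; [_,_]′)
open import Data.Empty using (⊥; ⊥-elim)
open import Data.Unit using (⊤; tt)
open import Relation.Binary.Definitions using (Tri; tri<; tri≈; tri>)
open import Relation.Nullary using (¬_; Dec; yes; no; does)
open import Relation.Nullary.Decidable using (_×-dec_; _⊎-dec_; _→-dec_; ¬?; map′; ⌊_⌋; toWitness; fromWitness)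
open import Relation.Binary.PropositionalEquality using (_≡_; _≢_; refl; trans; cong; cong₂; subst; subst₂; module ≡-Reasoning) renaming (sym to ≡sym)
open import Function using (_∘_)
open import Function.Bundles using (_⇔_; mk⇔; Equivalence)
import Data.List as List
import Data.List.Properties as List
open import Data.List using (List; []; _∷_; length)
open import Data.List.Relation.Unary.All using (All; []; _∷_)
open import Data.List.Relation.Unary.AllPairs using ([]; _∷_)
open import Data.List.Relation.Unary.Unique.Propositional using (Unique)
open import Data.Nat.ListAction using () renaming (sum to lsum)
open import Algebra.Properties.CommutativeMonoid.Sum +-0-commutativeMonoid using () renaming (sum to ∑; ∑-distrib-+ to ∑-+; ∑-comm to ∑-swap; sum-cong-≗ to ∑-cong)

-- Counting in half units makes (k + 1/2)|S| integral: a sender has two units and a centre has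
-- capacity 2k + 1. It also explains the tree family. In T_R a non-leaf x of R with 2r + 1 non-leaf
-- neighbours meets 2r + 1 subdivision vertices and k - r pendant vertices, so it receives (2r + 1)
-- + 2(k - r) = 2k + 1 units. The trees T_R are thus the tree components with saturated centres, and
-- when R is read off from such a component, clause (d) has nothing left to attach.
--
-- The lower bound of two units, which gives every star a leaf, is the delicate side, since Hall's
-- theorem only limits loads from above. It is secured by augmenting from a doubled matching,
-- because augmentation never lowers a load. The matching and the permutation both come from one
-- exchange: a violator of Hall's condition would show how to relabel vertices at a lower cost.
--
-- In the edge count the order hypothesis settles |S| = t + 1, and t < k settles |S| at least t + 2.

private
  variable
    m n : ℕ
    P Q : Set


-- Finite sums

-- The Iverson bracket; cardinalities of decidable sets are sums of it.
⟦_⟧ : Dec P → ℕ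
⟦ d ⟧ = if does d then 1 else 0

⟦⟧-yes : (d : Dec P) → P → ⟦ d ⟧ ≡ 1
⟦⟧-yes (yes _) _ = refl
⟦⟧-yes (no ¬p) p = ⊥-elim (¬p p)

⟦⟧-no : (d : Dec P) → ¬ P → ⟦ d ⟧ ≡ 0
⟦⟧-no (yes p) ¬p = ⊥-elim (¬p p)
⟦⟧-no (no _)  _  = refl

⟦⟧-mono : (d : Dec P) (e : Dec Q) → (P → Q) → ⟦ d ⟧ ≤ ⟦ e ⟧
⟦⟧-mono (no _)  _       _ = z≤n
⟦⟧-mono (yes _) (yes _) _ = ≤-refl
⟦⟧-mono (yes p) (no ¬q) h = ⊥-elim (¬q (h p))

⟦⟧-cong : (d : Dec P) (e : Dec Q) → (P → Q) → (Q → P) → ⟦ d ⟧ ≡ ⟦ e ⟧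
⟦⟧-cong (yes p) e pq qp = ≡sym (⟦⟧-yes e (pq p))
⟦⟧-cong (no ¬p) e pq qp = ≡sym (⟦⟧-no e (¬p ∘ qp))

⟦⟧≤1 : (d : Dec P) → ⟦ d ⟧ ≤ 1
⟦⟧≤1 (yes _) = ≤-refl
⟦⟧≤1 (no _)  = z≤n

⟦⟧-pos : (d : Dec P) → 1 ≤ ⟦ d ⟧ → P
⟦⟧-pos (yes p) _ = p

⟦⟧-split : (d : Dec P) (q : Dec Q) → ⟦ d ⟧ ≡ ⟦ d ×-dec q ⟧ + ⟦ d ×-dec ¬? q ⟧
⟦⟧-split (yes _) (yes _) = refl
⟦⟧-split (yes _) (no _)  = refl
⟦⟧-split (no _)  (yes _) = refl
⟦⟧-split (no _)  (no _)  = refl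

∑-mono : {f g : Fin n → ℕ} → (∀ i → f i ≤ g i) → ∑ f ≤ ∑ g
∑-mono {zero}  h = z≤n
∑-mono {suc n} h = +-mono-≤ (h zero) (∑-mono (h ∘ suc))

∑-zero : {f : Fin n → ℕ} → (∀ i → f i ≡ 0) → ∑ f ≡ 0
∑-zero {zero}  h = refl
∑-zero {suc n} h = cong₂ _+_ (h zero) (∑-zero (h ∘ suc))

∑-const : (c : ℕ) → ∑ {n} (λ _ → c) ≡ n * c
∑-const {zero}  c = refl
∑-const {suc n} c = cong (c +_) (∑-const {n} c)

∑-* : (c : ℕ) (f : Fin n → ℕ) → ∑ (λ i → c * f i) ≡ c * ∑ f
∑-* {zero}  c f = ≡sym (*-zeroʳ c)
∑-* {suc n} c f = trans (cong (c * f zero +_) (∑-* c (f ∘ suc))) (≡sym (*-distribˡ-+ c _ _))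

∑-term : (f : Fin n → ℕ) (i : Fin n) → f i ≤ ∑ f
∑-term f zero    = m≤m+n _ _
∑-term f (suc i) = ≤-trans (∑-term (f ∘ suc) i) (m≤n+m _ _)

∑-single : (f : Fin n → ℕ) (i : Fin n) → (∀ j → j ≢ i → f j ≡ 0) → ∑ f ≡ f i
∑-single f zero    h = trans (cong (f zero +_) (∑-zero (λ j → h (suc j) (λ ())))) (+-identityʳ _)
∑-single f (suc i) h = cong₂ _+_ (h zero (λ ())) (∑-single (f ∘ suc) i (λ j j≢i → h (suc j) (λ { refl → j≢i refl })))

∑-pos : (f : Fin n → ℕ) → 1 ≤ ∑ f → ∃ λ i → 1 ≤ f i
∑-pos {suc n} f h with f zero in eq
... | suc _ = zero , subst (1 ≤_) (≡sym eq) (s≤s z≤n)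
... | zero with ∑-pos (f ∘ suc) h
...   | i , q = suc i , q

-- Adding the other sum's term at `y` on each side avoids truncated subtraction. Effects of local
-- changes on loads and inflows are all stated in this style.
∑-change : (f g : Fin n → ℕ) (y : Fin n) → (∀ u → u ≢ y → f u ≡ g u) → ∑ f + g y ≡ ∑ g + f y
∑-change f g zero h
  rewrite ∑-cong {x = f ∘ suc} {y = g ∘ suc} (λ u → h (suc u) (λ ())) = swap (f zero) _ (g zero)
  where
  swap : ∀ a b c → (a + b) + c ≡ (c + b) + a
  swap = solve-∀
∑-change f g (suc y) h
  rewrite h zero (λ ()) | +-assoc (g zero) (∑ (f ∘ suc)) (g (suc y)) | +-assoc (g zero) (∑ (g ∘ suc)) (f (suc y))
  = cong (g zero +_) (∑-change (f ∘ suc) (g ∘ suc) y (λ u u≢y → h (suc u) (λ { refl → u≢y refl })))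

∑-two : (f : Fin n → ℕ) {i j : Fin n} → i ≢ j → f i + f j ≤ ∑ f
∑-two f {zero}  {zero}  i≢j = ⊥-elim (i≢j refl)
∑-two f {zero}  {suc j} i≢j = +-mono-≤ ≤-refl (∑-term (f ∘ suc) j)
∑-two f {suc i} {zero}  i≢j = ≤-trans (≤-reflexive (+-comm (f (suc i)) _)) (+-mono-≤ (≤-refl {f zero}) (∑-term (f ∘ suc) i))
∑-two f {suc i} {suc j} i≢j = ≤-trans (∑-two (f ∘ suc) (i≢j ∘ cong suc)) (m≤n+m _ _)

∑≤1 : (f : Fin n → ℕ) → (∀ i → f i ≤ 1) → (∀ i j → 1 ≤ f i → 1 ≤ f j → i ≡ j) → ∑ f ≤ 1
∑≤1 {zero}  f h u = z≤n
∑≤1 {suc n} f h u with f zero in eq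
... | zero = ∑≤1 (f ∘ suc) (h ∘ suc) (λ i j p q → fsuc-injective (u (suc i) (suc j) p q))
... | suc a = ≤-trans (≤-reflexive (trans (cong (suc a +_) (∑-zero z)) (+-identityʳ _))) (subst (_≤ 1) eq (h zero))
  where
  z : ∀ i → f (suc i) ≡ 0
  z i with f (suc i) in eq′
  ... | zero  = refl
  ... | suc _ with u zero (suc i) (subst (1 ≤_) (≡sym eq) (s≤s z≤n)) (subst (1 ≤_) (≡sym eq′) (s≤s z≤n))
  ...   | ()

∑-δ : (i : Fin n) → ∑ (λ j → ⟦ i ≟ j ⟧) ≡ 1
∑-δ i = trans (∑-single _ i (λ j j≢i → ⟦⟧-no (i ≟ j) (j≢i ∘ ≡sym))) (⟦⟧-yes (i ≟ i) refl)

-- Double counting of the related pairs: each `x` in `A` has at least one, each `y` in `B` at most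
-- one. Two uses in opposite directions give an equality of cardinalities.
∑-rel : {A : Fin m → Set} {B : Fin n → Set} {ρ : Fin m → Fin n → Set}
        (A? : ∀ x → Dec (A x)) (B? : ∀ y → Dec (B y)) (ρ? : ∀ x y → Dec (ρ x y)) →
        (∀ {x} → A x → ∃ λ y → B y × ρ x y) →
        (∀ {x x′ y} → A x → A x′ → ρ x y → ρ x′ y → x ≡ x′) →
        ∑ (λ x → ⟦ A? x ⟧) ≤ ∑ (λ y → ⟦ B? y ⟧)
∑-rel {m} {n} {A} {B} {ρ} A? B? ρ? total inj = begin
  ∑ (λ x → ⟦ A? x ⟧)
    ≤⟨ ∑-mono lower ⟩
  ∑ (λ x → ∑ λ y → ⟦ pair? x y ⟧)
    ≡⟨ ∑-swap (λ x y → ⟦ pair? x y ⟧) ⟩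
  ∑ (λ y → ∑ λ x → ⟦ pair? x y ⟧)
    ≤⟨ ∑-mono upper ⟩
  ∑ (λ y → ⟦ B? y ⟧) ∎
  where
  open ≤-Reasoning
  pair? : ∀ x y → Dec (A x × B y × ρ x y)
  pair? x y = A? x ×-dec (B? y ×-dec ρ? x y)
  lower : ∀ x → ⟦ A? x ⟧ ≤ ∑ λ y → ⟦ pair? x y ⟧
  lower x with A? x in eq
  ... | no _  = z≤n
  ... | yes a = let y , b , r = total a in
    ≤-trans (≤-reflexive (≡sym (⟦⟧-yes (yes a ×-dec (B? y ×-dec ρ? x y)) (a , b , r))))
            (∑-term (λ y → ⟦ yes a ×-dec (B? y ×-dec ρ? x y) ⟧) y)
  upper : ∀ y → (∑ λ x → ⟦ pair? x y ⟧) ≤ ⟦ B? y ⟧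
  upper y with B? y
  ... | yes b = ∑≤1 _ (λ x → ⟦⟧≤1 (A? x ×-dec (yes b ×-dec ρ? x y)))
      (λ x x′ p p′ → same (⟦⟧-pos (A? x ×-dec (yes b ×-dec ρ? x y)) p) (⟦⟧-pos (A? x′ ×-dec (yes b ×-dec ρ? x′ y)) p′))
    where
    same : ∀ {x x′} → A x × B y × ρ x y → A x′ × B y × ρ x′ y → x ≡ x′
    same (a , _ , r) (a′ , _ , r′) = inj a a′ r r′
  ... | no ¬b = ≤-reflexive (∑-zero (λ x → ⟦⟧-no (A? x ×-dec (no ¬b ×-dec ρ? x y)) (λ { (_ , b , _) → ¬b b })))

lsum-tabulate : (f : Fin n → ℕ) → lsum (List.tabulate f) ≡ ∑ f
lsum-tabulate {zero}  f = refl
lsum-tabulate {suc n} f = cong (f zero +_) (lsum-tabulate (f ∘ suc))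

lsum-allFin : (f : Fin n → ℕ) → lsum (List.map f (List.allFin n)) ≡ ∑ f
lsum-allFin f = trans (cong lsum (List.map-tabulate (λ i → i) f)) (lsum-tabulate f)

count-∑ : (p : Fin n → Bool) → count p ≡ ∑ (λ x → ⟦ T? (p x) ⟧)
count-∑ p = lsum-allFin (λ y → if p y then 1 else 0)

-- Exhaustive search and reachability

-- Constructive stand-in for choosing an extremal object. The candidate labellings, maps and flows
-- are vectors, so that they inherit this property from their entries.
Searchable : Set → Set₁
Searchable A = {P : A → Set} → (∀ x → Dec (P x)) → Dec (∃ P)

search-Vec : {A : Set} → Searchable A → Searchable (Vec A n)
search-Vec {zero}  search P? = map′ (λ p → [] , p) (λ { ([] , p) → p }) (P? [])
search-Vec {suc n} search P? =
  map′ (λ { (x , xs , p) → x ∷ xs , p }) (λ { (x ∷ xs , p) → x , xs , p })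
       (search (λ x → search-Vec search (λ xs → P? (x ∷ xs))))

search-× : {A B : Set} → Searchable A → Searchable B → Searchable (A × B)
search-× sA sB P? =
  map′ (λ { (x , y , p) → (x , y) , p }) (λ { ((x , y) , p) → x , y , p })
       (sA (λ x → sB (λ y → P? (x , y))))

argmin : {A : Set} → Searchable A → {V : A → Set} → (∀ x → Dec (V x)) → (μ : A → ℕ) →
         ∀ x → V x → ∃ λ y → V y × (∀ z → V z → μ y ≤ μ z)
argmin {A} search {V} V? μ x v = go (suc (μ x)) x v ≤-refl
  where
  go : ∀ b x → V x → μ x < b → ∃ λ y → V y × (∀ z → V z → μ y ≤ μ z)
  go (suc b) x v (s≤s lt) with search (λ y → V? y ×-dec (μ y <? μ x))
  ... | yes (y , vy , yx) = go b y vy (≤-trans yx lt)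
  ... | no none           = x , v , λ z vz → ≮⇒≥ (λ lt′ → none (z , vz , lt′))

module _ (E : Fin m → Fin m → Set) (v : Fin m) where

  data Path : ℕ → Fin m → Set where
    start : Path 0 v
    _▷_   : ∀ {l u w} → Path l u → E u w → Path (suc l) w

module _ {E : Fin m → Fin m → Set} {v : Fin m} where

  _∈ᵖ_ : ∀ {l w} → Fin m → Path E v l w → Set
  x ∈ᵖ start            = x ≡ v
  x ∈ᵖ (_▷_ {w = w} p _) = x ≡ w ⊎ x ∈ᵖ p

  Simple : ∀ {l w} → Path E v l w → Set
  Simple start             = ⊤
  Simple (_▷_ {w = w} p _) = Simple p × ¬ (w ∈ᵖ p)

  start∈ : ∀ {l w} (p : Path E v l w) → v ∈ᵖ p
  start∈ start   = refl
  start∈ (p ▷ _) = inj₂ (start∈ p)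

-- Closedness yields violators of Hall's condition. Paths are simple because rerouting along a path
-- with a repeated vertex would overwrite its own changes.
record Reachable (E : Fin m → Fin m → Set) (v : Fin m) : Set₁ where
  field
    In     : Fin m → Set
    In?    : ∀ u → Dec (In u)
    source : In v
    path   : ∀ {u} → In u → ∃ λ l → Σ (Path E v l u) Simple
    closed : ∀ {u w} → In u → E u w → In w

reachable : {E : Fin m → Fin m → Set} → (∀ u w → Dec (E u w)) → ∀ v → Reachable E v
reachable {m} {E} E? v =
  go _ (λ u → u ≡ v) (_≟ v) refl (λ { refl → 0 , start , tt , λ _ e → e }) ≤-refl
  where
  -- Paths stay inside `Z`, so appending a vertex from outside keeps them simple; `b` bounds the
  -- complement of `Z`.
  go : ∀ b (Z : Fin m → Set) (Z? : ∀ u → Dec (Z u)) → Z v →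
       (∀ {u} → Z u → ∃ λ l → Σ (Path E v l u) λ p → Simple p × (∀ x → x ∈ᵖ p → Z x)) →
       ∑ (λ u → ⟦ ¬? (Z? u) ⟧) ≤ b → Reachable E v
  go b Z Z? zv paths size
    with any? (λ u → any? (λ w → Z? u ×-dec (E? u w ×-dec ¬? (Z? w))))
  ... | no none = record
        { In = Z ; In? = Z? ; source = zv
        ; path = λ z → let l , p , s , _ = paths z in l , p , s
        ; closed = λ {u} {w} z e → in-Z u w z e (Z? w) }
    where
    in-Z : ∀ u w → Z u → E u w → Dec (Z w) → Z w
    in-Z u w z e (yes z′) = z′
    in-Z u w z e (no ¬z)  = ⊥-elim (none (u , w , z , e , ¬z))
  ... | yes (u , w , zu , e , ¬zw) = grow b size
    where
    Z′ : Fin m → Set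
    Z′ x = x ≡ w ⊎ Z x
    Z′? : ∀ x → Dec (Z′ x)
    Z′? x = (x ≟ w) ⊎-dec Z? x
    smaller : suc (∑ (λ x → ⟦ ¬? (Z′? x) ⟧)) ≤ ∑ (λ x → ⟦ ¬? (Z? x) ⟧)
    smaller = begin
      suc (∑ (λ x → ⟦ ¬? (Z′? x) ⟧))
        ≡⟨ cong (_+ ∑ (λ x → ⟦ ¬? (Z′? x) ⟧)) (≡sym (∑-δ w)) ⟩
      ∑ (λ x → ⟦ w ≟ x ⟧) + ∑ (λ x → ⟦ ¬? (Z′? x) ⟧)
        ≡⟨ ≡sym (∑-+ (λ x → ⟦ w ≟ x ⟧) (λ x → ⟦ ¬? (Z′? x) ⟧)) ⟩
      ∑ (λ x → ⟦ w ≟ x ⟧ + ⟦ ¬? (Z′? x) ⟧)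
        ≤⟨ ∑-mono pointwise ⟩
      ∑ (λ x → ⟦ ¬? (Z? x) ⟧) ∎
      where
      open ≤-Reasoning
      pointwise : ∀ x → ⟦ w ≟ x ⟧ + ⟦ ¬? (Z′? x) ⟧ ≤ ⟦ ¬? (Z? x) ⟧
      pointwise x with w ≟ x
      ... | yes refl = ≤-reflexive (trans (cong (1 +_) (⟦⟧-no (¬? (Z′? w)) (λ h → h (inj₁ refl))))
                                          (≡sym (⟦⟧-yes (¬? (Z? w)) ¬zw)))
      ... | no _ = ⟦⟧-mono (¬? (Z′? x)) (¬? (Z? x)) (λ h z → h (inj₂ z))
    paths′ : ∀ {x} → Z′ x → ∃ λ l → Σ (Path E v l x) λ p → Simple p × (∀ y → y ∈ᵖ p → Z′ y)
    paths′ (inj₂ z) = let l , p , s , h = paths z in l , p , s , λ y y∈ → inj₂ (h y y∈)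
    paths′ (inj₁ refl) = let l , p , s , h = paths zu in
      suc l , p ▷ e , (s , λ w∈ → ¬zw (h w w∈)) ,
      λ { y (inj₁ eq) → inj₁ eq ; y (inj₂ y∈) → inj₂ (h y y∈) }
    grow : ∀ b → ∑ (λ x → ⟦ ¬? (Z? x) ⟧) ≤ b → Reachable E v
    grow zero    le = ⊥-elim (n≮0 (≤-trans smaller le))
    grow (suc b) le = go b Z′ Z′? (inj₂ zv) paths′ (≤-pred (≤-trans smaller le))

-- Hall's theorem with capacities

module Assignment (E : Fin m → Fin n → Set) (E? : ∀ u c → Dec (E u c)) (cap : ℕ) where

  State : Set
  State = Vec (Maybe (Fin n)) m

  _sends_to_ : State → Fin m → Fin n → Set
  f sends u to c = lookup f u ≡ just c

  sends? : ∀ f u c → Dec (f sends u to c)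
  sends? f u c = ≡-dec _≟_ (lookup f u) (just c)

  load : State → Fin n → ℕ
  load f c = ∑ λ u → ⟦ sends? f u c ⟧

  Valid : State → Set
  Valid f = (∀ {u c} → f sends u to c → E u c) × (∀ c → load f c ≤ cap)

  Assigned : State → Fin m → Set
  Assigned f u = ∃ λ c → f sends u to c

  assigned? : ∀ f u → Dec (Assigned f u)
  assigned? f u = any? (sends? f u)

  unassigned : ∀ f u → ¬ Assigned f u → lookup f u ≡ nothing
  unassigned f u ¬a with lookup f u
  ... | nothing = refl
  ... | just c  = ⊥-elim (¬a (c , refl))

  none : State
  none = tabulate (λ _ → nothing)

  none-empty : ∀ {u c} → ¬ none sends u to c
  none-empty {u} e with trans (≡sym (lookup∘tabulate (λ _ → nothing) u)) e
  ... | ()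

  none-valid : Valid none
  none-valid = (λ {u} {c} e → ⊥-elim (none-empty {u} {c} e)) ,
               λ c → ≤-trans (≤-reflexive (∑-zero (λ u → ⟦⟧-no (sends? none u c) (none-empty {u} {c})))) z≤n

  -- `u` could displace `w`. This is two steps of the usual bipartite alternating path taken at
  -- once.
  Alternating : State → Fin m → Fin m → Set
  Alternating f u w = ∃ λ c → E u c × f sends w to c

  load-update : ∀ f u c x →
    load f x + ⟦ c ≟ x ⟧ ≡ load (f [ u ]≔ just c) x + ⟦ sends? f u x ⟧
  load-update f u c x = trans (cong (load f x +_) new)
    (∑-change (λ w → ⟦ sends? f w x ⟧) (λ w → ⟦ sends? f′ w x ⟧) u
      (λ w w≢u → ⟦⟧-cong (sends? f w x) (sends? f′ w x)
        (trans (lookup∘update′ w≢u f _)) (trans (≡sym (lookup∘update′ w≢u f _)))))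
    where
    f′ : State
    f′ = f [ u ]≔ just c
    new : ⟦ c ≟ x ⟧ ≡ ⟦ sends? f′ u x ⟧
    new = ⟦⟧-cong (c ≟ x) (sends? f′ u x)
      (λ { refl → lookup∘update u f _ })
      (λ eq → just-injective (trans (≡sym (lookup∘update u f (just c))) eq))

  update-valid : ∀ {f u c} → Valid f → E u c → load f c < cap → Valid (f [ u ]≔ just c)
  update-valid {f} {u} {c} (edge , le) e lt = edge′ , le′
    where
    f′ : State
    f′ = f [ u ]≔ just c
    edge′ : ∀ {w x} → f′ sends w to x → E w x
    edge′ {w} {x} eq with w ≟ u
    ... | no w≢u = edge (trans (≡sym (lookup∘update′ w≢u f _)) eq)
    ... | yes refl = subst (E u) (just-injective (trans (≡sym (lookup∘update u f (just c))) eq)) e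
    le′ : ∀ x → load f′ x ≤ cap
    le′ x with c ≟ x | load-update f u c x
    ... | yes refl | eq = ≤-trans (m≤m+n _ _) (≤-trans (≤-reflexive (≡sym eq)) (≤-trans (≤-reflexive (+-comm _ 1)) lt))
    ... | no _     | eq = ≤-trans (m≤m+n _ _) (≤-trans (≤-reflexive (≡sym eq)) (≤-trans (≤-reflexive (+-identityʳ _)) (le x)))

  -- A step of the path depends only on the current target of its later vertex, so reassigning a
  -- vertex off the path disturbs nothing.
  transport : ∀ {f u c v l w} (p : Path (Alternating f) v l w) → ¬ (u ∈ᵖ p) → Simple p →
    Σ (Path (Alternating (f [ u ]≔ just c)) v l w) λ p′ → Simple p′ × (∀ x → x ∈ᵖ p′ → x ∈ᵖ p)
  transport start u∉ s = start , tt , λ _ e → e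
  transport {f} {u} {c₁} (_▷_ {w = w} p (c , e , eq)) u∉ (s , w∉) =
    let p′ , s′ , sub = transport {f} {u} {c₁} p (λ u∈ → u∉ (inj₂ u∈)) s
    in p′ ▷ (c , e , trans (lookup∘update′ (λ w≡u → u∉ (inj₁ (≡sym w≡u))) f _) eq) ,
       (s′ , λ w∈ → w∉ (sub _ w∈)) ,
       λ { x (inj₁ q) → inj₁ q ; x (inj₂ q) → inj₂ (sub x q) }

  -- Works from the far end: `u` moves to `c`, which has room, and frees a unit at its old target
  -- for the preceding vertex of the path. Intermediate targets lose one sender and gain one, so
  -- only the load of `c` changes, and no load drops.
  augment : ∀ l {f v u c} → Valid f → lookup f v ≡ nothing → (p : Path (Alternating f) v l u) →
    Simple p → E u c → load f c < cap →
    Σ State λ f′ → Valid f′ × Assigned f′ v × (∀ w → Assigned f w → Assigned f′ w) ×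
                   (∀ x → load f x + ⟦ c ≟ x ⟧ ≡ load f′ x)
  augment zero {f} {v} {c = c} valid none start _ e lt =
    f [ v ]≔ just c , update-valid {f} valid e lt , (c , lookup∘update v f _) , keep ,
    λ x → trans (load-update f v c x)
                (trans (cong (load (f [ v ]≔ just c) x +_)
                             (⟦⟧-no (sends? f v x) (λ eq → nothing≢just (trans (≡sym none) eq))))
                       (+-identityʳ _))
    where
    nothing≢just : ∀ {x : Fin n} → nothing ≢ just x
    nothing≢just ()
    keep : ∀ w → Assigned f w → Assigned (f [ v ]≔ just c) w
    keep w (x , eq) with w ≟ v
    ... | yes refl = c , lookup∘update v f _
    ... | no w≢v   = x , trans (lookup∘update′ w≢v f _) eq
  augment (suc l) {f} {v} {u} {c} valid none (p ▷ (c₀ , e₀ , eq₀)) (s , u∉) e lt =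
    let p′ , s′ , _ = transport {f} {u} {c} p u∉ s
        f₂ , valid₂ , v₂ , keep₂ , load₂ =
          augment l {f [ u ]≔ just c} (update-valid {f} valid e lt) (trans (lookup∘update′ v≢u f _) none) p′ s′ e₀ room
    in f₂ , valid₂ , v₂ , (λ w a → keep₂ w (keep w a)) ,
       λ x → trans (load-update f u c x)
                   (trans (cong (load f₁ x +_) (⟦⟧-cong (sends? f u x) (c₀ ≟ x)
                                                 (λ eq → just-injective (trans (≡sym eq₀) eq))
                                                 (λ { refl → eq₀ })))
                          (load₂ x))
    where
    f₁ : State
    f₁ = f [ u ]≔ just c
    v≢u : v ≢ u
    v≢u refl = u∉ (start∈ p)
    keep : ∀ w → Assigned f w → Assigned f₁ w
    keep w (x , eq) with w ≟ u
    ... | yes refl = c , lookup∘update u f _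
    ... | no w≢u   = x , trans (lookup∘update′ w≢u f _) eq
    -- Either `c₀` is `c` and its load has not changed, or `u` has just left it.
    room : load f₁ c₀ < cap
    room with c ≟ c₀ | load-update f u c c₀
    ... | yes refl | eq = subst (_< cap) (+-cancelʳ-≡ 1 _ _ (trans eq (cong (load f₁ c +_) (⟦⟧-yes (sends? f u c) eq₀)))) lt
    ... | no _     | eq = ≤-trans (≤-reflexive (trans (+-comm 1 _)
                            (trans (cong (load f₁ c₀ +_) (≡sym (⟦⟧-yes (sends? f u c₀) eq₀)))
                                   (trans (≡sym eq) (+-identityʳ _))))) (proj₂ valid c₀)

  -- `hit` confines `R` to the neighbourhood of `Z`; the exchange arguments read off the labels of
  -- its members from it.
  record Violator (D : Fin m → Set) : Set₁ where
    field
      Z     : Fin m → Set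
      Z?    : ∀ u → Dec (Z u)
      R     : Fin n → Set
      R?    : ∀ c → Dec (R c)
      Z⊆D   : ∀ {u} → Z u → D u
      nbr   : ∀ {u c} → Z u → E u c → R c
      hit   : ∀ {c} → R c → ∃ λ u → Z u × E u c
      large : cap * ∑ (λ c → ⟦ R? c ⟧) < ∑ (λ u → ⟦ Z? u ⟧)

  -- If no vertex reachable from `v` sees a target with room, the reachable set violates Hall's
  -- condition: its neighbours are saturated, their senders are all reachable by closedness, and `v`
  -- is reachable without sending.
  assign-one : ∀ {D : Fin m → Set} → (∀ {u c} → E u c → D u) → ∀ {f v} → Valid f → D v → ¬ Assigned f v →
    (Σ State λ f′ → Valid f′ × Assigned f′ v × (∀ w → Assigned f w → Assigned f′ w) ×
                    (∀ x → load f x ≤ load f′ x))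
    ⊎ Violator D
  assign-one {D} E⇒D {f} {v} valid dv ¬a
    with reachable (λ u w → any? (λ c → E? u c ×-dec sends? f w c)) v
  ... | reach with any? (λ u → any? (λ c → Reachable.In? reach u ×-dec (E? u c ×-dec (load f c <? cap))))
  ...   | yes (u , c , z , e , lt) =
          let l , p , s = Reachable.path reach z
              f′ , valid′ , v′ , keep , loads = augment l {f} valid (unassigned f v ¬a) p s e lt
          in inj₁ (f′ , valid′ , v′ , keep , λ x → ≤-trans (m≤m+n _ _) (≤-reflexive (loads x)))
  ...   | no full = inj₂ record
          { Z = In ; Z? = In? ; R = R ; R? = R? ; Z⊆D = in-D ; nbr = λ z e → _ , z , e
          ; hit = λ r → r ; large = large }
    where
    open Reachable reach
    R : Fin n → Set
    R c = ∃ λ u → In u × E u c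
    R? : ∀ c → Dec (R c)
    R? c = any? (λ u → In? u ×-dec E? u c)
    in-D : ∀ {u} → In u → D u
    in-D z with path z
    ... | _ , start , _ = dv
    ... | _ , (_ ▷ (_ , _ , eq)) , _ = E⇒D (proj₁ valid eq)
    pair? : ∀ u c → Dec (R c × f sends u to c)
    pair? u c = R? c ×-dec sends? f u c
    saturated : ∀ c → cap * ⟦ R? c ⟧ ≤ ∑ λ u → ⟦ pair? u c ⟧
    saturated c = by-cases (R? c)
      where
      by-cases : (d : Dec (R c)) → cap * ⟦ d ⟧ ≤ ∑ λ u → ⟦ pair? u c ⟧
      by-cases (no _) = ≤-trans (≤-reflexive (*-zeroʳ cap)) z≤n
      by-cases (yes r@(u , z , e)) = begin
        cap * 1                       ≡⟨ *-identityʳ cap ⟩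
        cap                           ≤⟨ ≮⇒≥ (λ lt → full (u , c , z , e , lt)) ⟩
        load f c                      ≤⟨ ∑-mono (λ w → ⟦⟧-mono (sends? f w c) (pair? w c) (λ eq → r , eq)) ⟩
        (∑ λ w → ⟦ pair? w c ⟧)       ∎
        where open ≤-Reasoning
    one-target : ∀ u → ⟦ v ≟ u ⟧ + (∑ λ c → ⟦ pair? u c ⟧) ≤ ⟦ In? u ⟧
    one-target u with v ≟ u
    ... | yes refl = ≤-reflexive (trans (cong suc (∑-zero (λ c → ⟦⟧-no (pair? v c) (λ { (_ , eq) → ¬a (c , eq) }))))
                                        (≡sym (⟦⟧-yes (In? v) source)))
    ... | no _ with In? u
    ...   | yes _ = ∑≤1 _ (λ c → ⟦⟧≤1 (pair? u c))
                      (λ c c′ p p′ → just-injective (trans (≡sym (proj₂ (⟦⟧-pos (pair? u c) p))) (proj₂ (⟦⟧-pos (pair? u c′) p′))))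
    ...   | no ¬z = ≤-reflexive (∑-zero (λ c → ⟦⟧-no (pair? u c) (λ { ((w , z , e) , eq) → ¬z (closed z (c , e , eq)) })))
    large : suc (cap * ∑ (λ c → ⟦ R? c ⟧)) ≤ ∑ (λ u → ⟦ In? u ⟧)
    large = begin
      suc (cap * ∑ (λ c → ⟦ R? c ⟧))
        ≡⟨ cong suc (≡sym (∑-* cap (λ c → ⟦ R? c ⟧))) ⟩
      suc (∑ (λ c → cap * ⟦ R? c ⟧))
        ≤⟨ s≤s (∑-mono saturated) ⟩
      suc (∑ λ c → ∑ λ u → ⟦ pair? u c ⟧)
        ≡⟨ cong suc (∑-swap (λ c u → ⟦ pair? u c ⟧)) ⟩
      suc (∑ λ u → ∑ λ c → ⟦ pair? u c ⟧)
        ≡⟨ cong (_+ (∑ λ u → ∑ λ c → ⟦ pair? u c ⟧)) (≡sym (∑-δ v)) ⟩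
      ∑ (λ u → ⟦ v ≟ u ⟧) + (∑ λ u → ∑ λ c → ⟦ pair? u c ⟧)
        ≡⟨ ≡sym (∑-+ (λ u → ⟦ v ≟ u ⟧) (λ u → ∑ λ c → ⟦ pair? u c ⟧)) ⟩
      ∑ (λ u → ⟦ v ≟ u ⟧ + (∑ λ c → ⟦ pair? u c ⟧))
        ≤⟨ ∑-mono one-target ⟩
      ∑ (λ u → ⟦ In? u ⟧) ∎
      where open ≤-Reasoning

  -- Starting from an arbitrary valid `f₀` with loads that only grow preserves any lower bound on
  -- loads that `f₀` satisfies.
  hall : {D : Fin m → Set} → (∀ u → Dec (D u)) → (∀ {u c} → E u c → D u) → ∀ f₀ → Valid f₀ →
    (Σ State λ f → Valid f × (∀ u → D u → Assigned f u) × (∀ x → load f₀ x ≤ load f x)) ⊎ Violator D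
  hall {D} D? E⇒D f₀ valid₀ = go _ f₀ valid₀ (λ _ → ≤-refl) ≤-refl
    where
    missing? : ∀ f u → Dec (D u × ¬ Assigned f u)
    missing? f u = D? u ×-dec ¬? (assigned? f u)
    go : ∀ b f → Valid f → (∀ x → load f₀ x ≤ load f x) → ∑ (λ u → ⟦ missing? f u ⟧) ≤ b →
      (Σ State λ f → Valid f × (∀ u → D u → Assigned f u) × (∀ x → load f₀ x ≤ load f x)) ⊎ Violator D
    go b f valid grown size with any? (missing? f)
    ... | no none = inj₁ (f , valid , total , grown)
      where
      total : ∀ u → D u → Assigned f u
      total u d with assigned? f u
      ... | yes a = a
      ... | no ¬a = ⊥-elim (none (u , d , ¬a))
    ... | yes (v , dv , ¬a) with assign-one E⇒D {f} valid dv ¬a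
    ...   | inj₂ viol = inj₂ viol
    ...   | inj₁ (f′ , valid′ , v′ , keep , loads) = next b size
      where
      smaller : suc (∑ (λ u → ⟦ missing? f′ u ⟧)) ≤ ∑ (λ u → ⟦ missing? f u ⟧)
      smaller = begin
        suc (∑ (λ u → ⟦ missing? f′ u ⟧))
          ≡⟨ cong (_+ ∑ (λ u → ⟦ missing? f′ u ⟧)) (≡sym (∑-δ v)) ⟩
        ∑ (λ u → ⟦ v ≟ u ⟧) + ∑ (λ u → ⟦ missing? f′ u ⟧)
          ≡⟨ ≡sym (∑-+ (λ u → ⟦ v ≟ u ⟧) _) ⟩
        ∑ (λ u → ⟦ v ≟ u ⟧ + ⟦ missing? f′ u ⟧)
          ≤⟨ ∑-mono pointwise ⟩
        ∑ (λ u → ⟦ missing? f u ⟧) ∎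
        where
        open ≤-Reasoning
        pointwise : ∀ u → ⟦ v ≟ u ⟧ + ⟦ missing? f′ u ⟧ ≤ ⟦ missing? f u ⟧
        pointwise u with v ≟ u
        ... | yes refl = ≤-reflexive (trans (cong suc (⟦⟧-no (missing? f′ v) (λ { (_ , ¬a′) → ¬a′ v′ })))
                                            (≡sym (⟦⟧-yes (missing? f v) (dv , ¬a))))
        ... | no _ = ⟦⟧-mono (missing? f′ u) (missing? f u) (λ { (d , ¬a′) → d , λ a → ¬a′ (keep u a) })
      next : ∀ b → ∑ (λ u → ⟦ missing? f u ⟧) ≤ b →
        (Σ State λ f → Valid f × (∀ u → D u → Assigned f u) × (∀ x → load f₀ x ≤ load f x)) ⊎ Violator D
      next zero    le = ⊥-elim (n≮0 (≤-trans smaller le))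
      next (suc b) le = go b f′ valid′ (λ x → ≤-trans (grown x) (loads x)) (≤-pred (≤-trans smaller le))

-- Stars from a permutation

module Stars {n} (G : SimpleGraph n) (W : Fin n → Set) (W? : ∀ v → Dec (W v)) where

  _~_ : Fin n → Fin n → Set
  u ~ w = T (Adj G u w)

  ~-sym : ∀ {u w} → u ~ w → w ~ u
  ~-sym {u} {w} = subst T (SimpleGraph.sym G u w)

  ~-irrefl : ∀ {u} → ¬ u ~ u
  ~-irrefl {u} = subst T (irrefl G u)

  ~⇒≢ : ∀ {u w} → u ~ w → u ≢ w
  ~⇒≢ e refl = ~-irrefl e

  module Map (f : Vec (Fin n) n) where

    ⟨_⟩ : Fin n → Fin n
    ⟨_⟩ = lookup f

    Mutual : Fin n → Set
    Mutual v = ⟨ ⟨ v ⟩ ⟩ ≡ v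

    mutual? : ∀ v → Dec (Mutual v)
    mutual? v = ⟨ ⟨ v ⟩ ⟩ ≟ v

    sends? : ∀ u w → Dec (W u × ⟨ u ⟩ ≡ w)
    sends? u w = W? u ×-dec (⟨ u ⟩ ≟ w)

    indegree : Fin n → ℕ
    indegree w = ∑ λ u → ⟦ sends? u w ⟧

    -- A permutation meets the first alternative. The second one is for redirection, where a vertex
    -- gains a second preimage at the moment it becomes mutual.
    Valid : Set
    Valid = (∀ u → W u → W ⟨ u ⟩ × u ~ ⟨ u ⟩) ×
            (∀ w → indegree w ≤ 1 ⊎ (indegree w ≤ 2 × Mutual w))

    valid? : Dec Valid
    valid? = all? (λ u → W? u →-dec (W? ⟨ u ⟩ ×-dec T? _)) ×-dec
             all? (λ w → (indegree w ≤? 1) ⊎-dec ((indegree w ≤? 2) ×-dec mutual? w))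

    single : ℕ
    single = ∑ λ u → ⟦ ¬? (mutual? u) ⟧

  -- Sending `v` back to its preimage `z` creates a mutual pair. Only the old image of `v` loses a
  -- preimage, and only it can lose mutuality.
  module Redirect (f : Vec (Fin n) n) (valid : Map.Valid f) {v z : Fin n} (wv : W v) (wz : W z)
                  (fz : lookup f z ≡ v) (fv : lookup f v ≢ z) where
    open Map f
    f′ : Vec (Fin n) n
    f′ = f [ v ]≔ z
    module M′ = Map f′

    z≢v : z ≢ v
    z≢v refl = ~-irrefl (subst (z ~_) fz (proj₂ (proj₁ valid z wz)))

    f′v : lookup f′ v ≡ z
    f′v = lookup∘update v f z

    f′x : ∀ {x} → x ≢ v → lookup f′ x ≡ lookup f x
    f′x x≢v = lookup∘update′ x≢v f z

    mutual′-v : M′.Mutual v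
    mutual′-v = trans (cong (lookup f′) f′v) (trans (f′x z≢v) fz)

    mutual′-z : M′.Mutual z
    mutual′-z = trans (cong (lookup f′) (trans (f′x z≢v) fz)) f′v

    ¬mutual-z : ¬ Mutual z
    ¬mutual-z e = fv (trans (≡sym (cong (lookup f) fz)) e)

    mutual-keep : ∀ x → x ≢ lookup f v → Mutual x → M′.Mutual x
    mutual-keep x x≢fv mx with x ≟ v
    ... | yes refl = mutual′-v
    ... | no x≢v = trans (cong (lookup f′) (f′x x≢v)) (trans (f′x fx≢v) mx)
      where
      fx≢v : lookup f x ≢ v
      fx≢v fx = x≢fv (trans (≡sym mx) (cong (lookup f) fx))

    indegree-change : ∀ x → indegree x + ⟦ z ≟ x ⟧ ≡ M′.indegree x + ⟦ ⟨ v ⟩ ≟ x ⟧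
    indegree-change x = begin
      indegree x + ⟦ z ≟ x ⟧
        ≡⟨ cong (indegree x +_) (⟦⟧-cong (z ≟ x) (M′.sends? v x)
             (λ e → wv , trans f′v e) (λ e → trans (≡sym f′v) (proj₂ e))) ⟩
      indegree x + ⟦ M′.sends? v x ⟧
        ≡⟨ ∑-change (λ u → ⟦ sends? u x ⟧) (λ u → ⟦ M′.sends? u x ⟧) v
             (λ u u≢v → ⟦⟧-cong (sends? u x) (M′.sends? u x)
               (λ e → proj₁ e , trans (f′x u≢v) (proj₂ e))
               (λ e → proj₁ e , trans (≡sym (f′x u≢v)) (proj₂ e))) ⟩
      M′.indegree x + ⟦ sends? v x ⟧
        ≡⟨ cong (M′.indegree x +_) (⟦⟧-cong (sends? v x) (⟨ v ⟩ ≟ x) proj₂ (λ e → wv , e)) ⟩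
      M′.indegree x + ⟦ ⟨ v ⟩ ≟ x ⟧ ∎
      where open ≡-Reasoning

    valid′ : M′.Valid
    valid′ = edges , degrees
      where
      edges : ∀ u → W u → W (lookup f′ u) × u ~ lookup f′ u
      edges u wu with u ≟ v
      ... | yes refl rewrite f′v = wz , ~-sym (subst (z ~_) fz (proj₂ (proj₁ valid z wz)))
      ... | no u≢v rewrite f′x u≢v = proj₁ valid u wu
      degrees : ∀ x → M′.indegree x ≤ 1 ⊎ (M′.indegree x ≤ 2 × M′.Mutual x)
      degrees x with z ≟ x | ⟨ v ⟩ ≟ x | indegree-change x | proj₂ valid x
      ... | yes refl | _ | eq | inj₂ (_ , mz) = ⊥-elim (¬mutual-z mz)
      ... | yes refl | d | eq | inj₁ le =
            inj₂ (≤-trans (m≤m+n _ _) (≤-trans (≤-reflexive (≡sym eq)) (+-monoˡ-≤ 1 le)) , mutual′-z)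
      -- The old image of `v` may have lost its partner, but it has also lost a preimage, so the
      -- first alternative applies.
      ... | no _ | yes _ | eq | c =
            inj₁ (+-cancelʳ-≤ 1 _ _ (≤-trans (≤-reflexive (trans (≡sym eq) (+-identityʳ _))) (two c)))
        where
        two : indegree x ≤ 1 ⊎ (indegree x ≤ 2 × Mutual x) → indegree x ≤ 2
        two (inj₁ le) = ≤-trans le (s≤s z≤n)
        two (inj₂ le) = proj₁ le
      ... | no _ | no fv≢x | eq | inj₁ le =
            inj₁ (≤-trans (≤-reflexive (+-cancelʳ-≡ 0 _ _ (≡sym eq))) le)
      ... | no _ | no fv≢x | eq | inj₂ (le , mx) =
            inj₂ (≤-trans (≤-reflexive (+-cancelʳ-≡ 0 _ _ (≡sym eq))) le , mutual-keep x (fv≢x ∘ ≡sym) mx)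

    -- `z` becomes mutual, and the old image of `v` stops being mutual only if `v` was. Redirecting
    -- is therefore a strict gain at a non-mutual `v` and no loss at a mutual one.
    single-change : suc M′.single ≤ single + ⟦ mutual? v ⟧
    single-change = begin
      suc M′.single
        ≡⟨ cong (_+ M′.single) (≡sym (∑-δ z)) ⟩
      ∑ (λ x → ⟦ z ≟ x ⟧) + M′.single
        ≡⟨ ≡sym (∑-+ (λ x → ⟦ z ≟ x ⟧) (λ x → ⟦ ¬? (M′.mutual? x) ⟧)) ⟩
      ∑ (λ x → ⟦ z ≟ x ⟧ + ⟦ ¬? (M′.mutual? x) ⟧)
        ≤⟨ ∑-mono pointwise ⟩
      ∑ (λ x → ⟦ ¬? (mutual? x) ⟧ + ⟦ mutual? v ×-dec (⟨ v ⟩ ≟ x) ⟧)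
        ≡⟨ ∑-+ (λ x → ⟦ ¬? (mutual? x) ⟧) (λ x → ⟦ mutual? v ×-dec (⟨ v ⟩ ≟ x) ⟧) ⟩
      single + ∑ (λ x → ⟦ mutual? v ×-dec (⟨ v ⟩ ≟ x) ⟧)
        ≤⟨ +-monoʳ-≤ single total ⟩
      single + ⟦ mutual? v ⟧ ∎
      where
      open ≤-Reasoning
      total : ∑ (λ x → ⟦ mutual? v ×-dec (⟨ v ⟩ ≟ x) ⟧) ≤ ⟦ mutual? v ⟧
      total = ≤-trans (≤-reflexive (∑-single (λ x → ⟦ mutual? v ×-dec (⟨ v ⟩ ≟ x) ⟧) ⟨ v ⟩
                (λ x x≢ → ⟦⟧-no (mutual? v ×-dec (⟨ v ⟩ ≟ x)) (λ { (_ , e) → x≢ (≡sym e) }))))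
                (⟦⟧-mono (mutual? v ×-dec (⟨ v ⟩ ≟ ⟨ v ⟩)) (mutual? v) proj₁)
      pointwise : ∀ x → ⟦ z ≟ x ⟧ + ⟦ ¬? (M′.mutual? x) ⟧ ≤
                        ⟦ ¬? (mutual? x) ⟧ + ⟦ mutual? v ×-dec (⟨ v ⟩ ≟ x) ⟧
      pointwise x with z ≟ x
      ... | yes refl = ≤-trans (≤-reflexive (trans (cong suc (⟦⟧-no (¬? (M′.mutual? z)) (λ h → h mutual′-z)))
                                                   (≡sym (⟦⟧-yes (¬? (mutual? z)) ¬mutual-z))))
                               (m≤m+n _ _)
      ... | no _ with mutual? x
      ...   | no _ = ≤-trans (⟦⟧≤1 (¬? (M′.mutual? x))) (m≤m+n 1 _)
      ...   | yes mx = ⟦⟧-mono (¬? (M′.mutual? x)) (mutual? v ×-dec (⟨ v ⟩ ≟ x)) lost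
        where
        lost : ¬ M′.Mutual x → Mutual v × ⟨ v ⟩ ≡ x
        lost ¬m with ⟨ v ⟩ ≟ x
        ... | yes refl with lookup f ⟨ v ⟩ ≟ v
        ...   | yes mv = mv , refl
        ...   | no ¬mv = ⊥-elim (¬m (trans (cong (lookup f′) (f′x fv≢v)) (trans (f′x ¬mv) mx)))
          where
          fv≢v : ⟨ v ⟩ ≢ v
          fv≢v q = ¬mv (trans (cong (lookup f) q) q)
        lost ¬m | no fv≢x = ⊥-elim (¬m (mutual-keep x (fv≢x ∘ ≡sym) mx))

  record StarCover : Set₁ where
    field
      Centre   : Fin n → Set
      Centre?  : ∀ v → Dec (Centre v)
      to       : Fin n → Fin n
      centre⊆  : ∀ {v} → Centre v → W v
      leaf     : ∀ {v} → W v → ¬ Centre v → Centre (to v) × v ~ to v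
      nonempty : ∀ {c} → Centre c → ∃ λ v → W v × ¬ Centre v × to v ≡ c
      small    : ∀ c → ∑ (λ v → ⟦ W? v ×-dec (to v ≟ c) ⟧) ≤ 2

  -- Maximise the number of vertices matched with their image: then every other
  -- vertex is a leaf hanging off a matched pair, and on one side of the pair only.
  star-cover : (f : Vec (Fin n) n) → Map.Valid f → StarCover
  star-cover f₀ valid₀ with argmin (search-Vec any?) Map.valid? Map.single f₀ valid₀
  ... | f , valid , best = record
      { Centre = Centre ; Centre? = centre? ; to = ⟨_⟩ ; centre⊆ = proj₁ ; leaf = leaf
      ; nonempty = λ {c} cc@(wc , mc , _) → ⟨ c ⟩ , proj₁ (proj₁ valid c wc) , partner cc , mc
      ; small = small }
    where
    open Map f
    -- Stated for every optimal map, since it is also applied to a redirected one.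
    stuck : ∀ f → Map.Valid f → (∀ g → Map.Valid g → Map.single f ≤ Map.single g) →
            ∀ {v z} → W v → W z → lookup f z ≡ v → Map.Mutual f v
    stuck f valid best {v} {z} wv wz fz with Map.mutual? f v
    ... | yes mv = mv
    ... | no ¬mv = ⊥-elim (<-irrefl refl (≤-trans
            (≤-trans (s≤s (best f′ valid′)) single-change)
            (≤-reflexive (trans (cong (Map.single f +_) (⟦⟧-no (Map.mutual? f v) ¬mv)) (+-identityʳ _)))))
      where
      open Redirect f valid wv wz fz (λ fv → ¬mv (trans (cong (lookup f) fv) fz))
    Ext : Fin n → Set
    Ext v = ∃ λ z → W z × ⟨ z ⟩ ≡ v × z ≢ ⟨ v ⟩
    ext? : ∀ v → Dec (Ext v)
    ext? v = any? (λ z → W? z ×-dec ((⟨ z ⟩ ≟ v) ×-dec ¬? (z ≟ ⟨ v ⟩)))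
    -- If both ends of a pair have outside preimages, redirecting `v` to `z` keeps the map optimal,
    -- yet leaves the old image of `v` with the preimage `y` and no mutual partner, against `stuck`.
    one-side : ∀ {v} → W v → Mutual v → Ext v → ¬ Ext ⟨ v ⟩
    one-side {v} wv mv (z , wz , fz , z≢) (y , wy , fy , y≢) =
      z≢ (trans (≡sym f′v) (trans (≡sym (cong (lookup f′) ffv)) mutual-fv))
      where
      open Redirect f valid wv wz fz (z≢ ∘ ≡sym)
      fv≢v : ⟨ v ⟩ ≢ v
      fv≢v e = ~⇒≢ (proj₂ (proj₁ valid v wv)) (≡sym e)
      ffv : lookup f′ ⟨ v ⟩ ≡ v
      ffv = trans (f′x fv≢v) mv
      best′ : ∀ g → Map.Valid g → M′.single ≤ Map.single g
      best′ g vg = ≤-trans (≤-pred (≤-trans single-change (≤-reflexive (trans (cong (single +_) (⟦⟧-yes (mutual? v) mv)) (+-comm single 1))))) (best g vg)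
      mutual-fv : M′.Mutual ⟨ v ⟩
      mutual-fv = stuck f′ valid′ best′ (proj₁ (proj₁ valid v wv)) wy (trans (f′x (λ { refl → y≢ (≡sym mv) })) fy)
    -- The end with outside preimages is the centre; if neither end has any, the smaller index
    -- breaks the tie.
    Centre : Fin n → Set
    Centre v = W v × Mutual v × (Ext v ⊎ (¬ Ext ⟨ v ⟩ × toℕ v < toℕ ⟨ v ⟩))
    centre? : ∀ v → Dec (Centre v)
    centre? v = W? v ×-dec (mutual? v ×-dec (ext? v ⊎-dec (¬? (ext? ⟨ v ⟩) ×-dec (toℕ v <? toℕ ⟨ v ⟩))))
    leaf : ∀ {u} → W u → ¬ Centre u → Centre ⟨ u ⟩ × u ~ ⟨ u ⟩
    leaf {u} wu ¬cu = (wfu , mfu , side (mutual? u)) , proj₂ (proj₁ valid u wu)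
      where
      wfu = proj₁ (proj₁ valid u wu)
      mfu = stuck f valid best wfu wu refl
      side : Dec (Mutual u) → Ext ⟨ u ⟩ ⊎ (¬ Ext ⟨ ⟨ u ⟩ ⟩ × toℕ ⟨ u ⟩ < toℕ ⟨ ⟨ u ⟩ ⟩)
      side (no ¬mu) = inj₁ (u , wu , refl , ¬mu ∘ ≡sym)
      side (yes mu) with ext? ⟨ u ⟩
      ... | yes e = inj₁ e
      ... | no ¬e = inj₂ ((λ e → ¬cu (wu , mu , inj₁ (subst Ext mu e))) ,
                          subst (λ x → toℕ ⟨ u ⟩ < toℕ x) (≡sym mu)
                            (≤∧≢⇒< (≮⇒≥ (λ lt → ¬cu (wu , mu , inj₂ (¬e , lt))))
                                   (λ e → ~⇒≢ (proj₂ (proj₁ valid u wu)) (≡sym (toℕ-injective e)))))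
    partner : ∀ {c} → Centre c → ¬ Centre ⟨ c ⟩
    partner (wc , mc , inj₁ e) (_ , _ , inj₁ e′) = one-side wc mc e e′
    partner (wc , mc , inj₁ e) (_ , _ , inj₂ (¬e , _)) = ¬e (subst Ext (≡sym mc) e)
    partner (wc , mc , inj₂ (¬e , _)) (_ , _ , inj₁ e) = ¬e e
    partner {c} (wc , mc , inj₂ (_ , lt)) (_ , _ , inj₂ (_ , gt)) =
      <-asym lt (subst (λ x → toℕ ⟨ c ⟩ < toℕ x) mc gt)
    small : ∀ c → indegree c ≤ 2
    small c with proj₂ valid c
    ... | inj₁ le = ≤-trans le (s≤s z≤n)
    ... | inj₂ (le , _) = le

-- Separators maximising i(G - S) - |S|

data Label : Set where
  sep iso rest : Label

_≟ˡ_ : (a b : Label) → Dec (a ≡ b)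
sep  ≟ˡ sep  = yes refl
sep  ≟ˡ iso  = no λ ()
sep  ≟ˡ rest = no λ ()
iso  ≟ˡ sep  = no λ ()
iso  ≟ˡ iso  = yes refl
iso  ≟ˡ rest = no λ ()
rest ≟ˡ sep  = no λ ()
rest ≟ˡ iso  = no λ ()
rest ≟ˡ rest = yes refl

sep≢iso : sep ≢ iso
sep≢iso ()

sep≢rest : sep ≢ rest
sep≢rest ()

iso≢rest : iso ≢ rest
iso≢rest ()

search-Label : Searchable Label
search-Label P? with P? sep | P? iso | P? rest
... | yes p | _ | _ = yes (sep , p)
... | no _ | yes p | _ = yes (iso , p)
... | no _ | no _ | yes p = yes (rest , p)
... | no ¬s | no ¬i | no ¬r = no λ { (sep , p) → ¬s p ; (iso , p) → ¬i p ; (rest , p) → ¬r p }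

-- The total is n + |S| - |I|, the offset 1 keeping it a natural number.
cost : Label → ℕ
cost sep  = 2
cost rest = 1
cost iso  = 0

-- The hypothesis i(G - S) ≤ (k + 1/2)|S|, for a set J of isolated vertices of G - S.
IsolationBound : ℕ → SimpleGraph n → Set₁
IsolationBound {n} k G = {J S : Fin n → Set} (J? : ∀ v → Dec (J v)) (S? : ∀ v → Dec (S v)) →
  (∀ {v} → J v → ¬ S v) → (∀ {v w} → J v → T (Adj G v w) → S w) →
  2 * ∑ (λ v → ⟦ J? v ⟧) ≤ (2 * k + 1) * ∑ (λ v → ⟦ S? v ⟧)

module Labelling {n} (G : SimpleGraph n) where

  open Stars G (λ _ → ⊤) (λ _ → yes tt) using (_~_; ~-sym)

  ValidLabel : (Fin n → Label) → Set
  ValidLabel ℓ = ∀ v w → ℓ v ≡ iso → v ~ w → ℓ w ≡ sep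

  validLabel? : ∀ ℓ → Dec (ValidLabel ℓ)
  validLabel? ℓ = all? (λ v → all? (λ w → (ℓ v ≟ˡ iso) →-dec (T? _ →-dec (ℓ w ≟ˡ sep))))

  -- A labelling that minimises the total cost maximises i(G - S) - |S|.
  record Optimal : Set₁ where
    field
      ℓ     : Fin n → Label
      valid : ValidLabel ℓ
      best  : ∀ g → ValidLabel g → ∑ (cost ∘ ℓ) ≤ ∑ (cost ∘ g)

  optimal : Optimal
  optimal with argmin (search-Vec search-Label) (λ ℓ → validLabel? (lookup ℓ)) (λ ℓ → ∑ (cost ∘ lookup ℓ))
                      (tabulate (λ _ → rest)) (λ v w e → ⊥-elim (iso≢rest (trans (≡sym e) (lookup∘tabulate _ v))))
  ... | ℓ , valid , best = record
    { ℓ = lookup ℓ ; valid = valid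
    ; best = λ g vg → ≤-trans
        (best (tabulate g) (λ v w e vw → trans (lookup∘tabulate g w) (vg v w (trans (≡sym (lookup∘tabulate g v)) e) vw)))
        (≤-reflexive (∑-cong (λ v → cong cost (lookup∘tabulate g v)))) }

  module _ (opt : Optimal) where
    open Optimal opt

    -- The relabelling makes `Z` cheaper by one and `R` dearer by one, cancelling where they meet;
    -- optimality then forbids |Z| > |R|, which is what a violator of Hall's condition provides.
    no-exchange : {Z R : Fin n → Set} (Z? : ∀ v → Dec (Z v)) (R? : ∀ v → Dec (R v)) →
      ∀ g → ValidLabel g → (∀ v → cost (g v) + ⟦ Z? v ⟧ ≡ cost (ℓ v) + ⟦ R? v ⟧) →
      ∑ (λ v → ⟦ Z? v ⟧) ≤ ∑ (λ v → ⟦ R? v ⟧)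
    no-exchange Z? R? g vg eq = +-cancelˡ-≤ (∑ (cost ∘ ℓ)) _ _ (begin
      ∑ (cost ∘ ℓ) + ∑ (λ v → ⟦ Z? v ⟧)   ≤⟨ +-monoˡ-≤ _ (best g vg) ⟩
      ∑ (cost ∘ g) + ∑ (λ v → ⟦ Z? v ⟧)   ≡⟨ ≡sym (∑-+ (cost ∘ g) _) ⟩
      ∑ (λ v → cost (g v) + ⟦ Z? v ⟧)      ≡⟨ ∑-cong eq ⟩
      ∑ (λ v → cost (ℓ v) + ⟦ R? v ⟧)      ≡⟨ ∑-+ (cost ∘ ℓ) _ ⟩
      ∑ (cost ∘ ℓ) + ∑ (λ v → ⟦ R? v ⟧)   ∎)
      where open ≤-Reasoning

    module ToIso = Assignment (λ s i → ℓ s ≡ sep × ℓ i ≡ iso × s ~ i)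
                              (λ s i → (ℓ s ≟ˡ sep) ×-dec ((ℓ i ≟ˡ iso) ×-dec T? _)) 1

    -- For a violator, both `Z` and `R` become `rest`. Vertices that stay isolated have no neighbour
    -- in `Z`, so the labelling remains valid.
    iso-matching : Σ ToIso.State λ M → ToIso.Valid M × (∀ s → ℓ s ≡ sep → ToIso.Assigned M s)
    iso-matching with ToIso.hall (λ s → ℓ s ≟ˡ sep) proj₁ ToIso.none ToIso.none-valid
    ... | inj₁ (M , valid , total , _) = M , valid , total
    ... | inj₂ viol = ⊥-elim (<-irrefl refl (≤-trans large (≤-trans (no-exchange Z? R? g vg balance) (≤-reflexive (≡sym (+-identityʳ _))))))
      where
      open ToIso.Violator viol
      move : ∀ {v} → Label → Dec (Z v) → Dec (R v) → Label
      move sep (yes _) _ = rest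
      move iso _ (yes _) = rest
      move l   _ _       = l
      g : Fin n → Label
      g v = move (ℓ v) (Z? v) (R? v)
      R⇒iso : ∀ {v} → R v → ℓ v ≡ iso
      R⇒iso r = proj₁ (proj₂ (proj₂ (proj₂ (hit r))))
      balance : ∀ v → cost (g v) + ⟦ Z? v ⟧ ≡ cost (ℓ v) + ⟦ R? v ⟧
      balance v with ℓ v in eq | Z? v | R? v
      ... | sep  | yes z | yes r = ⊥-elim (sep≢iso (trans (≡sym eq) (R⇒iso r)))
      ... | sep  | yes z | no _  = refl
      ... | sep  | no _  | yes r = ⊥-elim (sep≢iso (trans (≡sym eq) (R⇒iso r)))
      ... | sep  | no _  | no _  = refl
      ... | iso  | yes z | _     = ⊥-elim (sep≢iso (≡sym (trans (≡sym eq) (Z⊆D z))))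
      ... | iso  | no _  | yes _ = refl
      ... | iso  | no _  | no _  = refl
      ... | rest | yes z | _     = ⊥-elim (sep≢rest (≡sym (trans (≡sym eq) (Z⊆D z))))
      ... | rest | no _  | yes r = ⊥-elim (iso≢rest (≡sym (trans (≡sym eq) (R⇒iso r))))
      ... | rest | no _  | no _  = refl
      g-iso : ∀ v → g v ≡ iso → ℓ v ≡ iso × ¬ R v
      g-iso v e with ℓ v | Z? v | R? v
      g-iso v () | sep  | yes _ | _
      g-iso v () | sep  | no _ | _
      g-iso v () | iso  | _ | yes _
      g-iso v e  | iso  | _ | no ¬r = refl , ¬r
      g-iso v () | rest | _ | _
      g-sep : ∀ v → ℓ v ≡ sep → ¬ Z v → g v ≡ sep
      g-sep v e ¬z with ℓ v | Z? v
      ... | sep | yes z = ⊥-elim (¬z z)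
      ... | sep | no _  = refl
      vg : ValidLabel g
      vg v w e vw = let i , ¬r = g-iso v e ; s = valid v w i vw in
        g-sep w s (λ z → ¬r (nbr z (s , i , ~-sym vw)))

    Rest : Fin n → Set
    Rest v = ℓ v ≡ rest

    rest? : ∀ v → Dec (Rest v)
    rest? v = ℓ v ≟ˡ rest

    module Perm = Assignment (λ u w → Rest u × Rest w × u ~ w)
                             (λ u w → rest? u ×-dec (rest? w ×-dec T? _)) 1

    -- For a violator, `Z` minus `R` becomes isolated and `R` minus `Z` joins the separator. A
    -- vertex of `Z` outside `R` has no neighbour in `Z`, which would put it into `R`; so after the
    -- change all its neighbours are separators.
    rest-permutation : Σ Perm.State λ M → Perm.Valid M × (∀ s → Rest s → Perm.Assigned M s)
    rest-permutation with Perm.hall rest? proj₁ Perm.none Perm.none-valid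
    ... | inj₁ (M , valid , total , _) = M , valid , total
    ... | inj₂ viol = ⊥-elim (<-irrefl refl (≤-trans large (≤-trans (no-exchange Z? R? g vg balance) (≤-reflexive (≡sym (+-identityʳ _))))))
      where
      open Perm.Violator viol
      move : ∀ {v} → Label → Dec (Z v) → Dec (R v) → Label
      move rest (yes _) (no _)  = iso
      move rest (no _)  (yes _) = sep
      move l    _       _       = l
      g : Fin n → Label
      g v = move (ℓ v) (Z? v) (R? v)
      R⇒rest : ∀ {v} → R v → Rest v
      R⇒rest r = proj₁ (proj₂ (proj₂ (proj₂ (hit r))))
      balance : ∀ v → cost (g v) + ⟦ Z? v ⟧ ≡ cost (ℓ v) + ⟦ R? v ⟧
      balance v with ℓ v in eq | Z? v | R? v
      ... | sep  | yes z | _     = ⊥-elim (sep≢rest (trans (≡sym eq) (Z⊆D z)))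
      ... | sep  | no _  | yes r = ⊥-elim (sep≢rest (trans (≡sym eq) (R⇒rest r)))
      ... | sep  | no _  | no _  = refl
      ... | iso  | yes z | _     = ⊥-elim (iso≢rest (trans (≡sym eq) (Z⊆D z)))
      ... | iso  | no _  | yes r = ⊥-elim (iso≢rest (trans (≡sym eq) (R⇒rest r)))
      ... | iso  | no _  | no _  = refl
      ... | rest | yes _ | yes _ = refl
      ... | rest | yes _ | no _  = refl
      ... | rest | no _  | yes _ = refl
      ... | rest | no _  | no _  = refl
      g-iso : ∀ v → g v ≡ iso → ℓ v ≡ iso ⊎ (ℓ v ≡ rest × Z v × ¬ R v)
      g-iso v e with ℓ v | Z? v | R? v
      g-iso v () | sep  | _ | _
      g-iso v e  | iso  | _ | _ = inj₁ refl
      g-iso v () | rest | yes _ | yes _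
      g-iso v e  | rest | yes z | no ¬r = inj₂ (refl , z , ¬r)
      g-iso v () | rest | no _ | yes _
      g-iso v () | rest | no _ | no _
      g-sep : ∀ v → ℓ v ≡ sep → g v ≡ sep
      g-sep v e with ℓ v
      ... | sep = refl
      g-R : ∀ v → R v → ¬ Z v → g v ≡ sep
      g-R v r ¬z with ℓ v | R⇒rest r | Z? v | R? v
      ... | rest | _ | yes z | _     = ⊥-elim (¬z z)
      ... | rest | _ | no _  | yes _ = refl
      ... | rest | _ | no _  | no ¬r = ⊥-elim (¬r r)
      vg : ValidLabel g
      vg v w e vw with g-iso v e
      ... | inj₁ i = g-sep w (valid v w i vw)
      ... | inj₂ (lv , z , ¬r) with ℓ w in lw
      ...   | sep  = refl
      ...   | iso  = ⊥-elim (sep≢rest (≡sym (trans (≡sym lv) (valid w v lw (~-sym vw)))))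
      ...   | rest = subst (λ l → move l (Z? w) (R? w) ≡ sep) lw
                       (g-R w (nbr z (lv , lw , vw)) (λ z′ → ¬r (nbr z′ (lw , lv , ~-sym vw))))

-- Two units per sender: the flow into the centres

∑-++ : ∀ m {n} (f : Fin (m + n) → ℕ) → ∑ f ≡ ∑ (λ i → f (i ↑ˡ n)) + ∑ (λ i → f (m ↑ʳ i))
∑-++ zero    f = refl
∑-++ (suc m) f = trans (cong (f zero +_) (∑-++ m (f ∘ suc))) (≡sym (+-assoc (f zero) _ _))

module HalfFlow {n} (G : SimpleGraph n) (k : ℕ) (Centre : Fin n → Set) (Centre? : ∀ v → Dec (Centre v)) where

  State : Set
  State = Vec (Fin n × Fin n) n

  amount : Fin n × Fin n → Fin n → ℕ
  amount (a , b) c = ⟦ a ≟ c ⟧ + ⟦ b ≟ c ⟧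

  inflow : State → Fin n → ℕ
  inflow σ c = ∑ λ u → ⟦ ¬? (Centre? u) ⟧ * amount (lookup σ u) c

  Target : Fin n → Fin n → Set
  Target u c = Centre c × T (Adj G u c)

  Targets : State → Set
  Targets σ = ∀ u → ¬ Centre u → Target u (proj₁ (lookup σ u)) × Target u (proj₂ (lookup σ u))

  Valid : State → Set
  Valid σ = Targets σ × (∀ c → Centre c → 2 ≤ inflow σ c × inflow σ c ≤ 2 * k + 1)

  targets? : ∀ σ → Dec (Targets σ)
  targets? σ = all? (λ u → ¬? (Centre? u) →-dec (target? u (proj₁ (lookup σ u)) ×-dec target? u (proj₂ (lookup σ u))))
    where
    target? : ∀ u c → Dec (Target u c)
    target? u c = Centre? c ×-dec T? _

  valid? : ∀ σ → Dec (Valid σ)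
  valid? σ = targets? σ ×-dec all? (λ c → Centre? c →-dec ((2 ≤? inflow σ c) ×-dec (inflow σ c ≤? 2 * k + 1)))

record HalfFactor (k : ℕ) (G : SimpleGraph n) : Set₁ where
  field
    Centre  : Fin n → Set
    Centre? : ∀ v → Dec (Centre v)
    σ       : HalfFlow.State G k Centre Centre?
    valid   : HalfFlow.Valid G k Centre Centre? σ

module _ {n} (G : SimpleGraph n) (k : ℕ) (2≤k : 2 ≤ k) (bound : IsolationBound k G) where

  open Labelling G
  open Stars G (λ _ → ⊤) (λ _ → yes tt) using (_~_; ~-sym)

  -- Every vertex is doubled, one copy for each of its units, so that Hall's theorem applies with
  -- capacity 2k + 1.
  vertex : Fin (n + n) → Fin n
  vertex u = [ (λ i → i) , (λ i → i) ]′ (splitAt n u)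

  vertexˡ : ∀ i → vertex (i ↑ˡ n) ≡ i
  vertexˡ i = cong [ (λ i → i) , (λ i → i) ]′ (splitAt-↑ˡ n i n)

  vertexʳ : ∀ i → vertex (n ↑ʳ i) ≡ i
  vertexʳ i = cong [ (λ i → i) , (λ i → i) ]′ (splitAt-↑ʳ n n i)

  module _ (opt : Optimal) where
    open Optimal opt

    module Units = Assignment (λ u s → ℓ (vertex u) ≡ iso × ℓ s ≡ sep × vertex u ~ s)
                              (λ u s → (ℓ (vertex u) ≟ˡ iso) ×-dec ((ℓ s ≟ˡ sep) ×-dec T? _)) (2 * k + 1)

    -- In `f₀` each matched vertex of I sends both units to its partner, which gives every separator
    -- load 2 from the start. For a violator, let `J` be the vertices with a unit in `Z`: then |Z|
    -- is at most 2|J|, which by `bound` is at most (2k + 1)|R|, a contradiction.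
    iso-flow : Σ Units.State λ f → Units.Valid f × (∀ u → ℓ (vertex u) ≡ iso → Units.Assigned f u) ×
                                   (∀ s → ℓ s ≡ sep → 2 ≤ Units.load f s)
    iso-flow with iso-matching opt
    ... | M , (edgeM , loadM) , totalM = answer (Units.hall (λ u → ℓ (vertex u) ≟ˡ iso) proj₁ f₀ valid₀)
      where
      module TI = ToIso opt
      unique : ∀ {s s′ i} → M TI.sends s to i → M TI.sends s′ to i → s ≡ s′
      unique {s} {s′} {i} e e′ with s ≟ s′
      ... | yes eq = eq
      ... | no ne = ⊥-elim (<-irrefl refl (≤-trans
              (≤-reflexive (≡sym (cong₂ _+_ (⟦⟧-yes (TI.sends? M s i) e) (⟦⟧-yes (TI.sends? M s′ i) e′))))
              (≤-trans (∑-two (λ u → ⟦ TI.sends? M u i ⟧) ne) (loadM i))))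
      pick : ∀ {i} → Dec (∃ λ s → M TI.sends s to i) → Maybe (Fin n)
      pick (yes (s , _)) = just s
      pick (no _)        = nothing
      h : Fin n → Maybe (Fin n)
      h i = pick (any? (λ s → TI.sends? M s i))
      h-sound : ∀ {i s} → h i ≡ just s → M TI.sends s to i
      h-sound {i} eq with any? (λ s → TI.sends? M s i)
      h-sound refl | yes (s , e) = e
      h-sound ()   | no _
      h-complete : ∀ {i s} → M TI.sends s to i → h i ≡ just s
      h-complete {i} {s} e with any? (λ s → TI.sends? M s i)
      ... | yes (s′ , e′) = cong just (unique e′ e)
      ... | no none = ⊥-elim (none (s , e))
      f₀ : Units.State
      f₀ = tabulate (h ∘ vertex)
      f₀-vertex : ∀ u → lookup f₀ u ≡ h (vertex u)
      f₀-vertex u = lookup∘tabulate (h ∘ vertex) u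
      count-h : Fin n → ℕ
      count-h s = ∑ (λ i → ⟦ ≡-dec _≟_ (h i) (just s) ⟧)
      load₀ : ∀ s → Units.load f₀ s ≡ count-h s + count-h s
      load₀ s = trans (∑-++ n _) (cong₂ _+_
        (∑-cong (λ i → cong (λ x → ⟦ ≡-dec _≟_ x (just s) ⟧) (trans (f₀-vertex (i ↑ˡ n)) (cong h (vertexˡ i)))))
        (∑-cong (λ i → cong (λ x → ⟦ ≡-dec _≟_ x (just s) ⟧) (trans (f₀-vertex (n ↑ʳ i)) (cong h (vertexʳ i))))))
      count-h≤1 : ∀ s → count-h s ≤ 1
      count-h≤1 s = ∑≤1 _ (λ i → ⟦⟧≤1 (≡-dec _≟_ (h i) (just s)))
        (λ i j p q → just-injective (trans (≡sym (h-sound (⟦⟧-pos (≡-dec _≟_ (h i) (just s)) p)))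
                                           (h-sound (⟦⟧-pos (≡-dec _≟_ (h j) (just s)) q))))
      1≤count-h : ∀ s → ℓ s ≡ sep → 1 ≤ count-h s
      1≤count-h s e = let i , Ms = totalM s e in
        ≤-trans (≤-reflexive (≡sym (⟦⟧-yes (≡-dec _≟_ (h i) (just s)) (h-complete Ms)))) (∑-term _ i)
      valid₀ : Units.Valid f₀
      valid₀ = (λ {u} {s} e → let s-sep , i-iso , si = edgeM {s} {vertex u} (h-sound (trans (≡sym (f₀-vertex u)) e))
                              in i-iso , s-sep , ~-sym si) ,
               λ s → ≤-trans (≤-reflexive (load₀ s)) (≤-trans (+-mono-≤ (count-h≤1 s) (count-h≤1 s))
                       (≤-trans (≤-trans 2≤k (m≤m+n k _)) (m≤m+n (2 * k) 1)))
      answer : _ → _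
      answer (inj₁ (f , valid′ , total , grown)) = f , valid′ , total ,
        λ s e → ≤-trans (≤-trans (+-mono-≤ (1≤count-h s e) (1≤count-h s e)) (≤-reflexive (≡sym (load₀ s)))) (grown s)
      answer (inj₂ viol) = ⊥-elim (<-irrefl refl (begin-strict
          2 * ∑ (λ v → ⟦ J? v ⟧)             ≤⟨ bound J? R? J⇒¬R J-nbr ⟩
          (2 * k + 1) * ∑ (λ v → ⟦ R? v ⟧)   <⟨ large ⟩
          ∑ (λ u → ⟦ Z? u ⟧)                 ≡⟨ ∑-++ n _ ⟩
          ∑ (λ i → ⟦ Z? (i ↑ˡ n) ⟧) + ∑ (λ i → ⟦ Z? (n ↑ʳ i) ⟧)
            ≤⟨ +-mono-≤ (∑-mono (λ i → ⟦⟧-mono (Z? (i ↑ˡ n)) (J? i) inj₁)) (∑-mono (λ i → ⟦⟧-mono (Z? (n ↑ʳ i)) (J? i) inj₂)) ⟩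
          ∑ (λ v → ⟦ J? v ⟧) + ∑ (λ v → ⟦ J? v ⟧)
            ≡⟨ cong (∑ (λ v → ⟦ J? v ⟧) +_) (≡sym (+-identityʳ _)) ⟩
          2 * ∑ (λ v → ⟦ J? v ⟧) ∎))
        where
        open ≤-Reasoning
        open Units.Violator viol
        J : Fin n → Set
        J v = Z (v ↑ˡ n) ⊎ Z (n ↑ʳ v)
        J? : ∀ v → Dec (J v)
        J? v = Z? (v ↑ˡ n) ⊎-dec Z? (n ↑ʳ v)
        J⇒unit : ∀ {v} → J v → ∃ λ u → Z u × vertex u ≡ v
        J⇒unit {v} (inj₁ z) = v ↑ˡ n , z , vertexˡ v
        J⇒unit {v} (inj₂ z) = n ↑ʳ v , z , vertexʳ v
        J⇒¬R : ∀ {v} → J v → ¬ R v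
        J⇒¬R j r with J⇒unit j
        ... | u , z , refl = sep≢iso (trans (≡sym (proj₁ (proj₂ (proj₂ (proj₂ (hit r)))))) (Z⊆D z))
        J-nbr : ∀ {v w} → J v → v ~ w → R w
        J-nbr {w = w} j vw with J⇒unit j
        ... | u , z , refl = nbr z (Z⊆D z , valid (vertex u) w (Z⊆D z) vw , vw)

    rest-cover : Stars.StarCover G (Rest opt) (rest? opt)
    rest-cover with rest-permutation opt
    ... | M , (edgeM , loadM) , totalM = star-cover (tabulate g) (edges , degrees)
      where
      open Stars G (Rest opt) (rest? opt) using (star-cover; module Map)
      module PM = Perm opt
      pick : ∀ {v} → Dec (PM.Assigned M v) → Fin n
      pick {v} (yes (c , _)) = c
      pick {v} (no _)        = v
      g : Fin n → Fin n
      g v = pick (PM.assigned? M v)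
      g-sends : ∀ {v} → Rest opt v → M PM.sends v to g v
      g-sends {v} r with PM.assigned? M v
      ... | yes (_ , e) = e
      ... | no ¬a = ⊥-elim (¬a (totalM v r))
      open Map (tabulate g)
      edges : ∀ u → Rest opt u → Rest opt ⟨ u ⟩ × u ~ ⟨ u ⟩
      edges u r rewrite lookup∘tabulate g u = proj₂ (edgeM (g-sends r))
      degrees : ∀ w → indegree w ≤ 1 ⊎ (indegree w ≤ 2 × Mutual w)
      degrees w = inj₁ (≤-trans (∑-mono (λ u → ⟦⟧-mono (sends? u w) (PM.sends? M u w)
        (λ { (r , e) → trans (g-sends r) (cong just (trans (≡sym (lookup∘tabulate g u)) e)) }))) (loadM w))

  -- The two kinds of centre do not interact. Separators receive units from `iso` only, so their
  -- inflow is the load of the flow; the centre of a star receives two units from each of its one or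
  -- two leaves, and 4 is at most 2k.
  half-factor : HalfFactor k G
  half-factor with optimal
  ... | opt with iso-flow opt | rest-cover opt
  ...   | f , (edgeF , loadF) , totalF , lowF | cover = record
          { Centre = Centre ; Centre? = Centre? ; σ = tabulate target
          ; valid = targets , λ c → [ sep-bounds c , rest-bounds c ]′ }
    where
    open Optimal opt
    module U = Units opt
    module C = Stars.StarCover cover
    Centre : Fin n → Set
    Centre v = ℓ v ≡ sep ⊎ C.Centre v
    Centre? : ∀ v → Dec (Centre v)
    Centre? v = (ℓ v ≟ˡ sep) ⊎-dec C.Centre? v
    open HalfFlow G k Centre Centre?
    pick : Fin n → ∀ {u} → Dec (U.Assigned f u) → Fin n
    pick v (yes (c , _)) = c
    pick v (no _)        = v
    unit : Fin n → Fin (n + n) → Fin n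
    unit v u = pick v (U.assigned? f u)
    unit-sends : ∀ v {u} → vertex u ≡ v → ℓ v ≡ iso → f U.sends u to unit v u
    unit-sends v {u} refl e with U.assigned? f u
    ... | yes (_ , s) = s
    ... | no ¬a = ⊥-elim (¬a (totalF u e))
    by-label : Label → Fin n → Fin n × Fin n
    -- A placeholder: separators are centres, and what a centre sends is not counted.
    by-label sep  v = v , v
    by-label iso  v = unit v (v ↑ˡ n) , unit v (n ↑ʳ v)
    by-label rest v = C.to v , C.to v
    target : Fin n → Fin n × Fin n
    target v = by-label (ℓ v) v
    targets : Targets (tabulate target)
    targets u ¬c rewrite lookup∘tabulate target u with ℓ u in eq
    ... | sep  = ⊥-elim (¬c (inj₁ refl))
    ... | rest = let c , e = C.leaf eq (¬c ∘ inj₂) in (inj₂ c , e) , (inj₂ c , e)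
    ... | iso  = to-sep (vertexˡ u) , to-sep (vertexʳ u)
      where
      to-sep : ∀ {x} → vertex x ≡ u → Target u (unit u x)
      to-sep {x} vx with edgeF (unit-sends u {x} vx eq)
      ... | _ , s , e = inj₁ s , subst (λ y → y ~ unit u x) vx e
    sep-bounds : ∀ c → ℓ c ≡ sep → 2 ≤ inflow (tabulate target) c × inflow (tabulate target) c ≤ 2 * k + 1
    sep-bounds c c-sep = subst (λ x → 2 ≤ x × x ≤ 2 * k + 1) (≡sym inflow≡load) (lowF c c-sep , loadF c)
      where
      silent : ∀ u → ℓ u ≢ iso → ∀ {x} → vertex x ≡ u → ⟦ U.sends? f x c ⟧ ≡ 0
      silent u ne {x} refl = ⟦⟧-no (U.sends? f x c) (λ e → ne (proj₁ (edgeF e)))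
      hits : ∀ u → ℓ u ≡ iso → ∀ {x} → vertex x ≡ u → ⟦ unit u x ≟ c ⟧ ≡ ⟦ U.sends? f x c ⟧
      hits u i {x} vx = ⟦⟧-cong (unit u x ≟ c) (U.sends? f x c)
        (λ e → trans (unit-sends u {x} vx i) (cong just e))
        (λ e → just-injective (trans (≡sym (unit-sends u {x} vx i)) e))
      pointwise : ∀ u → ⟦ ¬? (Centre? u) ⟧ * amount (lookup (tabulate target) u) c ≡
                        ⟦ U.sends? f (u ↑ˡ n) c ⟧ + ⟦ U.sends? f (n ↑ʳ u) c ⟧
      pointwise u rewrite lookup∘tabulate target u with ℓ u in eq
      ... | sep = ≡sym (cong₂ _+_ (silent u (λ e → sep≢iso (trans (≡sym eq) e)) (vertexˡ u)) (silent u (λ e → sep≢iso (trans (≡sym eq) e)) (vertexʳ u)))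
      ... | rest with C.Centre? u
      ...   | yes _ = ≡sym (cong₂ _+_ (silent u (λ e → iso≢rest (trans (≡sym e) eq)) (vertexˡ u)) (silent u (λ e → iso≢rest (trans (≡sym e) eq)) (vertexʳ u)))
      ...   | no ¬cu = trans (cong (λ x → 1 * (x + x)) (⟦⟧-no (C.to u ≟ c)
                (λ { refl → sep≢rest (trans (≡sym c-sep) (C.centre⊆ (proj₁ (C.leaf eq ¬cu)))) })))
                (≡sym (cong₂ _+_ (silent u (λ e → iso≢rest (trans (≡sym e) eq)) (vertexˡ u)) (silent u (λ e → iso≢rest (trans (≡sym e) eq)) (vertexʳ u))))
      pointwise u | iso with C.Centre? u
      ...   | yes cu = ⊥-elim (iso≢rest (trans (≡sym eq) (C.centre⊆ cu)))
      ...   | no _ = trans (*-identityˡ _) (cong₂ _+_ (hits u eq (vertexˡ u)) (hits u eq (vertexʳ u)))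
      inflow≡load : inflow (tabulate target) c ≡ U.load f c
      inflow≡load = trans (∑-cong pointwise) (trans (∑-+ (λ u → ⟦ U.sends? f (u ↑ˡ n) c ⟧) (λ u → ⟦ U.sends? f (n ↑ʳ u) c ⟧))
                                                    (≡sym (∑-++ n (λ u → ⟦ U.sends? f u c ⟧))))
    rest-bounds : ∀ c → C.Centre c → 2 ≤ inflow (tabulate target) c × inflow (tabulate target) c ≤ 2 * k + 1
    rest-bounds c cc = low , high
      where
      low : 2 ≤ inflow (tabulate target) c
      low with C.nonempty cc
      ... | v , r , ¬cv , e = ≤-trans (≤-reflexive (≡sym value)) (∑-term (λ u → ⟦ ¬? (Centre? u) ⟧ * amount (lookup (tabulate target) u) c) v)
        where
        value : ⟦ ¬? (Centre? v) ⟧ * amount (lookup (tabulate target) v) c ≡ 2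
        value rewrite lookup∘tabulate target v | r =
          cong₂ _*_ (⟦⟧-yes (¬? ((rest ≟ˡ sep) ⊎-dec C.Centre? v)) λ { (inj₁ ()) ; (inj₂ cv) → ¬cv cv })
                    (cong₂ _+_ (⟦⟧-yes (C.to v ≟ c) e) (⟦⟧-yes (C.to v ≟ c) e))
      pointwise : ∀ u → ⟦ ¬? (Centre? u) ⟧ * amount (lookup (tabulate target) u) c ≤
                        2 * ⟦ rest? opt u ×-dec (C.to u ≟ c) ⟧
      pointwise u rewrite lookup∘tabulate target u with ℓ u in eq
      ... | sep = z≤n
      ... | rest = ≤-trans (*-monoˡ-≤ (⟦ C.to u ≟ c ⟧ + ⟦ C.to u ≟ c ⟧) (⟦⟧≤1 (¬? ((rest ≟ˡ sep) ⊎-dec C.Centre? u))))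
                           (≤-reflexive (trans (*-identityˡ _) (cong (⟦ C.to u ≟ c ⟧ +_) (≡sym (+-identityʳ _)))))
      ... | iso = ≤-trans (*-monoʳ-≤ ⟦ ¬? ((iso ≟ˡ sep) ⊎-dec C.Centre? u) ⟧
                            (≤-reflexive (cong₂ _+_ (miss (vertexˡ u)) (miss (vertexʳ u)))))
                          (≤-reflexive (*-zeroʳ ⟦ ¬? ((iso ≟ˡ sep) ⊎-dec C.Centre? u) ⟧))
        where
        miss : ∀ {x} → vertex x ≡ u → ⟦ unit u x ≟ c ⟧ ≡ 0
        miss {x} vx = ⟦⟧-no (unit u x ≟ c) λ { refl →
          sep≢rest (trans (≡sym (proj₁ (proj₂ (edgeF (unit-sends u {x} vx eq))))) (C.centre⊆ cc)) }
      high : inflow (tabulate target) c ≤ 2 * k + 1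
      high = begin
        inflow (tabulate target) c ≤⟨ ∑-mono pointwise ⟩
        ∑ (λ u → 2 * ⟦ rest? opt u ×-dec (C.to u ≟ c) ⟧) ≡⟨ ∑-* 2 (λ u → ⟦ rest? opt u ×-dec (C.to u ≟ c) ⟧) ⟩
        2 * ∑ (λ u → ⟦ rest? opt u ×-dec (C.to u ≟ c) ⟧) ≤⟨ *-monoʳ-≤ 2 (≤-trans (C.small c) 2≤k) ⟩
        2 * k ≤⟨ m≤m+n _ 1 ⟩
        2 * k + 1 ∎
        where open ≤-Reasoning

-- Minimising the number of split senders

module Halves {n} (G : SimpleGraph n) (k : ℕ) (Centre : Fin n → Set) (Centre? : ∀ v → Dec (Centre v)) where

  open HalfFlow G k Centre Centre?

  Half : State → Fin n → Set
  Half σ u = ¬ Centre u × proj₁ (lookup σ u) ≢ proj₂ (lookup σ u)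

  half? : ∀ σ u → Dec (Half σ u)
  half? σ u = ¬? (Centre? u) ×-dec ¬? (proj₁ (lookup σ u) ≟ proj₂ (lookup σ u))

  halves : State → ℕ
  halves σ = ∑ λ u → ⟦ half? σ u ⟧

  -- A split sender seen as an edge of a multigraph on the centres. The stored pair is ordered and
  -- the edge is not, hence the two alternatives.
  Link : State → Fin n → Fin n → Fin n → Set
  Link σ y c d = ¬ Centre y × c ≢ d × (lookup σ y ≡ (c , d) ⊎ lookup σ y ≡ (d , c))

  link? : ∀ σ y c d → Dec (Link σ y c d)
  link? σ y c d = ¬? (Centre? y) ×-dec (¬? (c ≟ d) ×-dec
    ((×-≡-dec _≟_ _≟_ (lookup σ y) (c , d)) ⊎-dec (×-≡-dec _≟_ _≟_ (lookup σ y) (d , c))))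

  link-sym : ∀ {σ y c d} → Link σ y c d → Link σ y d c
  link-sym (¬cy , c≢d , inj₁ e) = ¬cy , c≢d ∘ ≡sym , inj₂ e
  link-sym (¬cy , c≢d , inj₂ e) = ¬cy , c≢d ∘ ≡sym , inj₁ e

  link-half : ∀ {σ y c d} → Link σ y c d → Half σ y
  link-half (¬cy , c≢d , inj₁ e) rewrite e = ¬cy , c≢d
  link-half (¬cy , c≢d , inj₂ e) rewrite e = ¬cy , c≢d ∘ ≡sym

  half-link : ∀ {σ y} → Half σ y → Link σ y (proj₁ (lookup σ y)) (proj₂ (lookup σ y))
  half-link (¬cy , ne) = ¬cy , ne , inj₁ refl

  link-amount : ∀ {σ y c d} → Link σ y c d → ∀ x → amount (lookup σ y) x ≡ ⟦ c ≟ x ⟧ + ⟦ d ≟ x ⟧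
  link-amount (_ , _ , inj₁ e) x rewrite e = refl
  link-amount {c = c} {d} (_ , _ , inj₂ e) x rewrite e = +-comm ⟦ d ≟ x ⟧ _

  link-target : ∀ {σ y c d} → Targets σ → Link σ y c d → Target y c
  link-target {y = y} tg (¬cy , _ , inj₁ e) = subst (Target y) (cong proj₁ e) (proj₁ (tg y ¬cy))
  link-target {y = y} tg (¬cy , _ , inj₂ e) = subst (Target y) (cong proj₂ e) (proj₂ (tg y ¬cy))

  link-end : ∀ {σ y c d c′ d′} → Link σ y c d → Link σ y c′ d′ → c ≡ c′ ⊎ c ≡ d′
  link-end (_ , _ , inj₁ e) (_ , _ , inj₁ e′) = inj₁ (cong proj₁ (trans (≡sym e) e′))
  link-end (_ , _ , inj₁ e) (_ , _ , inj₂ e′) = inj₂ (cong proj₁ (trans (≡sym e) e′))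
  link-end (_ , _ , inj₂ e) (_ , _ , inj₁ e′) = inj₂ (cong proj₂ (trans (≡sym e) e′))
  link-end (_ , _ , inj₂ e) (_ , _ , inj₂ e′) = inj₁ (cong proj₂ (trans (≡sym e) e′))

  settle : State → Fin n → Fin n → State
  settle σ y c = σ [ y ]≔ (c , c)

  link-settle : ∀ {σ y z u c d} → u ≢ y → Link σ u c d → Link (settle σ y z) u c d
  link-settle {σ} {y} {z} {u} u≢y (¬cu , c≢d , e) rewrite lookup∘update′ u≢y σ (z , z) = ¬cu , c≢d , e

  settle-targets : ∀ {σ y c d} → Targets σ → Link σ y c d → Targets (settle σ y c)
  settle-targets {σ} {y} {c} tg link u ¬cu with u ≟ y
  ... | yes refl rewrite lookup∘update u σ (c , c) = let t = link-target {σ} tg link in t , t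
  ... | no u≢y rewrite lookup∘update′ u≢y σ (c , c) = tg u ¬cu

  settle-inflow : ∀ {σ y c d} → Link σ y c d →
    ∀ x → inflow σ x + ⟦ c ≟ x ⟧ ≡ inflow (settle σ y c) x + ⟦ d ≟ x ⟧
  settle-inflow {σ} {y} {c} {d} link@(¬cy , _) x = +-cancelʳ-≡ ⟦ c ≟ x ⟧ _ _ (begin
    inflow σ x + ⟦ c ≟ x ⟧ + ⟦ c ≟ x ⟧
      ≡⟨ +-assoc (inflow σ x) _ _ ⟩
    inflow σ x + (⟦ c ≟ x ⟧ + ⟦ c ≟ x ⟧)
      ≡⟨ cong (inflow σ x +_) (≡sym new) ⟩
    inflow σ x + term σ′ y
      ≡⟨ ∑-change (term σ) (term σ′) y (λ u u≢y → cong (λ p → ⟦ ¬? (Centre? u) ⟧ * amount p x) (≡sym (lookup∘update′ u≢y σ (c , c)))) ⟩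
    inflow σ′ x + term σ y
      ≡⟨ cong (inflow σ′ x +_) (trans old (+-comm ⟦ c ≟ x ⟧ _)) ⟩
    inflow σ′ x + (⟦ d ≟ x ⟧ + ⟦ c ≟ x ⟧)
      ≡⟨ ≡sym (+-assoc (inflow σ′ x) _ _) ⟩
    inflow σ′ x + ⟦ d ≟ x ⟧ + ⟦ c ≟ x ⟧ ∎)
    where
    open ≡-Reasoning
    σ′ : State
    σ′ = settle σ y c
    term : State → Fin n → ℕ
    term τ u = ⟦ ¬? (Centre? u) ⟧ * amount (lookup τ u) x
    new : term σ′ y ≡ ⟦ c ≟ x ⟧ + ⟦ c ≟ x ⟧
    new = trans (cong₂ _*_ (⟦⟧-yes (¬? (Centre? y)) ¬cy) (cong (λ p → amount p x) (lookup∘update y σ (c , c)))) (*-identityˡ _)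
    old : term σ y ≡ ⟦ c ≟ x ⟧ + ⟦ d ≟ x ⟧
    old = trans (cong₂ _*_ (⟦⟧-yes (¬? (Centre? y)) ¬cy) (link-amount {σ} link x)) (*-identityˡ _)

  settle-halves : ∀ {σ y c d} → Link σ y c d → suc (halves (settle σ y c)) ≡ halves σ
  settle-halves {σ} {y} {c} link = begin
    suc (halves σ′)                    ≡⟨ +-comm 1 _ ⟩
    halves σ′ + 1                      ≡⟨ cong (halves σ′ +_) (≡sym (⟦⟧-yes (half? σ y) (link-half {σ} link))) ⟩
    halves σ′ + ⟦ half? σ y ⟧          ≡⟨ ≡sym (∑-change (λ u → ⟦ half? σ u ⟧) (λ u → ⟦ half? σ′ u ⟧) y others) ⟩
    halves σ + ⟦ half? σ′ y ⟧          ≡⟨ cong (halves σ +_) (⟦⟧-no (half? σ′ y) (λ { (_ , ne) → ne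
                                            (trans (cong proj₁ (lookup∘update y σ (c , c))) (≡sym (cong proj₂ (lookup∘update y σ (c , c))))) })) ⟩
    halves σ + 0                       ≡⟨ +-identityʳ _ ⟩
    halves σ ∎
    where
    open ≡-Reasoning
    σ′ : State
    σ′ = settle σ y c
    others : ∀ u → u ≢ y → ⟦ half? σ u ⟧ ≡ ⟦ half? σ′ u ⟧
    others u u≢y rewrite lookup∘update′ u≢y σ (c , c) = refl

  -- An unsplit sender contributes two units, so a single unit comes from a split one.
  inflow-one : ∀ σ d → inflow σ d ≡ 1 → ∃ λ y → ∃ λ e → Link σ y d e
  inflow-one σ d one with ∑-pos (λ u → ⟦ ¬? (Centre? u) ⟧ * amount (lookup σ u) d) (≤-reflexive (≡sym one))
  ... | y , pos = y , link (Centre? y) (proj₁ (lookup σ y) ≟ d) (proj₂ (lookup σ y) ≟ d) refl refl refl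
    where
    a = proj₁ (lookup σ y)
    b = proj₂ (lookup σ y)
    small : ⟦ ¬? (Centre? y) ⟧ * amount (lookup σ y) d ≤ 1
    small = ≤-trans (∑-term (λ u → ⟦ ¬? (Centre? u) ⟧ * amount (lookup σ u) d) y) (≤-reflexive one)
    link : (p : Dec (Centre y)) (q : Dec (a ≡ d)) (r : Dec (b ≡ d)) →
           Centre? y ≡ p → (a ≟ d) ≡ q → (b ≟ d) ≡ r → ∃ λ e → Link σ y d e
    link (yes cy) _ _ ep _ _ = ⊥-elim (n≮0 (subst (λ p → 1 ≤ ⟦ ¬? p ⟧ * amount (lookup σ y) d) ep pos))
    link (no ¬cy) (yes p) (no q) _ _ _ = b , ¬cy , (λ e → q (≡sym e)) , inj₁ (cong (_, b) p)
    link (no ¬cy) (no p) (yes q) _ _ _ = a , ¬cy , (λ e → p (≡sym e)) , inj₂ (cong (a ,_) q)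
    link (no _) (yes _) (yes _) ep eq er with subst₂ (λ p x → ⟦ ¬? p ⟧ * x ≤ 1) ep (cong₂ (λ q r → ⟦ q ⟧ + ⟦ r ⟧) eq er) small
    ... | s≤s ()
    link (no _) (no _) (no _) ep eq er with subst₂ (λ p x → 1 ≤ ⟦ ¬? p ⟧ * x) ep (cong₂ (λ q r → ⟦ q ⟧ + ⟦ r ⟧) eq er) pos
    ... | ()

  Improvement : State → Set
  Improvement σ = ∃ λ σ′ → Valid σ′ × halves σ′ < halves σ

  -- A centre with room takes over a half edge; the other end of that edge may then
  -- be left with a single unit, and it takes over a half edge in turn.
  pull : ∀ fuel σ {y c d} → halves σ ≤ fuel → Targets σ → Link σ y c d →
    (∀ x → Centre x → x ≢ c → 2 ≤ inflow σ x) → 1 ≤ inflow σ c →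
    (∀ x → Centre x → inflow σ x ≤ 2 * k + 1) → inflow σ c ≤ 2 * k → Improvement σ
  pull zero σ fuel tg link low lowc high room = ⊥-elim (n≮0 (≤-trans (≤-reflexive (settle-halves {σ} link)) fuel))
  pull (suc fuel) σ {y} {c} {d} le tg link@(_ , c≢d , _) low lowc high room = result (2 ≤? inflow σ′ d)
    where
    σ′ : State
    σ′ = settle σ y c
    at-c : inflow σ′ c ≡ suc (inflow σ c)
    at-c = trans (≡sym (+-identityʳ _)) (trans (cong (inflow σ′ c +_) (≡sym (⟦⟧-no (d ≟ c) (c≢d ∘ ≡sym))))
             (trans (≡sym (settle-inflow {σ} link c)) (trans (cong (inflow σ c +_) (⟦⟧-yes (c ≟ c) refl)) (+-comm _ 1))))
    at-d : inflow σ d ≡ suc (inflow σ′ d)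
    at-d = trans (≡sym (+-identityʳ _)) (trans (cong (inflow σ d +_) (≡sym (⟦⟧-no (c ≟ d) c≢d)))
             (trans (settle-inflow {σ} link d) (trans (cong (inflow σ′ d +_) (⟦⟧-yes (d ≟ d) refl)) (+-comm _ 1))))
    elsewhere : ∀ x → x ≢ c → x ≢ d → inflow σ′ x ≡ inflow σ x
    elsewhere x x≢c x≢d = trans (≡sym (+-identityʳ _)) (trans (cong (inflow σ′ x +_) (≡sym (⟦⟧-no (d ≟ x) (x≢d ∘ ≡sym))))
      (trans (≡sym (settle-inflow {σ} link x)) (trans (cong (inflow σ x +_) (⟦⟧-no (c ≟ x) (x≢c ∘ ≡sym))) (+-identityʳ _))))
    tg′ : Targets σ′
    tg′ = settle-targets {σ} tg link
    centre-d : Centre d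
    centre-d = proj₁ (link-target {σ} tg (link-sym {σ} link))
    -- Only one centre at a time may be short of two units: settling lifts `c` to at least two and
    -- moves the deficit to `d`.
    low′ : ∀ x → Centre x → x ≢ d → 2 ≤ inflow σ′ x
    low′ x cx x≢d with x ≟ c
    ... | yes refl rewrite at-c = s≤s lowc
    ... | no x≢c rewrite elsewhere x x≢c x≢d = low x cx x≢c
    high′ : ∀ x → Centre x → inflow σ′ x ≤ 2 * k + 1
    high′ x cx with x ≟ c | x ≟ d
    ... | yes refl | _ rewrite at-c = ≤-trans (s≤s room) (≤-reflexive (+-comm 1 _))
    ... | no _ | yes refl = ≤-trans (n≤1+n _) (≤-trans (≤-reflexive (≡sym at-d)) (high d centre-d))
    ... | no x≢c | no x≢d rewrite elsewhere x x≢c x≢d = high x cx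
    fewer : suc (halves σ′) ≡ halves σ
    fewer = settle-halves {σ} link
    result : Dec (2 ≤ inflow σ′ d) → Improvement σ
    result (yes ok) = σ′ , (tg′ , λ x cx → bound x cx , high′ x cx) , ≤-reflexive fewer
      where
      bound : ∀ x → Centre x → 2 ≤ inflow σ′ x
      bound x cx with x ≟ d
      ... | yes refl = ok
      ... | no x≢d   = low′ x cx x≢d
    result (no ¬ok) =
      let y′ , e , link′ = inflow-one σ′ d one
          σ″ , v″ , lt = pull fuel σ′ (≤-pred (≤-trans (≤-reflexive fewer) le)) tg′ link′ low′ (≤-reflexive (≡sym one)) high′
                           -- `d` holds a single unit, which is at most the inflow of `c`, hence at
                           -- most 2k.
                           (≤-trans (≤-reflexive one) (≤-trans lowc room))
      in σ″ , v″ , ≤-trans lt (≤-trans (n≤1+n _) (≤-reflexive fewer))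
      where
      one : inflow σ′ d ≡ 1
      one = ≤-antisym (≤-pred (≰⇒> ¬ok)) (≤-pred (≤-trans (low d centre-d (c≢d ∘ ≡sym)) (≤-reflexive at-d)))

  data Trail (σ : State) : List (Fin n) → Fin n → Fin n → Set where
    []  : ∀ {x} → Trail σ [] x x
    _∷_ : ∀ {y ys x x′ z} → Link σ y x x′ → Trail σ ys x′ z → Trail σ (y ∷ ys) x z

  trail-settle : ∀ {σ y c ys x z} → All (y ≢_) ys → Trail σ ys x z → Trail (settle σ y c) ys x z
  trail-settle [] [] = []
  trail-settle {σ} {y} {c} {ys = u ∷ _} (y≢u ∷ y∉) (link ∷ t) = link-settle {σ} {y} {c} (y≢u ∘ ≡sym) link ∷ trail-settle y∉ t

  -- Each split sender on the trail settles on its far end. Intermediate centres gain one unit and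
  -- lose one, so on a closed trail all inflows are preserved while its senders stop being split.
  push : ∀ {ys} σ {x z} → Targets σ → Trail σ ys x z → Unique ys →
    ∃ λ σ′ → Targets σ′ × (∀ w → inflow σ w + ⟦ z ≟ w ⟧ ≡ inflow σ′ w + ⟦ x ≟ w ⟧) × halves σ′ + length ys ≡ halves σ
  push σ tg [] [] = σ , tg , (λ _ → refl) , +-identityʳ _
  push {y ∷ ys} σ {x} {z} tg (_∷_ {x′ = x′} link t) (y∉ ∷ u)
    with push (settle σ y x′) (settle-targets {σ} tg (link-sym {σ} link)) (trail-settle y∉ t) u
  ... | σ″ , tg″ , flow , fewer = σ″ , tg″ , flow″ ,
        trans (+-suc (halves σ″) _) (trans (cong suc fewer) (settle-halves {σ} (link-sym {σ} link)))
    where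
    σ′ : State
    σ′ = settle σ y x′
    exchange : ∀ a b c d → (a + b) + (c + d) ≡ (a + d) + (c + b)
    exchange = solve-∀
    flow″ : ∀ w → inflow σ w + ⟦ z ≟ w ⟧ ≡ inflow σ″ w + ⟦ x ≟ w ⟧
    flow″ w = +-cancelʳ-≡ (inflow σ′ w + ⟦ x′ ≟ w ⟧) _ _ (begin
      (inflow σ w + ⟦ z ≟ w ⟧) + (inflow σ′ w + ⟦ x′ ≟ w ⟧)
        ≡⟨ exchange (inflow σ w) _ _ _ ⟩
      (inflow σ w + ⟦ x′ ≟ w ⟧) + (inflow σ′ w + ⟦ z ≟ w ⟧)
        ≡⟨ cong₂ _+_ (settle-inflow {σ} (link-sym {σ} link) w) (flow w) ⟩
      (inflow σ′ w + ⟦ x ≟ w ⟧) + (inflow σ″ w + ⟦ x′ ≟ w ⟧)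
        ≡⟨ +-comm (inflow σ′ w + ⟦ x ≟ w ⟧) _ ⟩
      (inflow σ″ w + ⟦ x′ ≟ w ⟧) + (inflow σ′ w + ⟦ x ≟ w ⟧)
        ≡⟨ exchange (inflow σ″ w) _ _ _ ⟩
      (inflow σ″ w + ⟦ x ≟ w ⟧) + (inflow σ′ w + ⟦ x′ ≟ w ⟧) ∎)
      where open ≡-Reasoning

  -- `acyclic` forbids closed trails without a repeated sender, rather than cycles through distinct
  -- centres, and so excludes parallel split senders as well.
  record Minimal : Set where
    field
      σ       : State
      targets : Targets σ
      low     : ∀ c → Centre c → 2 ≤ inflow σ c
      high    : ∀ c → Centre c → inflow σ c ≤ 2 * k + 1
      tight   : ∀ {y c d} → Link σ y c d → inflow σ c ≡ 2 * k + 1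
      acyclic : ∀ {y ys x} → Trail σ (y ∷ ys) x x → ¬ Unique (y ∷ ys)

  minimal : ∀ σ → Valid σ → Minimal
  minimal σ₀ valid₀ with argmin (search-Vec (search-× any? any?)) valid? halves σ₀ valid₀
  ... | σ , (tg , bounds) , best = record
    { σ = σ ; targets = tg ; low = λ c cc → proj₁ (bounds c cc) ; high = λ c cc → proj₂ (bounds c cc)
    ; tight = tight ; acyclic = acyclic }
    where
    no-improvement : ¬ Improvement σ
    no-improvement (σ′ , valid′ , lt) = <-irrefl refl (≤-trans lt (best σ′ valid′))
    tight : ∀ {y c d} → Link σ y c d → inflow σ c ≡ 2 * k + 1
    tight {c = c} link with inflow σ c ≤? 2 * k | link-target {σ} tg link
    ... | yes room | cc , _ = ⊥-elim (no-improvement (pull _ σ ≤-refl tg link (λ x cx _ → proj₁ (bounds x cx))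
                          (≤-trans (s≤s z≤n) (proj₁ (bounds c cc))) (λ x cx → proj₂ (bounds x cx)) room))
    ... | no full | cc , _ = ≤-antisym (proj₂ (bounds c cc)) (≤-trans (≤-reflexive (+-comm _ 1)) (≰⇒> full))
    acyclic : ∀ {y ys x} → Trail σ (y ∷ ys) x x → ¬ Unique (y ∷ ys)
    acyclic {y} {ys} t u with push σ tg t u
    ... | σ′ , tg′ , flow , fewer = no-improvement (σ′ , (tg′ , λ c cc →
            subst (λ i → 2 ≤ i × i ≤ 2 * k + 1) (+-cancelʳ-≡ _ _ _ (flow c)) (bounds c cc)) ,
            ≤-trans (m≤m+n _ (length ys)) (≤-reflexive (trans (≡sym (+-suc (halves σ′) (length ys))) fewer)))

-- Star components

⌊⌋-cong : (p : Dec P) (q : Dec Q) → (P → Q) → (Q → P) → ⌊ p ⌋ ≡ ⌊ q ⌋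
⌊⌋-cong (yes _) (yes _) _ _ = refl
⌊⌋-cong (yes p) (no ¬q) f _ = ⊥-elim (¬q (f p))
⌊⌋-cong (no ¬p) (yes q) _ g = ⊥-elim (¬p (g q))
⌊⌋-cong (no _)  (no _)  _ _ = refl

⌊⌋-false : (p : Dec P) → ¬ P → ⌊ p ⌋ ≡ false
⌊⌋-false (yes p) ¬p = ⊥-elim (¬p p)
⌊⌋-false (no _)  _  = refl

module _ {A : Fin n → Fin n → Bool} where

  infixr 5 _++ʷ_
  _++ʷ_ : ∀ {u v w} → Walk A u v → Walk A v w → Walk A u w
  here     ++ʷ q = q
  step e p ++ʷ q = step e (p ++ʷ q)

  reverseʷ : (∀ {u v} → T (A u v) → T (A v u)) → ∀ {u w} → Walk A u w → Walk A w u
  reverseʷ s here       = here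
  reverseʷ s (step e p) = reverseʷ s p ++ʷ step (s e) here

  invariant : (Q : Fin n → Set) → (∀ {x y} → Q x → T (A x y) → Q y) → ∀ {u w} → Q u → Walk A u w → Q w
  invariant Q h q here       = q
  invariant Q h q (step e p) = invariant Q h (h q e) p

  abstract
    walk? : ∀ u w → Dec (Walk A u w)
    walk? u w with In? w
      where open Reachable (reachable (λ x y → T? (A x y)) u)
    ... | yes i = let _ , p , _ = Reachable.path (reachable (λ x y → T? (A x y)) u) i in yes (to-walk p)
      where
      to-walk : ∀ {l x} → Path (λ x y → T (A x y)) u l x → Walk A u x
      to-walk start   = here
      to-walk (p ▷ e) = to-walk p ++ʷ step e here
    ... | no ¬i = no λ p → ¬i (invariant In (λ i e → closed i e) source p)
      where open Reachable (reachable (λ x y → T? (A x y)) u)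

record Enumeration (P : Fin n → Set) : Set where
  field
    size     : ℕ
    e        : Fin size → Fin n
    e-inj    : ∀ {i j} → e i ≡ e j → i ≡ j
    sound    : ∀ i → P (e i)
    complete : ∀ {x} → P x → ∃ λ i → e i ≡ x

abstract
  enumerate : {P : Fin n → Set} → (∀ x → Dec (P x)) → Enumeration P
  enumerate {zero}  P? = record { size = 0 ; e = λ () ; e-inj = λ { {()} } ; sound = λ () ; complete = λ { {()} } }
  enumerate {suc n} {P} P? with P? zero | enumerate (P? ∘ suc)
  ... | no ¬p | en = record
    { size = size ; e = suc ∘ e ; e-inj = λ eq → e-inj (fsuc-injective eq) ; sound = sound
    ; complete = λ { {zero} p → ⊥-elim (¬p p) ; {suc x} p → let i , eq = complete p in i , cong suc eq } }
    where open Enumeration en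
  ... | yes p | en = record
    { size = suc size ; e = e′ ; e-inj = e′-inj ; sound = λ { zero → p ; (suc i) → sound i }
    ; complete = λ { {zero} _ → zero , refl ; {suc x} q → let i , eq = complete q in suc i , cong suc eq } }
    where
    open Enumeration en
    e′ : Fin (suc size) → Fin (suc n)
    e′ zero    = zero
    e′ (suc i) = suc (e i)
    e′-inj : ∀ {i j} → e′ i ≡ e′ j → i ≡ j
    e′-inj {zero}  {zero}  _  = refl
    e′-inj {suc i} {suc j} eq = cong suc (e-inj (fsuc-injective eq))

module _ {n} {P : Fin n → Set} (P? : ∀ x → Dec (P x)) (en : Enumeration P) where
  open Enumeration en

  enumeration-count : {Q : Fin n → Set} (Q? : ∀ x → Dec (Q x)) →
    ∑ (λ i → ⟦ Q? (e i) ⟧) ≡ ∑ (λ x → ⟦ P? x ×-dec Q? x ⟧)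
  enumeration-count {Q} Q? = ≤-antisym
    (∑-rel (λ i → Q? (e i)) (λ x → P? x ×-dec Q? x) (λ i x → e i ≟ x)
       (λ {i} q → e i , (sound i , q) , refl) (λ _ _ p q → e-inj (trans p (≡sym q))))
    (∑-rel (λ x → P? x ×-dec Q? x) (λ i → Q? (e i)) (λ x i → e i ≟ x)
       (λ { (p , q) → let i , eq = complete p in i , subst Q (≡sym eq) q , eq }) (λ _ _ p q → trans (≡sym p) q))

  enumeration-size : size ≡ ∑ (λ x → ⟦ P? x ⟧)
  enumeration-size = trans (trans (≡sym (*-identityʳ size)) (≡sym (∑-const {size} 1)))
    (trans (enumeration-count (λ _ → yes tt)) (∑-cong (λ x → ⟦⟧-cong (P? x ×-dec yes tt) (P? x) proj₁ (_, tt))))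

2*≤⇒≤ : ∀ a b → 2 * a ≤ 2 * b + 1 → a ≤ b
2*≤⇒≤ a b h = ≮⇒≥ (λ lt → <-irrefl refl (begin-strict
  2 * b + 1     <⟨ ≤-refl ⟩
  suc (2 * b + 1) ≡⟨ lemma b ⟩
  2 * suc b     ≤⟨ *-monoʳ-≤ 2 lt ⟩
  2 * a         ≤⟨ h ⟩
  2 * b + 1     ∎))
  where
  open ≤-Reasoning
  lemma : ∀ b → suc (2 * b + 1) ≡ 2 * suc b
  lemma = solve-∀

shift : ∀ {F : SimpleGraph n} {u v H} → Walk (Adj F) u v → ComponentIso F v H → ComponentIso F u H
shift {F = F} p (φ , inj , reach , onto , adj) =
  φ , inj , (λ a → p ++ʷ reach a) ,
  (λ w q → onto w (reverseʷ (λ {a} {b} → subst T (SimpleGraph.sym F a b)) p ++ʷ q)) , adj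

module Factor {n} (G : SimpleGraph n) (k : ℕ)
              (Centre : Fin n → Set) (Centre? : ∀ v → Dec (Centre v))
              (minimal : Halves.Minimal G k Centre Centre?) where

  open HalfFlow G k Centre Centre?
  open Halves G k Centre Centre? hiding (minimal)
  open Halves.Minimal minimal

  π₁ π₂ : Fin n → Fin n
  π₁ u = proj₁ (lookup σ u)
  π₂ u = proj₂ (lookup σ u)

  Joins : Fin n → Fin n → Set
  Joins u c = ¬ Centre u × Centre c × (π₁ u ≡ c ⊎ π₂ u ≡ c)

  Edge : Fin n → Fin n → Set
  Edge u w = Joins u w ⊎ Joins w u

  abstract
    edge? : ∀ u w → Dec (Edge u w)
    edge? u w = joins? u w ⊎-dec joins? w u
      where
      joins? : ∀ u c → Dec (Joins u c)
      joins? u c = ¬? (Centre? u) ×-dec (Centre? c ×-dec ((π₁ u ≟ c) ⊎-dec (π₂ u ≟ c)))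

  edge-sym : ∀ {u w} → Edge u w → Edge w u
  edge-sym = [ inj₂ , inj₁ ]′

  F : SimpleGraph n
  F = record
    { Adj    = λ u w → ⌊ edge? u w ⌋
    ; sym    = λ u w → ⌊⌋-cong (edge? u w) (edge? w u) edge-sym edge-sym
    ; irrefl = λ u → ⌊⌋-false (edge? u u) (λ { (inj₁ (¬c , c , _)) → ¬c c ; (inj₂ (¬c , c , _)) → ¬c c }) }

  edge⁺ : ∀ {u w} → Edge u w → T (Adj F u w)
  edge⁺ {u} {w} = fromWitness {a? = edge? u w}

  edge⁻ : ∀ {u w} → T (Adj F u w) → Edge u w
  edge⁻ {u} {w} = toWitness {a? = edge? u w}

  _⟿_ : Fin n → Fin n → Set
  _⟿_ = Walk (Adj F)

  edge-walk : ∀ {u w} → Edge u w → u ⟿ w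
  edge-walk e = step (edge⁺ e) here

  joins⇒adj : ∀ {u c} → Joins u c → T (Adj G u c)
  joins⇒adj {u} (¬cu , _ , inj₁ refl) = proj₂ (proj₁ (targets u ¬cu))
  joins⇒adj {u} (¬cu , _ , inj₂ refl) = proj₂ (proj₂ (targets u ¬cu))

  spanning : Spanning⊆ F G
  spanning u w e with edge⁻ {u} {w} e
  ... | inj₁ j = joins⇒adj j
  ... | inj₂ j = subst T (SimpleGraph.sym G w u) (joins⇒adj j)

  joins₁ : ∀ {u} → ¬ Centre u → Joins u (π₁ u)
  joins₁ {u} ¬c = ¬c , proj₁ (proj₁ (targets u ¬c)) , inj₁ refl

  Linked : Fin n → Set
  Linked c = ∃ λ y → ∃ λ d → Link σ y c d

  FullAt : Fin n → Fin n → Set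
  FullAt c u = ¬ Centre u × π₁ u ≡ c × π₂ u ≡ c

  fullAt? : ∀ c u → Dec (FullAt c u)
  fullAt? c u = ¬? (Centre? u) ×-dec ((π₁ u ≟ c) ×-dec (π₂ u ≟ c))

  HalfAt : Fin n → Fin n → Set
  HalfAt c u = Half σ u × (π₁ u ≡ c ⊎ π₂ u ≡ c)

  halfAt? : ∀ c u → Dec (HalfAt c u)
  halfAt? c u = half? σ u ×-dec ((π₁ u ≟ c) ⊎-dec (π₂ u ≟ c))

  halfAt-link : ∀ {c u} → HalfAt c u → ∃ λ d → Link σ u c d
  halfAt-link {u = u} ((¬cu , ne) , inj₁ refl) = π₂ u , ¬cu , ne , inj₁ refl
  halfAt-link {u = u} ((¬cu , ne) , inj₂ refl) = π₁ u , ¬cu , ne ∘ ≡sym , inj₂ refl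

  joins-cases : ∀ {u c} → Joins u c → FullAt c u ⊎ HalfAt c u
  joins-cases {u} {c} (¬cu , cc , at) with π₁ u ≟ π₂ u
  ... | no ne  = inj₂ ((¬cu , ne) , at)
  ... | yes eq with at
  ...   | inj₁ p = inj₁ (¬cu , p , trans (≡sym eq) p)
  ...   | inj₂ q = inj₁ (¬cu , trans eq q , q)

  inflow-split : ∀ c → inflow σ c ≡ ∑ (λ u → ⟦ halfAt? c u ⟧) + 2 * ∑ (λ u → ⟦ fullAt? c u ⟧)
  inflow-split c = trans (∑-cong pointwise) (trans (∑-+ (λ u → ⟦ halfAt? c u ⟧) (λ u → 2 * ⟦ fullAt? c u ⟧))
                     (cong (∑ (λ u → ⟦ halfAt? c u ⟧) +_) (∑-* 2 (λ u → ⟦ fullAt? c u ⟧))))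
    where
    pointwise : ∀ u → ⟦ ¬? (Centre? u) ⟧ * amount (lookup σ u) c ≡ ⟦ halfAt? c u ⟧ + 2 * ⟦ fullAt? c u ⟧
    pointwise u with Centre? u
    ... | yes _ = refl
    ... | no ¬cu with π₁ u ≟ π₂ u | π₁ u ≟ c | π₂ u ≟ c
    ...   | yes eq | yes p | yes q = refl
    ...   | yes eq | yes p | no q  = ⊥-elim (q (trans (≡sym eq) p))
    ...   | yes eq | no p  | yes q = ⊥-elim (p (trans eq q))
    ...   | yes eq | no p  | no q  = refl
    ...   | no ne  | yes p | yes q = ⊥-elim (ne (trans p (≡sym q)))
    ...   | no ne  | yes p | no q  = refl
    ...   | no ne  | no p  | yes q = refl
    ...   | no ne  | no p  | no q  = refl

  -- Without split senders the inflow is twice the number of leaves, so the inflow bounds 2 and 2k +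
  -- 1 become 1 and, by parity, k.
  star : ∀ {c} → Centre c → ¬ Linked c → Σ ℕ λ j → 1 ≤ j × j ≤ k × ComponentIso F c (Star j)
  star {c} cc unlinked = size , 1≤size , size≤k , φ , φ-inj , φ-walk , φ-onto , λ a b → mk⇔ (φ-adj⁻ a b) (φ-adj⁺ a b)
    where
    en : Enumeration (FullAt c)
    en = enumerate (fullAt? c)
    open Enumeration en
    no-half : ∀ {u} → ¬ HalfAt c u
    no-half h = unlinked (_ , halfAt-link h)
    joins-full : ∀ {u} → Joins u c → FullAt c u
    joins-full j with joins-cases j
    ... | inj₁ f = f
    ... | inj₂ h = ⊥-elim (no-half h)
    inflow≡ : inflow σ c ≡ 2 * size
    inflow≡ = trans (inflow-split c) (trans (cong (_+ 2 * ∑ (λ u → ⟦ fullAt? c u ⟧)) (∑-zero (λ u → ⟦⟧-no (halfAt? c u) no-half)))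
                (cong (2 *_) (≡sym (enumeration-size (fullAt? c) en))))
    1≤size : 1 ≤ size
    1≤size = *-cancelˡ-≤ 2 (subst (2 ≤_) inflow≡ (low c cc))
    size≤k : size ≤ k
    size≤k = 2*≤⇒≤ size k (subst (_≤ 2 * k + 1) inflow≡ (high c cc))
    φ : Fin (suc size) → Fin n
    φ zero    = c
    φ (suc i) = e i
    e≢c : ∀ i → e i ≢ c
    e≢c i eq = proj₁ (sound i) (subst Centre (≡sym eq) cc)
    φ-inj : ∀ a b → φ a ≡ φ b → a ≡ b
    φ-inj zero    zero    _  = refl
    φ-inj zero    (suc j) eq = ⊥-elim (e≢c j (≡sym eq))
    φ-inj (suc i) zero    eq = ⊥-elim (e≢c i eq)
    φ-inj (suc i) (suc j) eq = cong suc (e-inj eq)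
    leaf-edge : ∀ i → Joins (e i) c
    leaf-edge i = proj₁ (sound i) , cc , inj₁ (proj₁ (proj₂ (sound i)))
    leaf-only : ∀ {i w} → Edge (e i) w → w ≡ c
    leaf-only {i} (inj₁ (_ , _ , inj₁ eq)) = trans (≡sym eq) (proj₁ (proj₂ (sound i)))
    leaf-only {i} (inj₁ (_ , _ , inj₂ eq)) = trans (≡sym eq) (proj₂ (proj₂ (sound i)))
    leaf-only {i} (inj₂ (_ , ci , _))      = ⊥-elim (proj₁ (sound i) ci)
    φ-walk : ∀ a → c ⟿ φ a
    φ-walk zero    = here
    φ-walk (suc i) = edge-walk (inj₂ (leaf-edge i))
    φ-onto : ∀ w → c ⟿ w → ∃ λ a → φ a ≡ w
    φ-onto w = invariant (λ w → ∃ λ a → φ a ≡ w) next (zero , refl)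
      where
      next : ∀ {x y} → (∃ λ a → φ a ≡ x) → T (Adj F x y) → ∃ λ a → φ a ≡ y
      next (suc i , refl) t = zero , ≡sym (leaf-only (edge⁻ t))
      next (zero , refl) t with edge⁻ t
      ... | inj₁ (¬c , _) = ⊥-elim (¬c cc)
      ... | inj₂ j = let i , eq = complete (joins-full j) in suc i , eq
    φ-adj⁻ : ∀ a b → T (Adj F (φ a) (φ b)) → (a ≡ zero × b ≢ zero) ⊎ (b ≡ zero × a ≢ zero)
    φ-adj⁻ zero    zero    t = ⊥-elim (subst T (irrefl F c) t)
    φ-adj⁻ zero    (suc j) t = inj₁ (refl , λ ())
    φ-adj⁻ (suc i) zero    t = inj₂ (refl , λ ())
    φ-adj⁻ (suc i) (suc j) t = ⊥-elim (e≢c j (leaf-only (edge⁻ t)))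
    φ-adj⁺ : ∀ a b → (a ≡ zero × b ≢ zero) ⊎ (b ≡ zero × a ≢ zero) → T (Adj F (φ a) (φ b))
    φ-adj⁺ zero    zero    (inj₁ (_ , ne)) = ⊥-elim (ne refl)
    φ-adj⁺ zero    zero    (inj₂ (_ , ne)) = ⊥-elim (ne refl)
    φ-adj⁺ zero    (suc j) _ = edge⁺ (inj₂ (leaf-edge j))
    φ-adj⁺ (suc i) zero    _ = edge⁺ (inj₁ (leaf-edge i))
    φ-adj⁺ (suc i) (suc j) (inj₁ (() , _))
    φ-adj⁺ (suc i) (suc j) (inj₂ (() , _))

-- Tree components

∧⁺ : ∀ {a b} → T a → T b → T (a ∧ b)
∧⁺ p q = Equivalence.from T-∧ (p , q)

∧⁻ : ∀ {a b} → T (a ∧ b) → T a × T b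
∧⁻ = Equivalence.to T-∧

not⁺ : ∀ {b} → ¬ T b → T (not b)
not⁺ {false} _ = tt
not⁺ {true}  h = h tt

not⁻ : ∀ {b} → T (not b) → ¬ T b
not⁻ {false} _ ()

-- At a saturated centre k = s + l, so clause (d) attaches nothing: the pendant vertices of the
-- component are already leaves of R.
no-pendants : ∀ k d l s → k ≡ s + l → d ≡ 2 * s + 1 → ¬ Fin (k ∸ d / 2 ∸ l)
no-pendants _ _ l s refl refl f = empty (subst Fin none f)
  where
  empty : ¬ Fin 0
  empty ()
  half : (2 * s + 1) / 2 ≡ s
  half = trans (+-distrib-/ (2 * s) 1 (subst (λ x → x + 1 < 2) (≡sym (trans (cong (_% 2) (*-comm 2 s)) (m*n%n≡0 s 2))) ≤-refl))
               (trans (+-identityʳ _) (trans (cong (_/ 2) (*-comm 2 s)) (m*n/n≡m s 2)))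
  none : s + l ∸ (2 * s + 1) / 2 ∸ l ≡ 0
  none = trans (cong (λ x → s + l ∸ x ∸ l) half) (trans (cong (_∸ l) (m+n∸m≡n s l)) (n∸n≡0 l))

count-cong : (p : Fin n → Bool) {Q : Fin n → Set} (Q? : ∀ x → Dec (Q x)) →
  (∀ x → T (p x) → Q x) → (∀ x → Q x → T (p x)) → count p ≡ ∑ (λ x → ⟦ Q? x ⟧)
count-cong p Q? f g = trans (count-∑ p) (∑-cong (λ x → ⟦⟧-cong (T? (p x)) (Q? x) (f x) (g x)))

module Tree {n} (G : SimpleGraph n) (k : ℕ) (2≤k : 2 ≤ k)
            (Centre : Fin n → Set) (Centre? : ∀ v → Dec (Centre v))
            (minimal : Halves.Minimal G k Centre Centre?)
            {c : Fin n} (cc : Centre c) (linked : Factor.Linked G k Centre Centre? minimal c) where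

  open HalfFlow G k Centre Centre?
  open Halves G k Centre Centre? hiding (minimal)
  open Halves.Minimal minimal
  open Factor G k Centre Centre? minimal

  link-joins : ∀ {y a b} → Link σ y a b → Joins y a
  link-joins l@(¬cy , _ , inj₁ e) = ¬cy , proj₁ (link-target {σ} targets l) , inj₁ (cong proj₁ e)
  link-joins l@(¬cy , _ , inj₂ e) = ¬cy , proj₁ (link-target {σ} targets l) , inj₂ (cong proj₂ e)

  link-other : ∀ {y a b b′} → Link σ y a b → Link σ y a b′ → b ≡ b′
  link-other l@(_ , a≢b , _) l′ with link-end {σ} (link-sym {σ} l) (link-sym {σ} l′)
  ... | inj₁ eq = eq
  ... | inj₂ eq = ⊥-elim (a≢b (≡sym eq))

  -- Two half edges with the same ends form a closed trail.
  link-unique : ∀ {y y′ a b} → Link σ y a b → Link σ y′ a b → y ≡ y′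
  link-unique {y} {y′} l l′ with y ≟ y′
  ... | yes eq = eq
  ... | no ne = ⊥-elim (acyclic (l ∷ (link-sym {σ} l′ ∷ [])) ((ne ∷ []) ∷ ([] ∷ [])))

  joins-link : ∀ {y a b x} → Link σ y a b → Joins y x → x ≡ a ⊎ x ≡ b
  joins-link (_ , _ , inj₁ e) (_ , _ , inj₁ p) = inj₁ (trans (≡sym p) (cong proj₁ e))
  joins-link (_ , _ , inj₁ e) (_ , _ , inj₂ p) = inj₂ (trans (≡sym p) (cong proj₂ e))
  joins-link (_ , _ , inj₂ e) (_ , _ , inj₁ p) = inj₂ (trans (≡sym p) (cong proj₁ e))
  joins-link (_ , _ , inj₂ e) (_ , _ , inj₂ p) = inj₁ (trans (≡sym p) (cong proj₂ e))

  -- An unsplit sender touches one centre only, so centres of a component are connected through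
  -- split senders. One linked centre thus makes all of them linked, and hence saturated.
  all-linked : ∀ {w} → c ⟿ w → (Centre w → Linked w) × (∀ {x} → Joins w x → Linked x)
  all-linked = invariant (λ w → (Centre w → Linked w) × (∀ {x} → Joins w x → Linked x)) next
                         ((λ _ → linked) , λ { (¬c , _) → ⊥-elim (¬c cc) })
    where
    next : ∀ {x y} → (Centre x → Linked x) × (∀ {z} → Joins x z → Linked z) → T (Adj F x y) →
           (Centre y → Linked y) × (∀ {z} → Joins y z → Linked z)
    next {x} {y} (at , to) t with edge⁻ {x} {y} t
    ... | inj₁ j@(_ , cy , _) = (λ _ → to j) , λ { (¬c , _) → ⊥-elim (¬c cy) }
    ... | inj₂ j@(¬cy , cx , _) = (λ cy → ⊥-elim (¬cy cy)) , other (joins-cases j)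
      where
      other : FullAt x y ⊎ HalfAt x y → ∀ {z} → Joins y z → Linked z
      other (inj₁ (_ , p , q)) (_ , _ , inj₁ r) = subst Linked (trans (≡sym p) r) (at cx)
      other (inj₁ (_ , p , q)) (_ , _ , inj₂ r) = subst Linked (trans (≡sym q) r) (at cx)
      other (inj₂ h) jz with halfAt-link h
      ... | d , l with joins-link l jz
      ...   | inj₁ refl = y , d , l
      ...   | inj₂ refl = y , x , link-sym {σ} l

  -- The vertices of R: the centres of the component and, as leaves, its unsplit senders.
  InTree : Fin n → Set
  InTree w = c ⟿ w × ¬ Half σ w

  abstract
    inTree? : ∀ w → Dec (InTree w)
    inTree? w = walk? c w ×-dec ¬? (half? σ w)

  en : Enumeration InTree
  en = enumerate inTree?

  open Enumeration en renaming (size to r)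

  centre-inTree : ∀ {w} → c ⟿ w → Centre w → InTree w
  centre-inTree p cw = p , λ { (¬c , _) → ¬c cw }

  link-walk : ∀ {y a b} → c ⟿ a → Link σ y a b → c ⟿ b
  link-walk p l = p ++ʷ edge-walk (inj₂ (link-joins l)) ++ʷ edge-walk (inj₁ (link-joins (link-sym {σ} l)))

  -- Suppressing the half senders turns the component into R.
  Rel : Fin n → Fin n → Set
  Rel u w = Edge u w ⊎ ∃ λ y → Link σ y u w

  abstract
    rel? : ∀ u w → Dec (Rel u w)
    rel? u w = edge? u w ⊎-dec any? (λ y → link? σ y u w)

  rel-sym : ∀ {u w} → Rel u w → Rel w u
  rel-sym (inj₁ e)       = inj₁ (edge-sym e)
  rel-sym (inj₂ (y , l)) = inj₂ (y , link-sym {σ} l)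

  R : SimpleGraph r
  R = record
    { Adj    = λ i j → ⌊ rel? (e i) (e j) ⌋
    ; sym    = λ i j → ⌊⌋-cong (rel? (e i) (e j)) (rel? (e j) (e i)) rel-sym rel-sym
    ; irrefl = λ i → ⌊⌋-false (rel? (e i) (e i))
        λ { (inj₁ ed) → subst T (irrefl F (e i)) (edge⁺ ed) ; (inj₂ (_ , _ , ne , _)) → ne refl } }

  R⁺ : ∀ {i j} → Rel (e i) (e j) → T (Adj R i j)
  R⁺ {i} {j} = fromWitness {a? = rel? (e i) (e j)}

  R⁻ : ∀ {i j} → T (Adj R i j) → Rel (e i) (e j)
  R⁻ {i} {j} = toWitness {a? = rel? (e i) (e j)}

  open TreeFamily R

  link-centres : ∀ {y a b} → Link σ y a b → Centre a × Centre b
  link-centres l = proj₁ (link-target {σ} targets l) , proj₁ (link-target {σ} targets (link-sym {σ} l))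

  pendant-rel : ∀ {i x} → ¬ Centre (e i) → Rel (e i) x → x ≡ π₁ (e i)
  pendant-rel {i} ¬ci (inj₂ (_ , l)) = ⊥-elim (¬ci (proj₁ (link-centres l)))
  pendant-rel {i} ¬ci (inj₁ (inj₂ (_ , ci , _))) = ⊥-elim (¬ci ci)
  pendant-rel {i} ¬ci (inj₁ (inj₁ j)) with joins-cases j
  ... | inj₁ (_ , p , _) = ≡sym p
  ... | inj₂ (h , _)     = ⊥-elim (proj₂ (sound i) h)

  centre-rel : ∀ {a b} → Centre a → Centre b → Rel a b → ∃ λ y → Link σ y a b
  centre-rel ca cb (inj₂ l) = l
  centre-rel ca cb (inj₁ (inj₁ (¬ca , _))) = ⊥-elim (¬ca ca)
  centre-rel ca cb (inj₁ (inj₂ (¬cb , _))) = ⊥-elim (¬cb cb)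

  -- A split sender at a centre determines its other end, and by `link-unique` the two ends
  -- determine the sender; so split senders and neighbouring centres are equally many.
  degree-at : ∀ {i} → Centre (e i) →
    ∑ (λ j → ⟦ rel? (e i) (e j) ×-dec Centre? (e j) ⟧) ≡ ∑ (λ u → ⟦ halfAt? (e i) u ⟧)
  degree-at {i} ci = ≤-antisym
    (∑-rel (λ j → rel? (e i) (e j) ×-dec Centre? (e j)) (halfAt? (e i)) (λ j u → link? σ u (e i) (e j))
      (λ { (rl , cj) → let u , l = centre-rel ci cj rl in u , (link-half {σ} l , proj₂ (proj₂ (link-joins l))) , l })
      (λ _ _ l l′ → e-inj (link-other l l′)))
    (∑-rel (halfAt? (e i)) (λ j → rel? (e i) (e j) ×-dec Centre? (e j)) (λ u j → link? σ u (e i) (e j))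
      (λ {u} h → let d , l = halfAt-link h
                     cd = proj₂ (link-centres l)
                     j , eq = complete (centre-inTree (link-walk (proj₁ (sound i)) l) cd)
                     l′ = subst (Link σ u (e i)) (≡sym eq) l
                 in j , (inj₂ (u , l′) , subst Centre (≡sym eq) cd) , l′)
      (λ _ _ → link-unique))

  pendants-at : ∀ {i} → Centre (e i) →
    ∑ (λ j → ⟦ rel? (e i) (e j) ×-dec ¬? (Centre? (e j)) ⟧) ≡ ∑ (λ u → ⟦ fullAt? (e i) u ⟧)
  pendants-at {i} ci = ≤-antisym
    (∑-rel (λ j → rel? (e i) (e j) ×-dec ¬? (Centre? (e j))) (fullAt? (e i)) (λ j u → e j ≟ u)
      (λ {j} (rl , ¬cj) → e j , full ¬cj rl , refl)
      (λ _ _ p q → e-inj (trans p (≡sym q))))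
    (∑-rel (fullAt? (e i)) (λ j → rel? (e i) (e j) ×-dec ¬? (Centre? (e j))) (λ u j → e j ≟ u)
      (λ {u} (¬cu , p , q) →
        let ed = inj₂ (¬cu , ci , inj₁ p)
            j , eq = complete (proj₁ (sound i) ++ʷ edge-walk ed , λ h → proj₂ h (trans p (≡sym q)))
        in j , (inj₁ (subst (Edge (e i)) (≡sym eq) ed) , subst (λ x → ¬ Centre x) (≡sym eq) ¬cu) , eq)
      (λ _ _ p q → trans (≡sym p) q))
    where
    full : ∀ {j} → ¬ Centre (e j) → Rel (e i) (e j) → FullAt (e i) (e j)
    full ¬cj (inj₂ (_ , l)) = ⊥-elim (¬cj (proj₂ (link-centres l)))
    full ¬cj (inj₁ (inj₁ (¬ci , _))) = ⊥-elim (¬ci ci)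
    full {j} ¬cj (inj₁ (inj₂ jn)) with joins-cases jn
    ... | inj₁ f = f
    ... | inj₂ (h , _) = ⊥-elim (proj₂ (sound j) h)

  tight-at : ∀ {i} → Centre (e i) →
    ∑ (λ u → ⟦ halfAt? (e i) u ⟧) + 2 * ∑ (λ u → ⟦ fullAt? (e i) u ⟧) ≡ 2 * k + 1
  tight-at {i} ci = let _ , _ , l = proj₁ (all-linked (proj₁ (sound i))) ci in
    trans (≡sym (inflow-split (e i))) (tight l)

  degree-rel : ∀ i → degree R i ≡ ∑ (λ j → ⟦ rel? (e i) (e j) ⟧)
  degree-rel i = count-cong (Adj R i) (λ j → rel? (e i) (e j)) (λ j → R⁻ {i} {j}) (λ j → R⁺ {i} {j})

  -- A centre with `D` split and `L` unsplit senders has degree D + L, while D + 2L = 2k + 1 is at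
  -- least 5. Degree 1 would allow at most 2.
  leaf⇒pendant : ∀ {i} → T (isLeaf i) → ¬ Centre (e i)
  leaf⇒pendant {i} lf ci = <-irrefl refl (begin-strict
    2 * 1                 <⟨ s≤s (s≤s (s≤s z≤n)) ⟩
    2 * 2 + 1             ≤⟨ +-monoˡ-≤ 1 (*-monoʳ-≤ 2 2≤k) ⟩
    2 * k + 1             ≡⟨ ≡sym (tight-at ci) ⟩
    D + 2 * L             ≤⟨ +-monoˡ-≤ (2 * L) (m≤m+n D _) ⟩
    2 * D + 2 * L         ≡⟨ ≡sym (*-distribˡ-+ 2 D L) ⟩
    2 * (D + L)           ≡⟨ cong (2 *_) (≡sym degree≡) ⟩
    2 * degree R i        ≡⟨ cong (2 *_) (≡ᵇ⇒≡ (degree R i) 1 lf) ⟩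
    2 * 1                 ∎)
    where
    open ≤-Reasoning
    D = ∑ (λ u → ⟦ halfAt? (e i) u ⟧)
    L = ∑ (λ u → ⟦ fullAt? (e i) u ⟧)
    degree≡ : degree R i ≡ D + L
    degree≡ = trans (degree-rel i) (trans (∑-cong (λ j → ⟦⟧-split (rel? (e i) (e j)) (Centre? (e j)))) (trans (∑-+ (λ j → ⟦ rel? (e i) (e j) ×-dec Centre? (e j) ⟧) _)
                (cong₂ _+_ (degree-at ci) (pendants-at ci))))

  pendant⇒leaf : ∀ {i} → ¬ Centre (e i) → T (isLeaf i)
  pendant⇒leaf {i} ¬ci = ≡⇒≡ᵇ (degree R i) 1 (trans (degree-rel i)
    (trans (∑-single _ j₀ (λ j ne → ⟦⟧-no (rel? (e i) (e j)) (λ rl → ne (e-inj (trans (pendant-rel {i} ¬ci rl) (≡sym eq₀))))))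
           (⟦⟧-yes (rel? (e i) (e j₀)) (inj₁ (subst (Edge (e i)) (≡sym eq₀) ed)))))
    where
    ed : Edge (e i) (π₁ (e i))
    ed = inj₁ (joins₁ ¬ci)
    found : ∃ λ j → e j ≡ π₁ (e i)
    found = complete (centre-inTree (proj₁ (sound i) ++ʷ edge-walk ed) (proj₁ (proj₂ (joins₁ ¬ci))))
    j₀ = proj₁ found
    eq₀ = proj₂ found

  nonleaf⇒centre : ∀ {i} → T (not (isLeaf i)) → Centre (e i)
  nonleaf⇒centre {i} nl with Centre? (e i)
  ... | yes ci = ci
  ... | no ¬ci = ⊥-elim (not⁻ {isLeaf i} nl (pendant⇒leaf {i} ¬ci))

  centre⇒nonleaf : ∀ {i} → Centre (e i) → T (not (isLeaf i))
  centre⇒nonleaf {i} ci = not⁺ {isLeaf i} (λ lf → leaf⇒pendant {i} lf ci)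

  nonleaf-counts : ∀ {i} → T (not (isLeaf i)) → dCore i + 2 * nLeaves i ≡ 2 * k + 1
  nonleaf-counts {i} nl = trans (cong₂ (λ x y → x + 2 * y) (trans core (degree-at ci)) (trans leaves (pendants-at ci))) (tight-at ci)
    where
    ci = nonleaf⇒centre {i} nl
    core : dCore i ≡ ∑ (λ j → ⟦ rel? (e i) (e j) ×-dec Centre? (e j) ⟧)
    core = count-cong (λ j → Adj R i j ∧ not (isLeaf j)) (λ j → rel? (e i) (e j) ×-dec Centre? (e j))
      (λ j t → let a , b = ∧⁻ {Adj R i j} t in R⁻ {i} {j} a , nonleaf⇒centre {j} b)
      (λ j (rl , cj) → ∧⁺ {Adj R i j} (R⁺ {i} {j} rl) (centre⇒nonleaf {j} cj))
    leaves : nLeaves i ≡ ∑ (λ j → ⟦ rel? (e i) (e j) ×-dec ¬? (Centre? (e j)) ⟧)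
    leaves = count-cong (λ j → Adj R i j ∧ isLeaf j) (λ j → rel? (e i) (e j) ×-dec ¬? (Centre? (e j)))
      (λ j t → let a , b = ∧⁻ {Adj R i j} t in R⁻ {i} {j} a , leaf⇒pendant {j} b)
      (λ j (rl , cj) → ∧⁺ {Adj R i j} (R⁺ {i} {j} rl) (pendant⇒leaf {j} cj))

  -- Source of condition (a): the leaves take an even share of the 2k + 1 units, so an odd number is
  -- left for the core.
  nonleaf-form : ∀ {i} → T (not (isLeaf i)) → ∃ λ s → k ≡ s + nLeaves i × dCore i ≡ 2 * s + 1
  nonleaf-form {i} nl = s , k≡ , +-cancelʳ-≡ (2 * L) _ _ (begin
    dCore i + 2 * L     ≡⟨ nonleaf-counts {i} nl ⟩
    2 * k + 1           ≡⟨ cong (λ x → 2 * x + 1) k≡ ⟩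
    2 * (s + L) + 1     ≡⟨ rearrange s L ⟩
    2 * s + 1 + 2 * L   ∎)
    where
    open ≡-Reasoning
    L = nLeaves i
    s = k ∸ L
    L≤k : L ≤ k
    L≤k = 2*≤⇒≤ L k (≤-trans (m≤n+m (2 * L) (dCore i)) (≤-reflexive (nonleaf-counts {i} nl)))
    k≡ : k ≡ s + L
    k≡ = ≡sym (m∸n+n≡m L≤k)
    rearrange : ∀ s L → 2 * (s + L) + 1 ≡ 2 * s + 1 + 2 * L
    rearrange = solve-∀

  condA : CondA k
  condA i lf = let s , k≡ , d≡ = nonleaf-form {i} (Equivalence.from (T-not-≡ {isLeaf i}) lf) in
    s , ≤-trans (m≤m+n s _) (≤-reflexive (≡sym k≡)) , d≡

  condB : CondB k
  condB i lf = swap (dCore i) (nLeaves i) (nonleaf-counts {i} (Equivalence.from (T-not-≡ {isLeaf i}) lf))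
    where
    swap : ∀ d l → d + 2 * l ≡ 2 * k + 1 → 2 * l + d ≤ 2 * k + 1
    swap d l eq = ≤-reflexive (trans (+-comm (2 * l) d) eq)

  no-new : ¬ NewV k
  no-new (i , nl , f) = let s , k≡ , d≡ = nonleaf-form {i} nl in no-pendants k (dCore i) (nLeaves i) s k≡ d≡ f

-- The reduced graph R is a tree

module TreeComponent {n} (G : SimpleGraph n) (k : ℕ) (2≤k : 2 ≤ k)
            (Centre : Fin n → Set) (Centre? : ∀ v → Dec (Centre v))
            (minimal : Halves.Minimal G k Centre Centre?)
            {c : Fin n} (cc : Centre c) (linked : Factor.Linked G k Centre Centre? minimal c) where

  open Halves G k Centre Centre? hiding (minimal)
  open Halves.Minimal minimal
  open Factor G k Centre Centre? minimal
  open Tree G k 2≤k Centre Centre? minimal cc linked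
  open Enumeration en renaming (size to r)
  open TreeFamily R

  root : Fin r
  root = proj₁ (complete (centre-inTree here cc))

  e-root : e root ≡ c
  e-root = proj₂ (complete (centre-inTree here cc))

  R-step : ∀ {i j u} → Walk (Adj R) u i → Rel (e i) (e j) → Walk (Adj R) u j
  R-step {i} {j} p rl = p ++ʷ step (R⁺ {i} {j} rl) here

  -- A walk in the component passes through split senders, which are not vertices of R. At such a
  -- sender the invariant `Reached` speaks of the centres that it joins instead.
  from-root : ∀ i → Walk (Adj R) root i
  from-root i = proj₂ (invariant Reached advance (here , at-root) (proj₁ (sound i))) i (inj₁ refl)
    where
    Reached : Fin n → Set
    Reached x = c ⟿ x × (∀ i → e i ≡ x ⊎ (Half σ x × Joins x (e i)) → Walk (Adj R) root i)
    at-root : ∀ i → e i ≡ c ⊎ (Half σ c × Joins c (e i)) → Walk (Adj R) root i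
    at-root i (inj₁ eq) = subst (Walk (Adj R) root) (e-inj (trans e-root (≡sym eq))) here
    at-root i (inj₂ (_ , ¬c , _)) = ⊥-elim (¬c cc)
    advance : ∀ {x y} → Reached x → T (Adj F x y) → Reached y
    advance {x} {y} (p , walks) t = p ++ʷ step t here , walks′ (edge⁻ {x} {y} t)
      where
      walks′ : Edge x y → ∀ j → e j ≡ y ⊎ (Half σ y × Joins y (e j)) → Walk (Adj R) root j
      walks′ ed j (inj₁ refl) with half? σ x
      ... | yes hx with ed
      ...   | inj₁ jn = walks j (inj₂ (hx , jn))
      ...   | inj₂ (_ , cx , _) = ⊥-elim (proj₁ hx cx)
      walks′ ed j (inj₁ refl) | no ¬hx with complete (p , ¬hx)
      ... | i , refl = R-step {i} {j} (walks i (inj₁ refl)) (inj₁ ed)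
      walks′ (inj₁ (_ , cy , _)) j (inj₂ ((¬cy , _) , _)) = ⊥-elim (¬cy cy)
      walks′ (inj₂ jx@(¬cy , cx , at)) j (inj₂ (hy , jj)) with halfAt-link (hy , at)
      ... | d , l with joins-link l jj
      ...   | inj₁ eq = walks j (inj₁ eq)
      ...   | inj₂ refl with complete (centre-inTree p cx)
      ...     | i , refl = R-step {i} {j} (walks i (inj₁ refl)) (inj₂ (y , l))

  R-connected : Connected R
  R-connected = positive root , λ u w →
    reverseʷ (λ {a} {b} → subst T (SimpleGraph.sym R a b)) (from-root u) ++ʷ from-root w
    where
    positive : ∀ {m} → Fin m → 0 < m
    positive zero    = s≤s z≤n
    positive (suc _) = s≤s z≤n

  R-sym : ∀ i j → T (Adj R i j) → T (Adj R j i)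
  R-sym i j = subst T (SimpleGraph.sym R i j)

  -- An unsplit sender has just one neighbour in R. This puts every vertex of a cycle among the
  -- centres.
  two-neighbours : ∀ {i j j′} → T (Adj R i j) → T (Adj R i j′) → j ≢ j′ → Centre (e i)
  two-neighbours {i} {j} {j′} a a′ ne with Centre? (e i)
  ... | yes ci = ci
  ... | no ¬ci = ⊥-elim (ne (e-inj (trans (pendant-rel {i} ¬ci (R⁻ {i} {j} a)) (≡sym (pendant-rel {i} ¬ci (R⁻ {i} {j′} a′))))))

  centre-adj : ∀ {i j} → Centre (e i) → Centre (e j) → T (Adj R i j) → ∃ λ y → Link σ y (e i) (e j)
  centre-adj {i} {j} ci cj a = centre-rel ci cj (R⁻ {i} {j} a)

  -- A split sender with an end at `w` cannot occur on a trail that avoids `w`; this is how trails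
  -- are shown to repeat no sender.
  Avoids : List (Fin n) → Fin n → Set
  Avoids ys w = All (λ y → ∀ b → ¬ Link σ y w b) ys

  -- `l` is the predecessor of `z` on the closed path, the second neighbour that makes the base
  -- point of a cycle a centre.
  Path-last : ∀ z y ys → PathFrom R z y ys → All (z ≢_) (y ∷ ys) →
    ∃ λ l → T (Adj R l z) × (∀ {x} → All (x ≢_) (y ∷ ys) → x ≢ l)
  Path-last z y []        a       _        = y , a , λ { (ne ∷ []) → ne }
  Path-last z y (y′ ∷ ys) (_ , p) (_ ∷ ne) = let l , a , avoid = Path-last z y′ ys p ne in
    l , a , λ { (_ ∷ h) → avoid h }

  -- The vertices after the first of a path in R ending at z are centres, because
  -- each has two neighbours; replacing every edge by its half sender gives a trail.
  path-trail : ∀ z y ys → Centre (e y) → Centre (e z) → PathFrom R z y ys → Unique (y ∷ ys) → All (z ≢_) (y ∷ ys) →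
    ∃ λ ts → Trail σ ts (e y) (e z) × Unique ts ×
             (∀ {w} → All (λ x → w ≢ e x) (y ∷ ys) → w ≢ e z → Avoids ts w)
  path-trail z y [] cy cz a _ _ with centre-adj {y} {z} cy cz a
  ... | t , l = t ∷ [] , l ∷ [] , [] ∷ [] , avoid
    where
    avoid : ∀ {w} → All (λ x → w ≢ e x) (y ∷ []) → w ≢ e z → Avoids (t ∷ []) w
    avoid (ney ∷ []) nez = (λ b l′ → [ ney , nez ]′ (link-end {σ} l′ l)) ∷ []
  path-trail z y (y′ ∷ ys) cy cz (a , p) (y∉ ∷ u) (z≢y ∷ z∉) = go (centre-adj {y} {y′} cy cy′ a) (path-trail z y′ ys cy′ cz p u z∉)
    where
    following : ∀ ys → PathFrom R z y′ ys → All (y ≢_) (y′ ∷ ys) → ∃ λ x → T (Adj R y′ x) × y ≢ x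
    following []       b       _            = z , b , z≢y ∘ ≡sym
    following (x ∷ ys) (b , _) (_ ∷ ne ∷ _) = x , b , ne
    cy′ : Centre (e y′)
    cy′ = let x , b , ne = following ys p y∉ in two-neighbours {y′} {y} {x} (R-sym y y′ a) b ne
    map-≢ : ∀ {x ys} → All (x ≢_) ys → All (λ v → e x ≢ e v) ys
    map-≢ []       = []
    map-≢ (h ∷ hs) = (h ∘ e-inj) ∷ map-≢ hs
    go : (∃ λ t → Link σ t (e y) (e y′)) →
         (∃ λ ts → Trail σ ts (e y′) (e z) × Unique ts × (∀ {w} → All (λ x → w ≢ e x) (y′ ∷ ys) → w ≢ e z → Avoids ts w)) →
         ∃ λ ts → Trail σ ts (e y) (e z) × Unique ts × (∀ {w} → All (λ x → w ≢ e x) (y ∷ y′ ∷ ys) → w ≢ e z → Avoids ts w)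
    go (t , l) (ts , trail , uts , avoid) = t ∷ ts , l ∷ trail , fresh (avoid (map-≢ y∉) (z≢y ∘ ≡sym ∘ e-inj)) ∷ uts ,
      λ { (ney ∷ ney′ ∷ nes) nez → (λ b l′ → [ ney , ney′ ]′ (link-end {σ} l′ l)) ∷ avoid (ney′ ∷ nes) nez }
      where
      fresh : ∀ {ts} → Avoids ts (e y) → All (t ≢_) ts
      fresh []       = []
      fresh (h ∷ hs) = (λ { refl → h _ l }) ∷ fresh hs

  -- The first two edges of the cycle are split off because both meet `x₁`, which the trail from
  -- `x₂` back to `x` avoids. Their senders are thus new to that trail and, as `x` and `x₂` differ,
  -- distinct from each other; together they close a trail against `acyclic`.
  R-acyclic : Acyclic R
  R-acyclic (x ∷ x₁ ∷ []) (s≤s () , _)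
  R-acyclic (x ∷ x₁ ∷ x₂ ∷ xs) (_ , (x≢x₁ ∷ x≢x₂ ∷ x∉) ∷ (x₁≢x₂ ∷ x₁∉) ∷ u , a , a₁ , p) =
    close (centre-adj {x} {x₁} cx cx₁ a) (centre-adj {x₁} {x₂} cx₁ cx₂ a₁) (path-trail x x₂ xs cx₂ cx p u (x≢x₂ ∷ x∉))
    where
    cx₁ : Centre (e x₁)
    cx₁ = two-neighbours {x₁} {x} {x₂} (R-sym x x₁ a) a₁ x≢x₂
    following : ∀ ys → PathFrom R x x₂ ys → All (x₁ ≢_) ys → ∃ λ v → T (Adj R x₂ v) × x₁ ≢ v
    following []       b       _        = x , b , x≢x₁ ∘ ≡sym
    following (y ∷ ys) (b , _) (ne ∷ _) = y , b , ne
    cx₂ : Centre (e x₂)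
    cx₂ = let v , b , ne = following xs p x₁∉ in two-neighbours {x₂} {x₁} {v} (R-sym x₁ x₂ a₁) b ne
    cx : Centre (e x)
    cx = let l , b , avoid = Path-last x x₂ xs p (x≢x₂ ∷ x∉) in
      two-neighbours {x} {x₁} {l} a (R-sym l x b) (avoid (x₁≢x₂ ∷ x₁∉))
    map-≢ : ∀ {v ys} → All (v ≢_) ys → All (λ w → e v ≢ e w) ys
    map-≢ []       = []
    map-≢ (h ∷ hs) = (h ∘ e-inj) ∷ map-≢ hs
    fresh : ∀ {t b ts} → Link σ t (e x₁) b → Avoids ts (e x₁) → All (t ≢_) ts
    fresh l []       = []
    fresh l (h ∷ hs) = (λ { refl → h _ l }) ∷ fresh l hs
    close : (∃ λ t → Link σ t (e x) (e x₁)) → (∃ λ t → Link σ t (e x₁) (e x₂)) →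
            (∃ λ ts → Trail σ ts (e x₂) (e x) × Unique ts × (∀ {w} → All (λ v → w ≢ e v) (x₂ ∷ xs) → w ≢ e x → Avoids ts w)) → ⊥
    close (t , l) (t₁ , l₁) (ts , trail , uts , avoid) =
      acyclic (l ∷ (l₁ ∷ trail)) ((t≢t₁ ∷ fresh (link-sym {σ} l) av) ∷ fresh l₁ av ∷ uts)
      where
      av : Avoids ts (e x₁)
      av = avoid (map-≢ (x₁≢x₂ ∷ x₁∉)) (x≢x₁ ∘ ≡sym ∘ e-inj)
      t≢t₁ : t ≢ t₁
      t≢t₁ refl = x≢x₂ (e-inj (link-other (link-sym {σ} l) l₁))

-- The isomorphism of a linked component with T_R

module TreeIso {n} (G : SimpleGraph n) (k : ℕ) (2≤k : 2 ≤ k)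
            (Centre : Fin n → Set) (Centre? : ∀ v → Dec (Centre v))
            (minimal : Halves.Minimal G k Centre Centre?)
            {c : Fin n} (cc : Centre c) (linked : Factor.Linked G k Centre Centre? minimal c) where

  open Halves G k Centre Centre? hiding (minimal)
  open Halves.Minimal minimal
  open Factor G k Centre Centre? minimal
  open Tree G k 2≤k Centre Centre? minimal cc linked
  open TreeComponent G k 2≤k Centre Centre? minimal cc linked
  open Enumeration en renaming (size to r)
  open TreeFamily R

  SubProof : Fin r → Fin r → Set
  SubProof a b = T ((toℕ a <ᵇ toℕ b) ∧ Adj R a b ∧ not (isLeaf a) ∧ not (isLeaf b))

  abstract
    sub⁻ : ∀ {a b} → SubProof a b → toℕ a < toℕ b × ∃ λ y → Link σ y (e a) (e b)
    sub⁻ {a} {b} p =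
      let lt , q = ∧⁻ {toℕ a <ᵇ toℕ b} p
          ad , q′ = ∧⁻ {Adj R a b} q
          la , lb = ∧⁻ {not (isLeaf a)} q′
      in <ᵇ⇒< (toℕ a) (toℕ b) lt , centre-adj {a} {b} (nonleaf⇒centre {a} la) (nonleaf⇒centre {b} lb) ad

    sub⁺ : ∀ {a b y} → toℕ a < toℕ b → Link σ y (e a) (e b) → SubProof a b
    sub⁺ {a} {b} {y} lt l = let ca , cb = link-centres l in
      ∧⁺ {toℕ a <ᵇ toℕ b} (<⇒<ᵇ lt) (∧⁺ {Adj R a b} (R⁺ {a} {b} (inj₂ (y , l)))
        (∧⁺ {not (isLeaf a)} (centre⇒nonleaf {a} ca) (centre⇒nonleaf {b} cb)))

  φ : TV k → Fin n
  φ (inj₁ i)                = e i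
  φ (inj₂ (inj₁ (a , b , p))) = proj₁ (proj₂ (sub⁻ {a} {b} p))
  φ (inj₂ (inj₂ new))       = ⊥-elim (no-new new)

  φ-link : ∀ {a b} (p : SubProof a b) → Link σ (φ (inj₂ (inj₁ (a , b , p)))) (e a) (e b)
  φ-link {a} {b} p = proj₂ (proj₂ (sub⁻ {a} {b} p))

  sub-irrelevant : ∀ {a b a′ b′} (p : SubProof a b) (p′ : SubProof a′ b′) → a ≡ a′ → b ≡ b′ →
    _≡_ {A = TV k} (inj₂ (inj₁ (a , b , p))) (inj₂ (inj₁ (a′ , b′ , p′)))
  sub-irrelevant {a} {b} p p′ refl refl = cong (λ q → inj₂ (inj₁ (a , b , q))) (T-irrelevant p p′)

  -- Subdivided edges list their ends in increasing order, which excludes the crossed identification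
  -- that an unordered link permits.
  sub-ends : ∀ {a b a′ b′ y} → toℕ a < toℕ b → toℕ a′ < toℕ b′ →
    Link σ y (e a) (e b) → Link σ y (e a′) (e b′) → a ≡ a′ × b ≡ b′
  sub-ends lt lt′ l l′ with link-end {σ} l l′ | link-end {σ} (link-sym {σ} l) l′
  ... | inj₁ p | inj₂ q = e-inj p , e-inj q
  ... | inj₁ p | inj₁ q = ⊥-elim (proj₁ (proj₂ l) (trans p (≡sym q)))
  ... | inj₂ p | inj₂ q = ⊥-elim (proj₁ (proj₂ l) (trans p (≡sym q)))
  ... | inj₂ p | inj₁ q = ⊥-elim (<-asym lt (subst₂ (λ x y → toℕ x < toℕ y) (≡sym (e-inj q)) (≡sym (e-inj p)) lt′))

  φ-injective : ∀ u w → φ u ≡ φ w → u ≡ w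
  φ-injective (inj₂ (inj₂ new)) _ _ = ⊥-elim (no-new new)
  φ-injective _ (inj₂ (inj₂ new)) _ = ⊥-elim (no-new new)
  φ-injective (inj₁ i) (inj₁ j) eq = cong inj₁ (e-inj eq)
  φ-injective (inj₁ i) (inj₂ (inj₁ (a , b , p))) eq =
    ⊥-elim (proj₂ (sound i) (subst (Half σ) (≡sym eq) (link-half {σ} (φ-link {a} {b} p))))
  φ-injective (inj₂ (inj₁ (a , b , p))) (inj₁ i) eq =
    ⊥-elim (proj₂ (sound i) (subst (Half σ) eq (link-half {σ} (φ-link {a} {b} p))))
  φ-injective (inj₂ (inj₁ (a , b , p))) (inj₂ (inj₁ (a′ , b′ , p′))) eq =
    let a≡ , b≡ = sub-ends (proj₁ (sub⁻ {a} {b} p)) (proj₁ (sub⁻ {a′} {b′} p′))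
                           (subst (λ y → Link σ y (e a) (e b)) eq (φ-link {a} {b} p)) (φ-link {a′} {b′} p′)
    in sub-irrelevant {a} {b} {a′} {b′} p p′ a≡ b≡

  φ-walk : ∀ u → c ⟿ φ u
  φ-walk (inj₁ i) = proj₁ (sound i)
  φ-walk (inj₂ (inj₁ (a , b , p))) = proj₁ (sound a) ++ʷ edge-walk (inj₂ (link-joins (φ-link {a} {b} p)))
  φ-walk (inj₂ (inj₂ new)) = ⊥-elim (no-new new)

  φ-onto : ∀ w → c ⟿ w → ∃ λ u → φ u ≡ w
  φ-onto w p = by-kind (half? σ w)
    where
    by-kind : Dec (Half σ w) → ∃ λ u → φ u ≡ w
    by-kind (no ¬h) = let i , eq = complete (p , ¬h) in inj₁ i , eq
    by-kind (yes h) = order (<-cmp (toℕ a) (toℕ b))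
      where
      l₀ : Link σ w (π₁ w) (π₂ w)
      l₀ = half-link {σ} h
      tree₁ : ∃ λ i → e i ≡ π₁ w
      tree₁ = complete (centre-inTree (p ++ʷ edge-walk (inj₁ (link-joins l₀))) (proj₁ (link-centres l₀)))
      tree₂ : ∃ λ i → e i ≡ π₂ w
      tree₂ = complete (centre-inTree (p ++ʷ edge-walk (inj₁ (link-joins (link-sym {σ} l₀)))) (proj₂ (link-centres l₀)))
      a b : Fin r
      a = proj₁ tree₁
      b = proj₁ tree₂
      l : Link σ w (e a) (e b)
      l = subst₂ (Link σ w) (≡sym (proj₂ tree₁)) (≡sym (proj₂ tree₂)) l₀
      sub : ∀ {a b} → toℕ a < toℕ b → Link σ w (e a) (e b) → ∃ λ u → φ u ≡ w
      sub {a} {b} lt l = let q = sub⁺ {a} {b} lt l in inj₂ (inj₁ (a , b , q)) , link-unique (φ-link {a} {b} q) l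
      order : Tri (toℕ a < toℕ b) (toℕ a ≡ toℕ b) (toℕ b < toℕ a) → ∃ λ u → φ u ≡ w
      order (tri< lt _ _) = sub {a} {b} lt l
      order (tri≈ _ eq _) = ⊥-elim (proj₁ (proj₂ l) (cong e (toℕ-injective eq)))
      order (tri> _ _ gt) = sub {b} {a} gt (link-sym {σ} l)

  -- The edges of R at a leaf are those to unsplit senders and are edges of `F`; an edge between
  -- centres stems from a split sender and is subdivided.
  core-edge : ∀ i j → Edge (e i) (e j) ⇔ T (Adj R i j ∧ (isLeaf i ∨ isLeaf j))
  core-edge i j = mk⇔ there back
    where
    there : Edge (e i) (e j) → T (Adj R i j ∧ (isLeaf i ∨ isLeaf j))
    there ed@(inj₁ (¬ci , _)) = ∧⁺ {Adj R i j} (R⁺ {i} {j} (inj₁ ed)) (Equivalence.from (T-∨ {isLeaf i}) (inj₁ (pendant⇒leaf {i} ¬ci)))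
    there ed@(inj₂ (¬cj , _)) = ∧⁺ {Adj R i j} (R⁺ {i} {j} (inj₁ ed)) (Equivalence.from (T-∨ {isLeaf i}) (inj₂ (pendant⇒leaf {j} ¬cj)))
    back : T (Adj R i j ∧ (isLeaf i ∨ isLeaf j)) → Edge (e i) (e j)
    back t = let ad , lf = ∧⁻ {Adj R i j} t in
      from-rel (R⁻ {i} {j} ad) (Equivalence.to (T-∨ {isLeaf i}) lf)
      where
      from-rel : Rel (e i) (e j) → T (isLeaf i) ⊎ T (isLeaf j) → Edge (e i) (e j)
      from-rel (inj₁ ed) _ = ed
      from-rel (inj₂ (y , l)) (inj₁ li) = ⊥-elim (leaf⇒pendant {i} li (proj₁ (link-centres l)))
      from-rel (inj₂ (y , l)) (inj₂ lj) = ⊥-elim (leaf⇒pendant {j} lj (proj₂ (link-centres l)))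

  sub-edge : ∀ {a b y} → Link σ y (e a) (e b) → ∀ i → Edge (e i) y ⇔ (i ≡ a ⊎ i ≡ b)
  sub-edge {a} {b} {y} l i = mk⇔ there back
    where
    there : Edge (e i) y → i ≡ a ⊎ i ≡ b
    there (inj₁ (_ , cy , _)) = ⊥-elim (proj₁ l cy)
    there (inj₂ jn) with joins-link l jn
    ... | inj₁ eq = inj₁ (e-inj eq)
    ... | inj₂ eq = inj₂ (e-inj eq)
    back : i ≡ a ⊎ i ≡ b → Edge (e i) y
    back (inj₁ refl) = inj₂ (link-joins l)
    back (inj₂ refl) = inj₂ (link-joins (link-sym {σ} l))

  φ-edge : ∀ u w → Edge (φ u) (φ w) ⇔ TAdj k u w
  φ-edge (inj₂ (inj₂ new)) _ = ⊥-elim (no-new new)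
  φ-edge (inj₁ _) (inj₂ (inj₂ new)) = ⊥-elim (no-new new)
  φ-edge (inj₂ (inj₁ _)) (inj₂ (inj₂ new)) = ⊥-elim (no-new new)
  φ-edge (inj₁ i) (inj₁ j) = core-edge i j
  φ-edge (inj₁ i) (inj₂ (inj₁ (a , b , p))) = sub-edge {a} {b} (φ-link {a} {b} p) i
  φ-edge (inj₂ (inj₁ (a , b , p))) (inj₁ i) =
    mk⇔ (Equivalence.to eqv ∘ edge-sym) (edge-sym ∘ Equivalence.from eqv)
    where eqv = sub-edge {a} {b} (φ-link {a} {b} p) i
  φ-edge (inj₂ (inj₁ (a , b , p))) (inj₂ (inj₁ (a′ , b′ , p′))) = mk⇔
    [ (λ { (_ , c′ , _) → proj₁ (φ-link {a′} {b′} p′) c′ }) , (λ { (_ , c′ , _) → proj₁ (φ-link {a} {b} p) c′ }) ]′ (λ ())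

  tree-component : ComponentOK k F c
  tree-component = inj₂ (r , R , (R-connected , R-acyclic) , condA , condB , φ , φ-injective , φ-walk , φ-onto ,
    λ u w → mk⇔ (Equivalence.to (φ-edge u w) ∘ edge⁻) (edge⁺ ∘ Equivalence.from (φ-edge u w)))

minimal⇒star-tree-factor : (G : SimpleGraph n) (k : ℕ) → 2 ≤ k →
  (Centre : Fin n → Set) (Centre? : ∀ v → Dec (Centre v)) → Halves.Minimal G k Centre Centre? →
  HasStarTreeFactor k G
minimal⇒star-tree-factor {n} G k 2≤k Centre Centre? minimal = F , spanning , component
  where
  open Halves G k Centre Centre? using (link?)
  open Halves.Minimal minimal using (σ)
  open Factor G k Centre Centre? minimal
  centre-component : ∀ {c} → Centre c → ComponentOK k F c
  centre-component {c} cc with any? (λ y → any? (λ d → link? σ y c d))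
  ... | yes linked  = TreeIso.tree-component G k 2≤k Centre Centre? minimal cc linked
  ... | no unlinked = inj₁ (star cc unlinked)
  shift-ok : ∀ {u v} → u ⟿ v → ComponentOK k F v → ComponentOK k F u
  shift-ok p (inj₁ (j , lo , hi , ci)) = inj₁ (j , lo , hi , shift {F = F} {H = Star j} p ci)
  shift-ok p (inj₂ (r , R , tree , a , b , ci)) = inj₂ (r , R , tree , a , b , shift {F = F} {H = TreeFamily.TR R k} p ci)
  component : ∀ v → ComponentOK k F v
  component v with Centre? v
  ... | yes cv = centre-component cv
  ... | no ¬cv = let j = joins₁ ¬cv in shift-ok (edge-walk (inj₁ j)) (centre-component (proj₁ (proj₂ j)))

half-factor⇒star-tree-factor : (k : ℕ) → 2 ≤ k → (G : SimpleGraph n) → HalfFactor k G → HasStarTreeFactor k G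
half-factor⇒star-tree-factor k 2≤k G hf =
  minimal⇒star-tree-factor G k 2≤k Centre Centre? (Halves.minimal G k Centre Centre? σ valid)
  where open HalfFactor hf

-- The edge count

n+2*nC2≡n*n : ∀ n → n + 2 * (n C 2) ≡ n * n
n+2*nC2≡n*n zero    = refl
n+2*nC2≡n*n (suc n) = begin
  suc n + 2 * (suc n C 2)       ≡⟨ cong (λ x → suc n + 2 * x) (≡sym (nCk+nC[k+1]≡[n+1]C[k+1] n 1)) ⟩
  suc n + 2 * (n C 1 + n C 2)   ≡⟨ cong (λ x → suc n + 2 * (x + n C 2)) (nC1≡n n) ⟩
  suc n + 2 * (n + n C 2)       ≡⟨ expand n (n C 2) ⟩
  1 + 2 * n + (n + 2 * (n C 2)) ≡⟨ cong (1 + 2 * n +_) (n+2*nC2≡n*n n) ⟩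
  1 + 2 * n + n * n             ≡⟨ square n ⟩
  suc n * suc n                 ∎
  where
  open ≡-Reasoning
  expand : ∀ a b → suc a + 2 * (a + b) ≡ 1 + 2 * a + (a + 2 * b)
  expand = solve-∀
  square : ∀ a → 1 + 2 * a + a * a ≡ suc a * suc a
  square = solve-∀

∑-× : {A : Fin m → Set} {B : Fin n → Set} (A? : ∀ x → Dec (A x)) (B? : ∀ y → Dec (B y)) →
  ∑ (λ x → ∑ (λ y → ⟦ A? x ×-dec B? y ⟧)) ≡ ∑ (λ x → ⟦ A? x ⟧) * ∑ (λ y → ⟦ B? y ⟧)
∑-× A? B? = trans (∑-cong row) (trans (∑-* b (λ x → ⟦ A? x ⟧)) (*-comm b _))
  where
  b = ∑ (λ y → ⟦ B? y ⟧)
  row : ∀ x → ∑ (λ y → ⟦ A? x ×-dec B? y ⟧) ≡ b * ⟦ A? x ⟧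
  row x with A? x
  ... | yes _ = ≡sym (*-identityʳ b)
  ... | no ¬a = trans (∑-zero (λ y → ⟦⟧-no (no ¬a ×-dec B? y) (¬a ∘ proj₁))) (≡sym (*-zeroʳ b))

2*edgeCount≤ : (G : SimpleGraph n) → 2 * edgeCount G ≤ ∑ (λ u → ∑ (λ v → ⟦ T? (Adj G u v) ⟧))
2*edgeCount≤ {n} G = begin
  2 * edgeCount G
    ≡⟨ cong (edgeCount G +_) (+-identityʳ _) ⟩
  edgeCount G + edgeCount G
    ≡⟨ cong₂ _+_ edgeCount≡ (trans edgeCount≡ (∑-swap (λ u v → ⟦ T? (up u v) ⟧))) ⟩
  ∑ (λ u → ∑ (λ v → ⟦ T? (up u v) ⟧)) + ∑ (λ u → ∑ (λ v → ⟦ T? (up v u) ⟧))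
    ≡⟨ ≡sym (∑-+ (λ u → ∑ (λ v → ⟦ T? (up u v) ⟧)) _) ⟩
  ∑ (λ u → ∑ (λ v → ⟦ T? (up u v) ⟧) + ∑ (λ v → ⟦ T? (up v u) ⟧))
    ≡⟨ ∑-cong (λ u → ≡sym (∑-+ (λ v → ⟦ T? (up u v) ⟧) _)) ⟩
  ∑ (λ u → ∑ (λ v → ⟦ T? (up u v) ⟧ + ⟦ T? (up v u) ⟧))
    ≤⟨ ∑-mono (λ u → ∑-mono (λ v → pointwise u v)) ⟩
  ∑ (λ u → ∑ (λ v → ⟦ T? (Adj G u v) ⟧)) ∎
  where
  open ≤-Reasoning
  up : Fin n → Fin n → Bool
  up u v = (toℕ u <ᵇ toℕ v) ∧ Adj G u v
  edgeCount≡ : edgeCount G ≡ ∑ (λ u → ∑ (λ v → ⟦ T? (up u v) ⟧))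
  edgeCount≡ = trans (lsum-allFin (λ u → count (up u))) (∑-cong (λ u → count-∑ (up u)))
  up⇒adj : ∀ u v → T (up u v) → T (Adj G u v)
  up⇒adj u v t = proj₂ (∧⁻ {toℕ u <ᵇ toℕ v} t)
  pointwise : ∀ u v → ⟦ T? (up u v) ⟧ + ⟦ T? (up v u) ⟧ ≤ ⟦ T? (Adj G u v) ⟧
  pointwise u v = by-cases (T? (up u v)) (T? (up v u)) (T? (Adj G u v))
    where
    by-cases : (d : Dec (T (up u v))) (d′ : Dec (T (up v u))) (a : Dec (T (Adj G u v))) → ⟦ d ⟧ + ⟦ d′ ⟧ ≤ ⟦ a ⟧
    by-cases (no _) d′ a = ⟦⟧-mono d′ a (λ t → subst T (SimpleGraph.sym G v u) (up⇒adj v u t))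
    by-cases (yes t) (yes t′) _ = ⊥-elim (<-asym (<ᵇ⇒< (toℕ u) (toℕ v) (proj₁ (∧⁻ {toℕ u <ᵇ toℕ v} t)))
                                                 (<ᵇ⇒< (toℕ v) (toℕ u) (proj₁ (∧⁻ {toℕ v <ᵇ toℕ u} t′))))
    by-cases (yes _) (no _) (yes _) = ≤-refl
    by-cases (yes t) (no _) (no ¬a) = ⊥-elim (¬a (up⇒adj u v t))

module _ {n} (G : SimpleGraph n) {J S : Fin n → Set} (J? : ∀ v → Dec (J v)) (S? : ∀ v → Dec (S v))
         (J⇒¬S : ∀ {v} → J v → ¬ S v) (J-nbr : ∀ {v w} → J v → T (Adj G v w) → S w) where

  private
    j c s : ℕ
    j = ∑ (λ v → ⟦ J? v ⟧)
    c = ∑ (λ v → ⟦ ¬? (J? v) ⟧)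
    s = ∑ (λ v → ⟦ S? v ⟧)

  complement-count : c + j ≡ n
  complement-count = trans (≡sym (∑-+ (λ v → ⟦ ¬? (J? v) ⟧) (λ v → ⟦ J? v ⟧))) (trans (∑-cong one) (trans (∑-const {n} 1) (*-identityʳ n)))
    where
    one : ∀ v → ⟦ ¬? (J? v) ⟧ + ⟦ J? v ⟧ ≡ 1
    one v with J? v
    ... | yes _ = refl
    ... | no _  = refl

  separator≤complement : s ≤ c
  separator≤complement = ∑-mono (λ v → ⟦⟧-mono (S? v) (¬? (J? v)) (λ sv jv → J⇒¬S jv sv))

  -- An ordered adjacent pair avoids `J` in both coordinates or lies in J × S or S × J. The summand
  -- `c` pays for the diagonal of the first block.
  isolated-edge-bound : c + 2 * edgeCount G ≤ c * c + 2 * (j * s)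
  isolated-edge-bound = begin
    c + 2 * edgeCount G
      ≤⟨ +-monoʳ-≤ c (2*edgeCount≤ G) ⟩
    c + ∑ (λ u → ∑ (λ v → ⟦ T? (Adj G u v) ⟧))
      ≡⟨ cong (_+ ∑ (λ u → ∑ (λ v → ⟦ T? (Adj G u v) ⟧))) (≡sym diagonal) ⟩
    ∑ (λ u → ∑ (λ v → ⟦ ¬? (J? u) ×-dec (u ≟ v) ⟧)) + ∑ (λ u → ∑ (λ v → ⟦ T? (Adj G u v) ⟧))
      ≡⟨ ∑∑-+ (λ u v → ⟦ ¬? (J? u) ×-dec (u ≟ v) ⟧) _ ⟩
    ∑ (λ u → ∑ (λ v → ⟦ ¬? (J? u) ×-dec (u ≟ v) ⟧ + ⟦ T? (Adj G u v) ⟧))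
      ≤⟨ ∑-mono (λ u → ∑-mono (λ v → pointwise u v)) ⟩
    ∑ (λ u → ∑ (λ v → ⟦ ¬? (J? u) ×-dec ¬? (J? v) ⟧ + (⟦ J? u ×-dec S? v ⟧ + ⟦ S? u ×-dec J? v ⟧)))
      ≡⟨ ≡sym (∑∑-+ (λ u v → ⟦ ¬? (J? u) ×-dec ¬? (J? v) ⟧) _) ⟩
    ∑ (λ u → ∑ (λ v → ⟦ ¬? (J? u) ×-dec ¬? (J? v) ⟧)) + ∑ (λ u → ∑ (λ v → ⟦ J? u ×-dec S? v ⟧ + ⟦ S? u ×-dec J? v ⟧))
      ≡⟨ cong₂ _+_ (∑-× (λ u → ¬? (J? u)) (λ v → ¬? (J? v)))
                   (trans (≡sym (∑∑-+ (λ u v → ⟦ J? u ×-dec S? v ⟧) _)) (cong₂ _+_ (∑-× J? S?) (∑-× S? J?))) ⟩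
    c * c + (j * s + s * j)
      ≡⟨ cong (λ x → c * c + (j * s + x)) (trans (*-comm s j) (≡sym (+-identityʳ _))) ⟩
    c * c + 2 * (j * s) ∎
    where
    open ≤-Reasoning
    ∑∑-+ : (f g : Fin n → Fin n → ℕ) →
      ∑ (λ u → ∑ (λ v → f u v)) + ∑ (λ u → ∑ (λ v → g u v)) ≡ ∑ (λ u → ∑ (λ v → f u v + g u v))
    ∑∑-+ f g = trans (≡sym (∑-+ (λ u → ∑ (f u)) (λ u → ∑ (g u)))) (∑-cong (λ u → ≡sym (∑-+ (f u) (g u))))
    diagonal : ∑ (λ u → ∑ (λ v → ⟦ ¬? (J? u) ×-dec (u ≟ v) ⟧)) ≡ c
    diagonal = ∑-cong (λ u → trans (∑-single (λ v → ⟦ ¬? (J? u) ×-dec (u ≟ v) ⟧) u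
                 (λ v v≢u → ⟦⟧-no (¬? (J? u) ×-dec (u ≟ v)) (λ { (_ , eq) → v≢u (≡sym eq) })))
                 (⟦⟧-cong (¬? (J? u) ×-dec (u ≟ u)) (¬? (J? u)) proj₁ (_, refl)))
    pointwise : ∀ u v → ⟦ ¬? (J? u) ×-dec (u ≟ v) ⟧ + ⟦ T? (Adj G u v) ⟧ ≤
                        ⟦ ¬? (J? u) ×-dec ¬? (J? v) ⟧ + (⟦ J? u ×-dec S? v ⟧ + ⟦ S? u ×-dec J? v ⟧)
    pointwise u v = by-cases (u ≟ v) (T? (Adj G u v)) (J? u) (J? v) (S? u) (S? v)
      where
      by-cases : (d : Dec (u ≡ v)) (a : Dec (T (Adj G u v))) (ju : Dec (J u)) (jv : Dec (J v)) (su : Dec (S u)) (sv : Dec (S v)) →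
        ⟦ ¬? ju ×-dec d ⟧ + ⟦ a ⟧ ≤ ⟦ ¬? ju ×-dec ¬? jv ⟧ + (⟦ ju ×-dec sv ⟧ + ⟦ su ×-dec jv ⟧)
      by-cases (yes refl) (yes a) _ _ _ _ = ⊥-elim (subst T (irrefl G u) a)
      by-cases (yes refl) (no _) (yes _) _ _ _ = z≤n
      by-cases (yes refl) (no _) (no ¬j) (yes j) _ _ = ⊥-elim (¬j j)
      by-cases (yes refl) (no _) (no _) (no _) _ _ = s≤s z≤n
      by-cases (no _) (no _) (yes _) _ _ _ = z≤n
      by-cases (no _) (no _) (no _) _ _ _ = z≤n
      by-cases (no _) (yes a) (yes ju) _ _ (yes _) = s≤s z≤n
      by-cases (no _) (yes a) (yes ju) _ _ (no ¬sv) = ⊥-elim (¬sv (J-nbr ju a))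
      by-cases (no _) (yes a) (no _) (yes jv) (yes _) _ = s≤s z≤n
      by-cases (no _) (yes a) (no _) (yes jv) (no ¬su) _ = ⊥-elim (¬su (J-nbr jv (subst T (SimpleGraph.sym G u v) a)))
      by-cases (no _) (yes a) (no _) (no _) _ _ = s≤s z≤n

∣tabulate∣ : (p : Fin n → Bool) → ∣ tabulate p ∣ ≡ ∑ (λ x → ⟦ T? (p x) ⟧)
∣tabulate∣ {zero}  p = refl
∣tabulate∣ {suc n} p with p zero
... | true  = cong suc (∣tabulate∣ (p ∘ suc))
... | false = ∣tabulate∣ (p ∘ suc)

-- Every edge at `v` ends in `S`, so deleting `S` cuts `v` off from any other remaining vertex. If
-- none remains, then n is at most |S| + 1, hence at most t, against t < n.
few-separators : ∀ {t} (G : SimpleGraph n) → TConnected t G → {J S : Fin n → Set} (S? : ∀ v → Dec (S v)) →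
  (∀ {v} → J v → ¬ S v) → (∀ {v w} → J v → T (Adj G v w) → S w) → ∑ (λ v → ⟦ S? v ⟧) < t → ∀ v → ¬ J v
few-separators {n} {t} G (t<n , connected) {J} {S} S? J⇒¬S J-nbr s<t v jv with any? (λ w → ¬? (w ≟ v) ×-dec ¬? (S? w))
... | yes (w , w≢v , ¬sw) = blocked (connected S′ (subst (_< t) (≡sym card) s<t) v w (outside (J⇒¬S jv)) (outside ¬sw))
  where
  S′ : Subset n
  S′ = tabulate (λ x → ⌊ S? x ⌋)
  card : ∣ S′ ∣ ≡ ∑ (λ x → ⟦ S? x ⟧)
  card = trans (∣tabulate∣ (λ x → ⌊ S? x ⌋)) (∑-cong (λ x → ⟦⟧-cong (T? ⌊ S? x ⌋) (S? x) (toWitness {a? = S? x}) (fromWitness {a? = S? x})))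
  outside : ∀ {x} → ¬ S x → x ∉ˢ S′
  outside {x} ¬sx x∈ = ¬sx (toWitness {a? = S? x} (subst T (≡sym (trans (≡sym (lookup∘tabulate _ x)) ([]=⇒lookup x∈))) tt))
  blocked : Walk (deleteAdj G S′) v w → ⊥
  blocked here = w≢v refl
  blocked (step {v = x} e _) = let a , q = ∧⁻ {Adj G v x} e in
    not⁻ {lookup S′ x} (proj₂ (∧⁻ {not (lookup S′ v)} q))
      (subst T (≡sym (lookup∘tabulate _ x)) (fromWitness {a? = S? x} (J-nbr jv a)))
... | no none = ⊥-elim (<-irrefl refl (begin-strict
    n                                              ≡⟨ ≡sym (trans (∑-const {n} 1) (*-identityʳ n)) ⟩
    ∑ {n} (λ _ → 1)                                ≤⟨ ∑-mono covered ⟩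
    ∑ (λ w → ⟦ v ≟ w ⟧ + ⟦ S? w ⟧)                 ≡⟨ ∑-+ (λ w → ⟦ v ≟ w ⟧) _ ⟩
    ∑ (λ w → ⟦ v ≟ w ⟧) + ∑ (λ w → ⟦ S? w ⟧)       ≡⟨ cong (_+ ∑ (λ w → ⟦ S? w ⟧)) (∑-δ v) ⟩
    suc (∑ (λ w → ⟦ S? w ⟧))                       ≤⟨ s<t ⟩
    t                                              <⟨ t<n ⟩
    n                                              ∎))
  where
  open ≤-Reasoning
  covered : ∀ w → 1 ≤ ⟦ v ≟ w ⟧ + ⟦ S? w ⟧
  covered w with v ≟ w | S? w
  ... | yes _ | _     = s≤s z≤n
  ... | no _  | yes _ = s≤s z≤n
  ... | no ne | no ¬s = ⊥-elim (none (w , ne ∘ ≡sym , ¬s))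

-- With s = t + δ, j = m + 1 + B and n - j = s + h, where m = ⌊(k + 1/2)t⌋, this is
-- what the edge bound for S, J and the edge bound for t, m + 1 differ by.
excess-bound : ∀ {k t m δ h B} → t < k → 2 * m ≤ (2 * k + 1) * t →
  (2 * k + 1) * (t + δ) < 2 * (m + 1 + B) →
  (2 * k * k + 5 * k + 1) * t + k * k + 5 * k + 2 ≤ 2 * k * (t + δ + h + (m + 1 + B)) →
  2 * (m + 1) * δ + B ≤ 2 * h * B + B * B
excess-bound {k} {t} {m} {δ} {h} {B} t<k m≤ many order = by-δ δ refl
  where
  open ≤-Reasoning
  δ<B : (2 * k + 1) * δ ≤ 2 * B + 1
  δ<B = +-cancelˡ-≤ (2 * m + 1) _ _ (begin
    2 * m + 1 + (2 * k + 1) * δ               ≤⟨ +-monoˡ-≤ _ (+-monoˡ-≤ 1 m≤) ⟩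
    (2 * k + 1) * t + 1 + (2 * k + 1) * δ     ≡⟨ lemma₁ k t δ ⟩
    suc ((2 * k + 1) * (t + δ))               ≤⟨ many ⟩
    2 * (m + 1 + B)                           ≡⟨ lemma₂ m B ⟩
    2 * m + 1 + (2 * B + 1)                   ∎)
    where
    lemma₁ : ∀ k t δ → (2 * k + 1) * t + 1 + (2 * k + 1) * δ ≡ suc ((2 * k + 1) * (t + δ))
    lemma₁ = solve-∀
    lemma₂ : ∀ m B → 2 * (m + 1 + B) ≡ 2 * m + 1 + (2 * B + 1)
    lemma₂ = solve-∀
  m≤n*n : ∀ a → a ≤ a * a
  m≤n*n zero    = z≤n
  m≤n*n (suc a) = m≤m+n (suc a) _
  by-δ : ∀ d → δ ≡ d → 2 * (m + 1) * δ + B ≤ 2 * h * B + B * B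
  by-δ 0 refl = begin
    2 * (m + 1) * 0 + B   ≡⟨ cong (_+ B) (*-zeroʳ (2 * (m + 1))) ⟩
    B                     ≤⟨ m≤n*n B ⟩
    B * B                 ≤⟨ m≤n+m (B * B) _ ⟩
    2 * h * B + B * B     ∎
  by-δ 1 refl = with-excess (m≤n⇒∃[o]m+o≡n k≤B)
    where
    k≤B : k ≤ B
    k≤B = 2*≤⇒≤ k B (≤-trans (≤-trans (m≤m+n (2 * k) 1) (≤-reflexive (≡sym (*-identityʳ (2 * k + 1))))) δ<B)
    -- The coefficient of t in the order hypothesis is (k + 1)(2k + 1) + 2k; its first part is
    -- traded for m through 2m ≤ (2k + 1)t.
    tight : k * k + k + 2 * (m + 1) ≤ 2 * k * (h + B)
    tight = +-cancelˡ-≤ (2 * k * m + 2 * k * t + 4 * k) _ _ (begin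
      2 * k * m + 2 * k * t + 4 * k + (k * k + k + 2 * (m + 1))
        ≡⟨ lemma₁ k m t ⟩
      (k + 1) * (2 * m) + (2 * k * t + k * k + 5 * k + 2)
        ≤⟨ +-monoˡ-≤ _ (*-monoʳ-≤ (k + 1) m≤) ⟩
      (k + 1) * ((2 * k + 1) * t) + (2 * k * t + k * k + 5 * k + 2)
        ≡⟨ lemma₂ k t ⟩
      (2 * k * k + 5 * k + 1) * t + k * k + 5 * k + 2
        ≤⟨ order ⟩
      2 * k * (t + 1 + h + (m + 1 + B))
        ≡⟨ lemma₃ k t h m B ⟩
      2 * k * m + 2 * k * t + 4 * k + 2 * k * (h + B) ∎)
      where
      lemma₁ : ∀ k m t → 2 * k * m + 2 * k * t + 4 * k + (k * k + k + 2 * (m + 1)) ≡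
                         (k + 1) * (2 * m) + (2 * k * t + k * k + 5 * k + 2)
      lemma₁ = solve-∀
      lemma₂ : ∀ k t → (k + 1) * ((2 * k + 1) * t) + (2 * k * t + k * k + 5 * k + 2) ≡
                       (2 * k * k + 5 * k + 1) * t + k * k + 5 * k + 2
      lemma₂ = solve-∀
      lemma₃ : ∀ k t h m B → 2 * k * (t + 1 + h + (m + 1 + B)) ≡ 2 * k * m + 2 * k * t + 4 * k + 2 * k * (h + B)
      lemma₃ = solve-∀
    with-excess : (∃ λ r → k + r ≡ B) → 2 * (m + 1) * 1 + B ≤ 2 * h * B + B * B
    -- Adding k² + k makes `tight` applicable; beyond it only r ≤ r² is needed.
    with-excess (r , refl) = +-cancelˡ-≤ (k * k + k) _ _ (begin
      k * k + k + (2 * (m + 1) * 1 + (k + r))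
        ≡⟨ lemma₁ k m r ⟩
      k * k + k + 2 * (m + 1) + (k + r)
        ≤⟨ +-mono-≤ tight (+-monoʳ-≤ k (m≤n*n r)) ⟩
      2 * k * (h + (k + r)) + (k + r * r)
        ≤⟨ m≤m+n _ (2 * r * h) ⟩
      2 * k * (h + (k + r)) + (k + r * r) + 2 * r * h
        ≡⟨ lemma₂ k h r ⟩
      k * k + k + (2 * h * (k + r) + (k + r) * (k + r)) ∎)
      where
      lemma₁ : ∀ k m r → k * k + k + (2 * (m + 1) * 1 + (k + r)) ≡ k * k + k + 2 * (m + 1) + (k + r)
      lemma₁ = solve-∀
      lemma₂ : ∀ k h r → 2 * k * (h + (k + r)) + (k + r * r) + 2 * r * h ≡
                         k * k + k + (2 * h * (k + r) + (k + r) * (k + r))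
      lemma₂ = solve-∀
  by-δ (suc (suc d)) refl = with-excess (m≤n⇒∃[o]m+o≡n kδ<B) (m≤n⇒∃[o]m+o≡n t<k)
    where
    -- From δ = 2 on the half units add up to a whole one, which yields the extra 1.
    kδ<B : k * δ + 1 ≤ B
    kδ<B = 2*≤⇒≤ (k * δ + 1) B (begin
      2 * (k * (2 + d) + 1)               ≤⟨ m≤m+n _ d ⟩
      2 * (k * (2 + d) + 1) + d           ≡⟨ lemma k d ⟩
      (2 * k + 1) * (2 + d)               ≤⟨ δ<B ⟩
      2 * B + 1                           ∎)
      where
      lemma : ∀ k d → 2 * (k * (2 + d) + 1) + d ≡ (2 * k + 1) * (2 + d)
      lemma = solve-∀
    with-excess : (∃ λ r → k * δ + 1 + r ≡ B) → (∃ λ q → suc t + q ≡ k) →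
      2 * (m + 1) * δ + B ≤ 2 * h * B + B * B
    with-excess (r , refl) (q , refl) = begin
      2 * (m + 1) * (2 + d) + B
        ≡⟨ lemma₁ m d B ⟩
      2 * m * (2 + d) + (2 * (2 + d) + B)
        ≤⟨ +-monoˡ-≤ _ (*-monoˡ-≤ (2 + d) m≤) ⟩
      (2 * k + 1) * t * (2 + d) + (2 * (2 + d) + B)
        ≤⟨ m≤m+n _ rest′ ⟩
      (2 * k + 1) * t * (2 + d) + (2 * (2 + d) + B) + rest′
        ≡⟨ lemma₂ t q d r ⟩
      B * B
        ≤⟨ m≤n+m (B * B) _ ⟩
      2 * h * B + B * B ∎
      where
      -- The gap to B² after substituting k = t + 1 + q and B = kδ + 1 + r. Here t < k is what lets
      -- it be written without negative terms.
      rest′ : ℕ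
      rest′ = (2 + d) * (k * k * d + 2 * k * q + 2 * t + 3 * q + 1) + r * (2 * (k * (2 + d)) + 1 + r)
      lemma₁ : ∀ m d B → 2 * (m + 1) * (2 + d) + B ≡ 2 * m * (2 + d) + (2 * (2 + d) + B)
      lemma₁ = solve-∀
      lemma₂ : ∀ t q d r → let k = suc t + q ; B = k * (2 + d) + 1 + r in
        (2 * k + 1) * t * (2 + d) + (2 * (2 + d) + B) +
        ((2 + d) * (k * k * d + 2 * k * q + 2 * t + 3 * q + 1) + r * (2 * (k * (2 + d)) + 1 + r)) ≡ B * B
      lemma₂ = solve-∀

-- A violation with |S| at least t forces |J| to be at least M + 1, so δ, h and B are natural
-- numbers and n - M - 1 exceeds the complement of `J` by exactly B.
isolation-bound : ∀ {k t} → 2 ≤ k → t ≤ k ∸ 1 → (G : SimpleGraph n) → TConnected t G →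
  (2 * k * k + 5 * k + 1) * t + k * k + 5 * k + 2 ≤ 2 * k * n →
  ((n ∸ ((2 * k + 1) * t) / 2 ∸ 1) C 2) + t * (((2 * k + 1) * t) / 2 + 1) < edgeCount G →
  IsolationBound k G
isolation-bound {n} {k} {t} 2≤k t≤ G connected order dense {J} {S} J? S? J⇒¬S J-nbr = by-size (s <? t)
  where
  j s c M : ℕ
  j = ∑ (λ v → ⟦ J? v ⟧)
  s = ∑ (λ v → ⟦ S? v ⟧)
  c = ∑ (λ v → ⟦ ¬? (J? v) ⟧)
  M = ((2 * k + 1) * t) / 2
  t<k : t < k
  t<k = ≤-trans (s≤s t≤) (≤-reflexive (m+[n∸m]≡n (≤-trans (s≤s z≤n) 2≤k)))
  2m≤ : 2 * M ≤ (2 * k + 1) * t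
  2m≤ = ≤-trans (≤-reflexive (*-comm 2 M)) (m/n*n≤m ((2 * k + 1) * t) 2)
  c+j≡n : c + j ≡ n
  c+j≡n = complement-count G J? S? J⇒¬S J-nbr
  by-size : Dec (s < t) → 2 * j ≤ (2 * k + 1) * s
  by-size (yes s<t) = ≤-trans (≤-reflexive (trans (cong (2 *_) (∑-zero (λ v → ⟦⟧-no (J? v) (few-separators G connected S? J⇒¬S J-nbr s<t v)))) (*-zeroʳ 2))) z≤n
  by-size (no s≮t) = ≮⇒≥ (λ many → contradict many (m≤n⇒∃[o]m+o≡n (≮⇒≥ s≮t))
                                     (m≤n⇒∃[o]m+o≡n (separator≤complement G J? S? J⇒¬S J-nbr))
                                     (m≤n⇒∃[o]m+o≡n (m<j many)))
    where
    m<j : (2 * k + 1) * s < 2 * j → M + 1 ≤ j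
    m<j many = ≤-trans (≤-reflexive (+-comm M 1)) (*-cancelˡ-< 2 M j
      (≤-trans (s≤s (≤-trans 2m≤ (*-monoʳ-≤ (2 * k + 1) (≮⇒≥ s≮t)))) many))
    contradict : (2 * k + 1) * s < 2 * j → (∃ λ δ → t + δ ≡ s) → (∃ λ h → s + h ≡ c) → (∃ λ B → M + 1 + B ≡ j) → ⊥
    contradict many (δ , δ≡) (h , h≡) (B , B≡) = finish (edgeCount G) dense edges
      where
      a : ℕ
      a = t + δ + h + B
      a≡ : n ∸ M ∸ 1 ≡ a
      a≡ = trans (∸-+-assoc n M 1) (trans (cong (_∸ (M + 1)) n≡) (m+n∸n≡m a (M + 1)))
        where
        regroup : ∀ x B M → x + (M + 1 + B) ≡ x + B + (M + 1)
        regroup = solve-∀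
        n≡ : n ≡ a + (M + 1)
        n≡ = trans (≡sym c+j≡n) (trans (cong₂ _+_ (trans (≡sym h≡) (cong (_+ h) (≡sym δ≡))) (≡sym B≡)) (regroup (t + δ + h) B M))
      c≡ : c ≡ t + δ + h
      c≡ = trans (≡sym h≡) (cong (_+ h) (≡sym δ≡))
      excess : 2 * (M + 1) * δ + B ≤ 2 * h * B + B * B
      excess = excess-bound {k} {t} {M} {δ} {h} {B} t<k 2m≤
        (subst₂ (λ x y → (2 * k + 1) * x < 2 * y) (≡sym δ≡) (≡sym B≡) many)
        (subst (λ x → (2 * k * k + 5 * k + 1) * t + k * k + 5 * k + 2 ≤ 2 * k * x)
               (trans (≡sym c+j≡n) (cong₂ _+_ c≡ (≡sym B≡))) order)
      edges : t + δ + h + 2 * edgeCount G ≤ (t + δ + h) * (t + δ + h) + 2 * ((M + 1 + B) * (t + δ))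
      edges = subst₂ (λ x y → x + 2 * edgeCount G ≤ x * x + 2 * y) c≡ (cong₂ _*_ (≡sym B≡) (≡sym δ≡))
                     (isolated-edge-bound G J? S? J⇒¬S J-nbr)
      -- Both edge bounds are doubled, to remove the binomial coefficient, and padded by `x` and
      -- `a`, to avoid subtraction. The chain returns to its first term with one strict step.
      finish : ∀ E → ((n ∸ M ∸ 1) C 2) + t * (M + 1) < E →
               t + δ + h + 2 * E ≤ (t + δ + h) * (t + δ + h) + 2 * ((M + 1 + B) * (t + δ)) → ⊥
      finish E dense edges rewrite a≡ = <-irrefl refl (begin-strict
        a * a + 2 * (t * (M + 1)) + x
          ≡⟨ cong (λ y → y + 2 * (t * (M + 1)) + x) (≡sym (n+2*nC2≡n*n a)) ⟩
        a + 2 * (a C 2) + 2 * (t * (M + 1)) + x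
          ≡⟨ regroup a (a C 2) (t * (M + 1)) x ⟩
        2 * (a C 2 + t * (M + 1)) + (x + a)
          <⟨ +-monoˡ-< (x + a) (*-monoʳ-< 2 dense) ⟩
        2 * E + (x + a)
          ≡⟨ swap E x a ⟩
        x + 2 * E + a
          ≤⟨ +-monoˡ-≤ a edges ⟩
        x * x + 2 * ((M + 1 + B) * (t + δ)) + a
          ≡⟨ expand t δ h B M ⟩
        x * x + 2 * (t + δ) * B + 2 * (t * (M + 1)) + x + (2 * (M + 1) * δ + B)
          ≤⟨ +-monoʳ-≤ (x * x + 2 * (t + δ) * B + 2 * (t * (M + 1)) + x) excess ⟩
        x * x + 2 * (t + δ) * B + 2 * (t * (M + 1)) + x + (2 * h * B + B * B)
          ≡⟨ collect t δ h B M ⟩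
        a * a + 2 * (t * (M + 1)) + x ∎)
        where
        open ≤-Reasoning
        x : ℕ
        x = t + δ + h
        regroup : ∀ a b c x → a + 2 * b + 2 * c + x ≡ 2 * (b + c) + (x + a)
        regroup = solve-∀
        swap : ∀ E x a → 2 * E + (x + a) ≡ x + 2 * E + a
        swap = solve-∀
        expand : ∀ t δ h B M → (t + δ + h) * (t + δ + h) + 2 * ((M + 1 + B) * (t + δ)) + (t + δ + h + B) ≡
          (t + δ + h) * (t + δ + h) + 2 * (t + δ) * B + 2 * (t * (M + 1)) + (t + δ + h) + (2 * (M + 1) * δ + B)
        expand = solve-∀
        collect : ∀ t δ h B M →
          (t + δ + h) * (t + δ + h) + 2 * (t + δ) * B + 2 * (t * (M + 1)) + (t + δ + h) + (2 * h * B + B * B) ≡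
          (t + δ + h + B) * (t + δ + h + B) + 2 * (t * (M + 1)) + (t + δ + h)
        collect = solve-∀

theorem1p3 : (k t n : ℕ) → 2 ≤ k → 1 ≤ t → t ≤ k ∸ 1 →
    (G : SimpleGraph n) → TConnected t G →
    (2 * k * k + 5 * k + 1) * t + k * k + 5 * k + 2 ≤ 2 * k * n →
    ((n ∸ ((2 * k + 1) * t) / 2 ∸ 1) C 2) + t * (((2 * k + 1) * t) / 2 + 1) < edgeCount G →
    HasStarTreeFactor k G
theorem1p3 k t n 2≤k _ t≤ G connected order dense =
  half-factor⇒star-tree-factor k 2≤k G
    (half-factor G k 2≤k (isolation-bound 2≤k t≤ G connected order dense))
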